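{- For each integer $n$ let $K_n=\mathbb{Q}(\theta_n)$, where $\theta_n$ is a root of $$f_n(x)=x^5+n^2x^4-(2n^3+6n^2+10n+10)x^3+(n^4+5n^3+11n^2+15n+5)x^2+(n^3+4n^2+10n+10)x+1,$$ and let $m_n=n^4+5n^3+15n^2+25n+25$. If $m_n$ is cube-free and $5\mid n$, then $K_n$ is not monogenic (there is no $\theta\in\mathcal{O}_{K_n}$ with $\mathcal{O}_{K_n}=\mathbb{Z}[\theta]$) and $I(K_n)=1$.
   Context: For a number field $K$ and a primitive element $\theta\in\mathcal{O}_K$ (i.e. $K=\mathbb{Q}(\theta)$), the index of $\theta$ is $I(\theta)=[\mathcal{O}_K:\mathbb{Z}[\theta]]$. The index of $K$ is $I(K)=\gcd\{I(\theta): \theta\in\mathcal{O}_K,\ K=\mathbb{Q}(\theta)\}$. -}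

module Defs where

open import Data.Nat using (ℕ; _^_)
open import Data.Nat.Divisibility as ℕD using ()
open import Data.Integer as Int using (ℤ; +_; ∣_∣)
open import Data.Integer.Divisibility as ℤD using ()
open import Data.Rational as Rat using (ℚ; 0ℚ; 1ℚ; _/_)
open import Data.List using (List; []; _∷_; map; _++_)
open import Data.Vec using (Vec; []; _∷_; toList; zipWith)
open import Data.Product using (Σ; ∃; _×_; _,_)
open import Data.Fin using (Fin)
open import Relation.Binary.PropositionalEquality using (_≡_)
open import Relation.Nullary using (¬_)

module Coeffs (n : ℤ) where
  open Int using (_+_; _*_; -_)
  c4 c3 c2 c1 c0 : ℤ
  c4 = n * n
  c3 = - (+ 2 * n * n * n + + 6 * n * n + + 10 * n + + 10)
  c2 = n * n * n * n + + 5 * n * n * n + + 11 * n * n + + 15 * n + + 5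
  c1 = n * n * n + + 4 * n * n + + 10 * n + + 10
  c0 = + 1

m : ℤ → ℤ
m n = n * n * n * n + + 5 * n * n * n + + 15 * n * n + + 25 * n + + 25
  where open Int using (_+_; _*_)

CubeFree : ℤ → Set
CubeFree z = (k : ℕ) → (k ^ 3) ℕD.∣ ∣ z ∣ → k ≡ 1

toℚ : ℤ → ℚ
toℚ z = z / 1

-- The field K_n = Q(θ_n) ≅ Q[x]/(f_n), elements represented by their
-- coordinates (a0,…,a4) w.r.t. the basis 1, θ_n, …, θ_n^4.
module Field (n : ℤ) where
  open Coeffs n
  open Rat using (_+_; _*_; _-_)

  K : Set
  K = Vec ℚ 5

  0K : K
  0K = 0ℚ ∷ 0ℚ ∷ 0ℚ ∷ 0ℚ ∷ 0ℚ ∷ []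

  const : ℚ → K
  const q = q ∷ 0ℚ ∷ 0ℚ ∷ 0ℚ ∷ 0ℚ ∷ []

  θn : K
  θn = 0ℚ ∷ 1ℚ ∷ 0ℚ ∷ 0ℚ ∷ 0ℚ ∷ []

  _+K_ : K → K → K
  _+K_ = zipWith _+_

  _-K_ : K → K → K
  _-K_ = zipWith _-_

  scale : ℚ → K → K
  scale q = Data.Vec.map (q *_)

  -- multiplication by θ_n, using θ_n^5 = -(c4 θ^4 + c3 θ^3 + c2 θ^2 + c1 θ + c0)
  mulθ : K → K
  mulθ (a0 ∷ a1 ∷ a2 ∷ a3 ∷ a4 ∷ []) =
    (0ℚ - a4 * toℚ c0) ∷ (a0 - a4 * toℚ c1) ∷ (a1 - a4 * toℚ c2)
      ∷ (a2 - a4 * toℚ c3) ∷ (a3 - a4 * toℚ c4) ∷ []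

  mulAux : List ℚ → K → K
  mulAux [] y = 0K
  mulAux (a ∷ as) y = scale a y +K mulθ (mulAux as y)

  _*K_ : K → K → K
  x *K y = mulAux (toList x) y

  evalℚ : List ℚ → K → K
  evalℚ [] α = 0K
  evalℚ (c ∷ cs) α = const c +K (α *K evalℚ cs α)

  evalℤ : List ℤ → K → K
  evalℤ cs α = evalℚ (map toℚ cs) α

  Integral : K → Set
  Integral α = Σ (List ℤ) λ cs → evalℚ (map toℚ cs ++ (1ℚ ∷ [])) α ≡ 0K

  InZθ : K → K → Set
  InZθ θ α = Σ (List ℤ) λ p → evalℤ p θ ≡ α

  Primitive : K → Set
  Primitive θ = (β : K) → Σ (List ℚ) λ p → evalℚ p θ ≡ β

  Monogenic : Set
  Monogenic = Σ K λ θ → Integral θ × ((α : K) → Integral α → InZθ θ α)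

  IndexIs : K → ℕ → Set
  IndexIs θ d =
    Σ (Fin d → K) λ r →
      ((i : Fin d) → Integral (r i))
      × ((i j : Fin d) → InZθ θ (r i -K r j) → i ≡ j)
      × ((α : K) → Integral α → Σ (Fin d) λ i → InZθ θ (α -K r i))

  -- I(K) = 1 : gcd of all indices I(θ) (θ ∈ O_K primitive) is 1,
  -- i.e. every common divisor of these indices divides 1.
  FieldIndexOne : Set
  FieldIndexOne =
    (g : ℕ) →
      ((θ : K) (d : ℕ) → Integral θ → Primitive θ → IndexIs θ d → g ℕD.∣ d) →
      g ℕD.∣ 1

{-# OPTIONS --safe #-}
module Submission where

-- K is cyclic over ℚ, with an explicit generator σ of its Galois group. An element x is integral iff some N ≠ 0 satisfies
-- N xᵏ ∈ ℤ[θ] for all k (its characteristic polynomial ∏ (X − σʲx) then has coefficients in ℤ); such x visibly form a ring A.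
--
-- Non-monogenicity (after Gras): since 5 ∣ n, the prime 5 is totally ramified. If A = ℤ[α], then ε = σ a / a with a = σα − α
-- is a unit of norm 1, hence ε ≡ 1 modulo the prime above 5, and 1 + ε = (σ²α − α) / a is a unit too; but its norm is
-- congruent to 2⁵ ≡ 2 modulo 5.
--
-- Index one: for each prime p there is a generator α with A ⊆ ℤ₍ₚ₎[α], so that p does not divide the index of α. With
-- D = n³ + 5n² + 10n + 7 and T = n² + 5θ, one takes α = θ if p ∤ D m and α = θ / σ⁴θ if p ∣ D (by a discriminant argument with
-- the trace form), and a root of an Eisenstein polynomial if p ∣ m: θ + 1 for p = 5, T if p ∥ m, and T³ / p if p² ∥ m.
-- The goal g ∣ 1 is decidable, so the representatives of A / ℤ[α] need only be found up to double negation.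

open import Defs
open import Data.Nat as ℕ using (ℕ; zero; suc)
import Data.Nat.Properties as ℕₚ
open import Data.Nat.Divisibility as ℕD using (_∣?_)
import Data.Nat.Coprimality as Cop
open import Data.Integer as ℤ using (ℤ; ∣_∣) renaming (+_ to pos)
import Data.Integer.Properties as ℤₚ
open import Data.Rational as ℚ using (ℚ; 0ℚ; 1ℚ; mkℚ; ↥_; ↧_; ↧ₙ_; toℚᵘ)
import Data.Rational.Properties as ℚₚ
open import Data.Rational.Unnormalised.Base as ℚᵘ using (ℚᵘ; mkℚᵘ; *≡*)
import Data.Rational.Unnormalised.Properties as ℚᵘₚ
open import Data.Product using (Σ; _×_; _,_; proj₁; proj₂)
open import Data.Sum using (inj₁; inj₂; _⊎_)
open import Data.Empty using (⊥)
open import Relation.Binary.PropositionalEquality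
open import Algebra.Bundles using (CommutativeRing; RawRing)
import Algebra.Properties.Group
open import Data.Rational.Solver as ℚSolver using (module +-*-Solver)
open import Relation.Nullary using (¬_; yes; no; Dec; contradiction; ¬?)
open import Level using (0ℓ)
open import Data.List as List using (List; []; _∷_; length; _++_)
open import Data.Vec as Vec using (Vec; []; _∷_; toList; zipWith; lookup)
import Data.Vec.Properties as Vecₚ
open import Algebra.Structures using (IsCommutativeRing)
open import Data.Maybe using (Maybe; just; nothing)
open import Algebra.Solver.Ring.AlmostCommutativeRing using (AlmostCommutativeRing; fromCommutativeRing; _-Raw-AlmostCommutative⟶_)
import Algebra.Solver.Ring
import Algebra.Properties.Ring
open import Data.Nat.Primality using (Prime; euclidsLemma; prime⇒nonZero; prime?; prime⇒irreducible; prime[2])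
open import Data.Fin as Fin using (Fin; zero; suc; toℕ; combine; remQuot; punchIn)
open import Relation.Nullary.Decidable using (from-no; from-yes; decidable-stable)
open import Function using (_∘_)
open import Data.Nat.Induction using (<-rec)
open import Data.Nat.GCD using (module Bézout)
import Data.Integer.DivMod as ℤDM
import Data.Integer.Solver as ℤSolver
import Data.Fin.Properties as Finₚ
import Algebra.Properties.CommutativeMonoid.Sum
import Algebra.Properties.Semiring.Sum
open import Data.Bool using (Bool; true; false; T; _∧_)
open import Data.Unit using (tt)
open import Data.Nat.Primality.Factorisation using (factorise; module PrimeFactorisation)
open import Data.List.Relation.Unary.All as All using ()
open import Data.Fin.Patterns using (0F; 1F; 2F; 3F; 4F)

-- The choices at p ∣ m are read off from valuations. A prime p ∣ m is totally ramified; normalise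
-- the valuation v above p by v(p) = 5. Since Tr θ = -n², the element T = 5θ + n² is 5 (θ - Tr θ /
-- 5), of trace 0, and all lower coefficients of its polynomial are divisible by m. For p ≠ 5 its
-- norm has the same p-part as m, so v(T) is 1 or 2 because m is cube-free. In the second case v(T³
-- / p) = 6 - 5 = 1, and an element of valuation 1 has an Eisenstein polynomial. At p = 5 the factor
-- 5 spoils T, but f_n ≡ (X + 1)⁵ modulo 5. At p ∣ D the order ℤ[θ] is not good enough. As θ has
-- norm -1, quotients of its conjugates are integral again, and the index polynomial of θ / σ⁴θ has
-- only the prime 5 in common with D, while 5 ∤ D. The mutual divisibility of σα - α and σ²α - α
-- comes from σ and σ² both generating the Galois group.

module GroupP = Algebra.Properties.Group (CommutativeRing.+-group ℚₚ.+-*-commutativeRing)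
module ℤGroup = Algebra.Properties.Group (CommutativeRing.+-group ℤₚ.+-*-commutativeRing)

-- Rational integers in ℚ

toℚᵘ-toℚ : ∀ z → toℚᵘ (toℚ z) ℚᵘ.≃ mkℚᵘ z 0
toℚᵘ-toℚ z = ℚₚ.toℚᵘ-fromℚᵘ (mkℚᵘ z 0)

toℚ-+ : ∀ a b → toℚ (a ℤ.+ b) ≡ toℚ a ℚ.+ toℚ b
toℚ-+ a b = ℚₚ.toℚᵘ-injective (begin
  toℚᵘ (toℚ (a ℤ.+ b)) ≈⟨ toℚᵘ-toℚ (a ℤ.+ b) ⟩
  mkℚᵘ (a ℤ.+ b) 0 ≈⟨ *≡* (cong (ℤ._* pos 1) (sym (cong₂ ℤ._+_ (ℤₚ.*-identityʳ a) (ℤₚ.*-identityʳ b)))) ⟩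
  mkℚᵘ a 0 ℚᵘ.+ mkℚᵘ b 0 ≈⟨ ℚᵘₚ.+-cong (toℚᵘ-toℚ a) (toℚᵘ-toℚ b) ⟨
  toℚᵘ (toℚ a) ℚᵘ.+ toℚᵘ (toℚ b) ≈⟨ ℚₚ.toℚᵘ-homo-+ (toℚ a) (toℚ b) ⟨
  toℚᵘ (toℚ a ℚ.+ toℚ b) ∎)
  where open ℚᵘₚ.≃-Reasoning

toℚ-* : ∀ a b → toℚ (a ℤ.* b) ≡ toℚ a ℚ.* toℚ b
toℚ-* a b = ℚₚ.toℚᵘ-injective (begin
  toℚᵘ (toℚ (a ℤ.* b)) ≈⟨ toℚᵘ-toℚ (a ℤ.* b) ⟩
  mkℚᵘ (a ℤ.* b) 0 ≈⟨ *≡* refl ⟩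
  mkℚᵘ a 0 ℚᵘ.* mkℚᵘ b 0 ≈⟨ ℚᵘₚ.*-cong (toℚᵘ-toℚ a) (toℚᵘ-toℚ b) ⟨
  toℚᵘ (toℚ a) ℚᵘ.* toℚᵘ (toℚ b) ≈⟨ ℚₚ.toℚᵘ-homo-* (toℚ a) (toℚ b) ⟨
  toℚᵘ (toℚ a ℚ.* toℚ b) ∎)
  where open ℚᵘₚ.≃-Reasoning

toℚ-injective : ∀ {a b} → toℚ a ≡ toℚ b → a ≡ b
toℚ-injective {a} {b} eq with ℚᵘₚ.≃-trans (ℚᵘₚ.≃-sym (toℚᵘ-toℚ a)) (ℚᵘₚ.≃-trans (ℚᵘₚ.≃-reflexive (cong toℚᵘ eq)) (toℚᵘ-toℚ b))
... | *≡* e = trans (sym (ℤₚ.*-identityʳ a)) (trans e (ℤₚ.*-identityʳ b))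

toℚ-neg : ∀ a → toℚ (ℤ.- a) ≡ ℚ.- toℚ a
toℚ-neg a = GroupP.inverseˡ-unique (toℚ (ℤ.- a)) (toℚ a)
  (trans (sym (toℚ-+ (ℤ.- a) a)) (cong toℚ (ℤₚ.+-inverseˡ a)))

toℚ-minus : ∀ a b → toℚ (a ℤ.- b) ≡ toℚ a ℚ.- toℚ b
toℚ-minus a b = trans (toℚ-+ a (ℤ.- b)) (cong (toℚ a ℚ.+_) (toℚ-neg b))

IsInt : ℚ → Set
IsInt q = Σ ℤ λ z → q ≡ toℚ z

int-+ : ∀ {p q} → IsInt p → IsInt q → IsInt (p ℚ.+ q)
int-+ (a , refl) (b , refl) = a ℤ.+ b , sym (toℚ-+ a b)

int-* : ∀ {p q} → IsInt p → IsInt q → IsInt (p ℚ.* q)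
int-* (a , refl) (b , refl) = a ℤ.* b , sym (toℚ-* a b)

int-neg : ∀ {p} → IsInt p → IsInt (ℚ.- p)
int-neg (a , refl) = ℤ.- a , sym (toℚ-neg a)

int-toℚ : ∀ z → IsInt (toℚ z)
int-toℚ z = z , refl

toℚ-↥ : ∀ q → toℚ (↧ q) ℚ.* q ≡ toℚ (↥ q)
toℚ-↥ q@record{} = ℚₚ.toℚᵘ-injective (begin
  toℚᵘ (toℚ (↧ q) ℚ.* q) ≈⟨ ℚₚ.toℚᵘ-homo-* (toℚ (↧ q)) q ⟩
  toℚᵘ (toℚ (↧ q)) ℚᵘ.* toℚᵘ q ≈⟨ ℚᵘₚ.*-cong (toℚᵘ-toℚ (↧ q)) (ℚᵘₚ.≃-refl {toℚᵘ q}) ⟩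
  mkℚᵘ (↧ q) 0 ℚᵘ.* toℚᵘ q ≈⟨ *≡* (trans (ℤₚ.*-identityʳ _) (trans (ℤₚ.*-comm (↧ q) (↥ q)) (cong (λ t → ↥ q ℤ.* pos t) (sym (ℕₚ.+-identityʳ (↧ₙ q)))))) ⟩
  mkℚᵘ (↥ q) 0 ≈⟨ toℚᵘ-toℚ (↥ q) ⟨
  toℚᵘ (toℚ (↥ q)) ∎)
  where open ℚᵘₚ.≃-Reasoning

denominator-one : ∀ q → ↧ₙ q ≡ 1 → IsInt q
denominator-one q e = ↥ q , trans (sym (ℚₚ.*-identityˡ q))
  (trans (cong (λ t → toℚ (pos t) ℚ.* q) (sym e)) (toℚ-↥ q))

reduced : ∀ q → Cop.Coprime ∣ ↥ q ∣ (↧ₙ q)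
reduced (mkℚ a b c) = Cop.recompute c

infixr 8 _^Q_
_^Q_ : ℚ → ℕ → ℚ
q ^Q zero = 1ℚ
q ^Q suc k = q ℚ.* q ^Q k

coprime-^ʳ : ∀ {m n} k → Cop.Coprime m n → Cop.Coprime m (n ℕ.^ k)
coprime-^ʳ zero c (_ , d) = ℕD.∣1⇒≡1 d
coprime-^ʳ {m} {n} (suc k) c {d} (d∣m , d∣n) = coprime-^ʳ k c (d∣m ,
  Cop.coprime-divisor {d} {n} (λ (e∣d , e∣n) → c (ℕD.∣-trans e∣d d∣m , e∣n)) d∣n)

coprime-^ : ∀ {m n} j k → Cop.Coprime m n → Cop.Coprime (m ℕ.^ j) (n ℕ.^ k)
coprime-^ j k c = Cop.sym (coprime-^ʳ j (Cop.sym (coprime-^ʳ k c)))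

n<2^n : ∀ n → n ℕ.< 2 ℕ.^ n
n<2^n zero = ℕ.s≤s ℕ.z≤n
n<2^n (suc n) = ℕₚ.<-≤-trans (ℕ.s≤s (n<2^n n))
  (ℕₚ.≤-trans (ℕₚ.+-monoˡ-≤ (2 ℕ.^ n) (ℕₚ.≤-trans (ℕ.s≤s ℕ.z≤n) (n<2^n n)))
    (ℕₚ.+-monoʳ-≤ (2 ℕ.^ n) (ℕₚ.≤-reflexive (sym (ℕₚ.+-identityʳ (2 ℕ.^ n))))))

∣∣-^ : ∀ z k → ∣ z ℤ.^ k ∣ ≡ ∣ z ∣ ℕ.^ k
∣∣-^ z zero = refl
∣∣-^ z (suc k) = trans (ℤₚ.∣i*j∣≡∣i∣*∣j∣ z (z ℤ.^ k)) (cong (∣ z ∣ ℕ.*_) (∣∣-^ z k))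

pow-clear : ∀ q k → toℚ ((↧ q) ℤ.^ k) ℚ.* q ^Q k ≡ toℚ ((↥ q) ℤ.^ k)
pow-clear q zero = ℚₚ.*-identityˡ 1ℚ
pow-clear q (suc k) = begin
  toℚ (↧ q ℤ.* ↧ q ℤ.^ k) ℚ.* (q ℚ.* q ^Q k)
    ≡⟨ cong (ℚ._* (q ℚ.* q ^Q k)) (toℚ-* (↧ q) (↧ q ℤ.^ k)) ⟩
  (toℚ (↧ q) ℚ.* toℚ (↧ q ℤ.^ k)) ℚ.* (q ℚ.* q ^Q k)
    ≡⟨ solve 4 (λ a b c d → (a :* b) :* (c :* d) := (a :* c) :* (b :* d)) refl (toℚ (↧ q)) (toℚ (↧ q ℤ.^ k)) q (q ^Q k) ⟩
  (toℚ (↧ q) ℚ.* q) ℚ.* (toℚ (↧ q ℤ.^ k) ℚ.* q ^Q k)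
    ≡⟨ cong₂ ℚ._*_ (toℚ-↥ q) (pow-clear q k) ⟩
  toℚ (↥ q) ℚ.* toℚ (↥ q ℤ.^ k) ≡⟨ toℚ-* (↥ q) (↥ q ℤ.^ k) ⟨
  toℚ (↥ q ℤ.^ suc k) ∎
  where open ≡-Reasoning
        open +-*-Solver

-- With q = a / b in lowest terms, bᵏ divides N aᵏ and hence N, for every k. If b ≥ 2, the exponent
-- k = ∣N∣ contradicts ∣N∣ < 2^∣N∣.
almost-integral-rational : ∀ q N → N ≢ pos 0 → (∀ k → IsInt (toℚ N ℚ.* q ^Q k)) → IsInt q
almost-integral-rational q N N≢0 h = denominator-one q (b≡1 (↧ₙ q) refl)
  where
  open ≡-Reasoning
  open +-*-Solver
  c : Cop.Coprime (↧ₙ q) ∣ ↥ q ∣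
  c = Cop.sym (reduced q)
  b^k∣N : ∀ k → (↧ₙ q ℕ.^ k) ℕD.∣ ∣ N ∣
  b^k∣N k = Cop.coprime-divisor (coprime-^ k k c)
    (ℕD.divides ∣ z ∣ (begin
      ∣ ↥ q ∣ ℕ.^ k ℕ.* ∣ N ∣ ≡⟨ cong (ℕ._* ∣ N ∣) (∣∣-^ (↥ q) k) ⟨
      ∣ ↥ q ℤ.^ k ∣ ℕ.* ∣ N ∣ ≡⟨ ℤₚ.∣i*j∣≡∣i∣*∣j∣ (↥ q ℤ.^ k) N ⟨
      ∣ ↥ q ℤ.^ k ℤ.* N ∣ ≡⟨ cong ∣_∣ (toℚ-injective {↥ q ℤ.^ k ℤ.* N} {z ℤ.* ↧ q ℤ.^ k} e) ⟩
      ∣ z ℤ.* ↧ q ℤ.^ k ∣ ≡⟨ ℤₚ.∣i*j∣≡∣i∣*∣j∣ z (↧ q ℤ.^ k) ⟩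
      ∣ z ∣ ℕ.* ∣ ↧ q ℤ.^ k ∣ ≡⟨ cong (∣ z ∣ ℕ.*_) (∣∣-^ (↧ q) k) ⟩
      ∣ z ∣ ℕ.* ↧ₙ q ℕ.^ k ∎))
    where
    z = proj₁ (h k)
    e : toℚ (↥ q ℤ.^ k ℤ.* N) ≡ toℚ (z ℤ.* ↧ q ℤ.^ k)
    e = begin
      toℚ (↥ q ℤ.^ k ℤ.* N) ≡⟨ toℚ-* (↥ q ℤ.^ k) N ⟩
      toℚ (↥ q ℤ.^ k) ℚ.* toℚ N ≡⟨ cong (ℚ._* toℚ N) (pow-clear q k) ⟨
      (toℚ (↧ q ℤ.^ k) ℚ.* q ^Q k) ℚ.* toℚ N
        ≡⟨ solve 3 (λ a b c → (a :* b) :* c := (c :* b) :* a) refl (toℚ (↧ q ℤ.^ k)) (q ^Q k) (toℚ N) ⟩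
      (toℚ N ℚ.* q ^Q k) ℚ.* toℚ (↧ q ℤ.^ k) ≡⟨ cong (ℚ._* toℚ (↧ q ℤ.^ k)) (proj₂ (h k)) ⟩
      toℚ z ℚ.* toℚ (↧ q ℤ.^ k) ≡⟨ toℚ-* z (↧ q ℤ.^ k) ⟨
      toℚ (z ℤ.* ↧ q ℤ.^ k) ∎
  b≡1 : ∀ b → ↧ₙ q ≡ b → b ≡ 1
  b≡1 zero ()
  b≡1 (suc zero) _ = refl
  b≡1 (suc (suc b)) e = contradiction
    (ℕₚ.≤-<-trans (ℕₚ.≤-trans (ℕₚ.^-monoˡ-≤ ∣ N ∣ (ℕ.s≤s (ℕ.s≤s (ℕ.z≤n {b}))))
        (ℕD.∣⇒≤ {{ℕ.≢-nonZero λ a → N≢0 (ℤₚ.∣i∣≡0⇒i≡0 a)}} (subst (λ t → (t ℕ.^ ∣ N ∣) ℕD.∣ ∣ N ∣) e (b^k∣N ∣ N ∣))))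
      (n<2^n ∣ N ∣)) (ℕₚ.<-irrefl refl)

*-nonzero : ∀ {a b} → a ≢ pos 0 → b ≢ pos 0 → a ℤ.* b ≢ pos 0
*-nonzero {a} {b} a≢0 b≢0 e with ℤₚ.i*j≡0⇒i≡0∨j≡0 a e
... | inj₁ p = a≢0 p
... | inj₂ p = b≢0 p

toℚ-inverse : ∀ z → z ≢ pos 0 → Σ ℚ λ q → q ℚ.* toℚ z ≡ 1ℚ
toℚ-inverse z z≢0 = ℚ.1/ toℚ z , ℚₚ.*-inverseˡ (toℚ z)
  where instance nz : ℚ.NonZero (toℚ z)
                 nz = ℚ.≢-nonZero λ e → z≢0 (toℚ-injective {z} {pos 0} e)

toℚ-cancel : ∀ z {p q} → z ≢ pos 0 → toℚ z ℚ.* p ≡ toℚ z ℚ.* q → p ≡ q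
toℚ-cancel z {p} {q} z≢0 e = begin
  p ≡⟨ ℚₚ.*-identityˡ p ⟨
  1ℚ ℚ.* p ≡⟨ cong (ℚ._* p) (proj₂ i) ⟨
  (proj₁ i ℚ.* toℚ z) ℚ.* p ≡⟨ ℚₚ.*-assoc (proj₁ i) (toℚ z) p ⟩
  proj₁ i ℚ.* (toℚ z ℚ.* p) ≡⟨ cong (proj₁ i ℚ.*_) e ⟩
  proj₁ i ℚ.* (toℚ z ℚ.* q) ≡⟨ ℚₚ.*-assoc (proj₁ i) (toℚ z) q ⟨
  (proj₁ i ℚ.* toℚ z) ℚ.* q ≡⟨ cong (ℚ._* q) (proj₂ i) ⟩
  1ℚ ℚ.* q ≡⟨ ℚₚ.*-identityˡ q ⟩
  q ∎
  where open ≡-Reasoning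
        i = toℚ-inverse z z≢0

∣-signed : ∀ p d → p ℕD.∣ ∣ d ∣ → Σ ℤ λ e → d ≡ e ℤ.* pos p
∣-signed p (pos n) (ℕD.divides q refl) = pos q , ℤₚ.pos-* q p
∣-signed p (ℤ.-[1+ n ]) (ℕD.divides q eq) = ℤ.- pos q , trans (cong (λ t → ℤ.- pos t) eq) (trans (cong (λ t → ℤ.- t) (ℤₚ.pos-* q p)) (ℤₚ.neg-distribˡ-* (pos q) (pos p)))

-- The ring of coordinate vectors

module KRing (n : ℤ) where
  open Coeffs n
  open Field n
  open ≡-Reasoning

  vec5 : ∀ {a0 a1 a2 a3 a4 b0 b1 b2 b3 b4 : ℚ} → a0 ≡ b0 → a1 ≡ b1 → a2 ≡ b2 → a3 ≡ b3 → a4 ≡ b4 →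
    _≡_ {A = K} (a0 ∷ a1 ∷ a2 ∷ a3 ∷ a4 ∷ []) (b0 ∷ b1 ∷ b2 ∷ b3 ∷ b4 ∷ [])
  vec5 refl refl refl refl refl = refl

  1K : K
  1K = const 1ℚ

  negK : K → K
  negK = Vec.map (ℚ.-_)

  +K-comm : ∀ x y → x +K y ≡ y +K x
  +K-comm = Vecₚ.zipWith-comm ℚₚ.+-comm

  +K-assoc : ∀ x y z → (x +K y) +K z ≡ x +K (y +K z)
  +K-assoc = Vecₚ.zipWith-assoc ℚₚ.+-assoc

  +K-identityˡ : ∀ x → 0K +K x ≡ x
  +K-identityˡ = Vecₚ.zipWith-identityˡ ℚₚ.+-identityˡ

  +K-identityʳ : ∀ x → x +K 0K ≡ x
  +K-identityʳ = Vecₚ.zipWith-identityʳ ℚₚ.+-identityʳ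

  negK-inverseˡ : ∀ x → negK x +K x ≡ 0K
  negK-inverseˡ = Vecₚ.zipWith-inverseˡ ℚₚ.+-inverseˡ

  negK-inverseʳ : ∀ x → x +K negK x ≡ 0K
  negK-inverseʳ = Vecₚ.zipWith-inverseʳ ℚₚ.+-inverseʳ

  +K-medial : ∀ a b c d → (a +K b) +K (c +K d) ≡ (a +K c) +K (b +K d)
  +K-medial a b c d = begin
    (a +K b) +K (c +K d) ≡⟨ +K-assoc a b (c +K d) ⟩
    a +K (b +K (c +K d)) ≡⟨ cong (a +K_) (+K-assoc b c d) ⟨
    a +K ((b +K c) +K d) ≡⟨ cong (λ t → a +K (t +K d)) (+K-comm b c) ⟩
    a +K ((c +K b) +K d) ≡⟨ cong (a +K_) (+K-assoc c b d) ⟩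
    a +K (c +K (b +K d)) ≡⟨ +K-assoc a c (b +K d) ⟨
    (a +K c) +K (b +K d) ∎

  scale-+K : ∀ {k} q (x y : Vec ℚ k) → Vec.map (q ℚ.*_) (zipWith ℚ._+_ x y) ≡ zipWith ℚ._+_ (Vec.map (q ℚ.*_) x) (Vec.map (q ℚ.*_) y)
  scale-+K q [] [] = refl
  scale-+K q (x ∷ xs) (y ∷ ys) = cong₂ _∷_ (ℚₚ.*-distribˡ-+ q x y) (scale-+K q xs ys)

  scale-scale : ∀ q r x → scale q (scale r x) ≡ scale (q ℚ.* r) x
  scale-scale q r x = trans (sym (Vecₚ.map-∘ (q ℚ.*_) (r ℚ.*_) x)) (Vecₚ.map-cong (λ t → sym (ℚₚ.*-assoc q r t)) x)

  scale-comm : ∀ q r x → scale q (scale r x) ≡ scale r (scale q x)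
  scale-comm q r x = trans (scale-scale q r x) (trans (cong (λ t → scale t x) (ℚₚ.*-comm q r)) (sym (scale-scale r q x)))

  scale-0 : ∀ q → scale q 0K ≡ 0K
  scale-0 q = vec5 z z z z z
    where z = ℚₚ.*-zeroʳ q

  scale-zero : ∀ x → scale 0ℚ x ≡ 0K
  scale-zero (a0 ∷ a1 ∷ a2 ∷ a3 ∷ a4 ∷ []) =
    vec5 (ℚₚ.*-zeroˡ a0) (ℚₚ.*-zeroˡ a1) (ℚₚ.*-zeroˡ a2) (ℚₚ.*-zeroˡ a3) (ℚₚ.*-zeroˡ a4)

  mulθ-+ : ∀ x y → mulθ (x +K y) ≡ mulθ x +K mulθ y
  mulθ-+ (a0 ∷ a1 ∷ a2 ∷ a3 ∷ a4 ∷ []) (b0 ∷ b1 ∷ b2 ∷ b3 ∷ b4 ∷ []) =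
    vec5 (l 0ℚ 0ℚ (toℚ c0)) (l a0 b0 (toℚ c1)) (l a1 b1 (toℚ c2)) (l a2 b2 (toℚ c3)) (l a3 b3 (toℚ c4))
    where
    open +-*-Solver
    l : ∀ a b c → (a ℚ.+ b) ℚ.- (a4 ℚ.+ b4) ℚ.* c ≡ (a ℚ.- a4 ℚ.* c) ℚ.+ (b ℚ.- b4 ℚ.* c)
    l a b c = solve 5 (λ a b c a4 b4 → (a :+ b) :- (a4 :+ b4) :* c := (a :- a4 :* c) :+ (b :- b4 :* c)) refl a b c a4 b4

  mulθ-scale : ∀ q x → mulθ (scale q x) ≡ scale q (mulθ x)
  mulθ-scale q (a0 ∷ a1 ∷ a2 ∷ a3 ∷ a4 ∷ []) =
    vec5 (trans (cong (ℚ._- (q ℚ.* a4) ℚ.* toℚ c0) (sym (ℚₚ.*-zeroʳ q))) (l 0ℚ (toℚ c0))) (l a0 (toℚ c1)) (l a1 (toℚ c2)) (l a2 (toℚ c3)) (l a3 (toℚ c4))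
    where
    open +-*-Solver
    l : ∀ a c → q ℚ.* a ℚ.- (q ℚ.* a4) ℚ.* c ≡ q ℚ.* (a ℚ.- a4 ℚ.* c)
    l a c = solve 4 (λ a c q a4 → q :* a :- (q :* a4) :* c := q :* (a :- a4 :* c)) refl a c q a4

  mulθ-0 : mulθ 0K ≡ 0K
  mulθ-0 = begin
    mulθ 0K ≡⟨ cong mulθ (scale-0 0ℚ) ⟨
    mulθ (scale 0ℚ 0K) ≡⟨ mulθ-scale 0ℚ 0K ⟩
    scale 0ℚ (mulθ 0K) ≡⟨ scale-zero (mulθ 0K) ⟩
    0K ∎

  mulAux-θ : ∀ as y → mulAux as (mulθ y) ≡ mulθ (mulAux as y)
  mulAux-θ [] y = sym mulθ-0
  mulAux-θ (a ∷ as) y = begin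
    scale a (mulθ y) +K mulθ (mulAux as (mulθ y)) ≡⟨ cong₂ _+K_ (sym (mulθ-scale a y)) (cong mulθ (mulAux-θ as y)) ⟩
    mulθ (scale a y) +K mulθ (mulθ (mulAux as y)) ≡⟨ mulθ-+ (scale a y) _ ⟨
    mulθ (scale a y +K mulθ (mulAux as y)) ∎

  mulAux-scale : ∀ as q y → mulAux as (scale q y) ≡ scale q (mulAux as y)
  mulAux-scale [] q y = sym (scale-0 q)
  mulAux-scale (a ∷ as) q y = begin
    scale a (scale q y) +K mulθ (mulAux as (scale q y))
      ≡⟨ cong₂ _+K_ (scale-comm a q y) (trans (cong mulθ (mulAux-scale as q y)) (mulθ-scale q _)) ⟩
    scale q (scale a y) +K scale q (mulθ (mulAux as y)) ≡⟨ scale-+K q _ _ ⟨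
    scale q (scale a y +K mulθ (mulAux as y)) ∎

  mulAux-+ : ∀ as y z → mulAux as (y +K z) ≡ mulAux as y +K mulAux as z
  mulAux-+ [] y z = sym (+K-identityˡ 0K)
  mulAux-+ (a ∷ as) y z = begin
    scale a (y +K z) +K mulθ (mulAux as (y +K z))
      ≡⟨ cong₂ _+K_ (scale-+K a y z) (trans (cong mulθ (mulAux-+ as y z)) (mulθ-+ _ _)) ⟩
    (scale a y +K scale a z) +K (mulθ (mulAux as y) +K mulθ (mulAux as z)) ≡⟨ +K-medial _ _ _ _ ⟩
    (scale a y +K mulθ (mulAux as y)) +K (scale a z +K mulθ (mulAux as z)) ∎

  mulAux-0 : ∀ as → mulAux as 0K ≡ 0K
  mulAux-0 [] = refl
  mulAux-0 (a ∷ as) = trans (cong₂ _+K_ (scale-0 a) (trans (cong mulθ (mulAux-0 as)) mulθ-0)) (+K-identityˡ 0K)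

  -- Multiplication by a vector is a polynomial in the operator `mulθ`, so any two multiplications
  -- commute. Together with the right unit this yields both commutativity and associativity of
  -- `_*K_`.
  mulAux-swap : ∀ as bs y → mulAux as (mulAux bs y) ≡ mulAux bs (mulAux as y)
  mulAux-swap [] bs y = sym (mulAux-0 bs)
  mulAux-swap (a ∷ as) bs y = begin
    scale a (mulAux bs y) +K mulθ (mulAux as (mulAux bs y))
      ≡⟨ cong₂ _+K_ (sym (mulAux-scale bs a y)) (trans (cong mulθ (mulAux-swap as bs y)) (sym (mulAux-θ bs _))) ⟩
    mulAux bs (scale a y) +K mulAux bs (mulθ (mulAux as y)) ≡⟨ mulAux-+ bs _ _ ⟨
    mulAux bs (scale a y +K mulθ (mulAux as y)) ∎

  shift-1K : ∀ a b0 b1 b2 b3 → scale a 1K +K mulθ (b0 ∷ b1 ∷ b2 ∷ b3 ∷ 0ℚ ∷ []) ≡ a ∷ b0 ∷ b1 ∷ b2 ∷ b3 ∷ []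
  shift-1K a b0 b1 b2 b3 = vec5
    (solve 2 (λ a c → a :* con 1ℚ :+ (con 0ℚ :- con 0ℚ :* c) := a) refl a (toℚ c0))
    (l b0 (toℚ c1)) (l b1 (toℚ c2)) (l b2 (toℚ c3)) (l b3 (toℚ c4))
    where
    open +-*-Solver
    l : ∀ b c → a ℚ.* 0ℚ ℚ.+ (b ℚ.- 0ℚ ℚ.* c) ≡ b
    l b c = solve 3 (λ a b c → a :* con 0ℚ :+ (b :- con 0ℚ :* c) := b) refl a b c

  *K-identityʳ : ∀ x → x *K 1K ≡ x
  *K-identityʳ (a0 ∷ a1 ∷ a2 ∷ a3 ∷ a4 ∷ []) =
    step a0 (step a1 (step a2 (step a3 (step a4 refl))))
    where
    step : ∀ a {y b0 b1 b2 b3} → y ≡ b0 ∷ b1 ∷ b2 ∷ b3 ∷ 0ℚ ∷ [] → scale a 1K +K mulθ y ≡ a ∷ b0 ∷ b1 ∷ b2 ∷ b3 ∷ []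
    step a refl = shift-1K a _ _ _ _

  *K-comm : ∀ x y → x *K y ≡ y *K x
  *K-comm x y = begin
    x *K y ≡⟨ cong (x *K_) (*K-identityʳ y) ⟨
    x *K (y *K 1K) ≡⟨ mulAux-swap (toList x) (toList y) 1K ⟩
    y *K (x *K 1K) ≡⟨ cong (y *K_) (*K-identityʳ x) ⟩
    y *K x ∎

  *K-assoc : ∀ x y z → (x *K y) *K z ≡ x *K (y *K z)
  *K-assoc x y z = begin
    (x *K y) *K z ≡⟨ *K-comm (x *K y) z ⟩
    z *K (x *K y) ≡⟨ mulAux-swap (toList z) (toList x) y ⟩
    x *K (z *K y) ≡⟨ cong (x *K_) (*K-comm z y) ⟩
    x *K (y *K z) ∎

  *K-identityˡ : ∀ x → 1K *K x ≡ x
  *K-identityˡ x = trans (*K-comm 1K x) (*K-identityʳ x)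

  *K-distribˡ : ∀ x y z → x *K (y +K z) ≡ (x *K y) +K (x *K z)
  *K-distribˡ x y z = mulAux-+ (toList x) y z

  *K-distribʳ : ∀ x y z → (y +K z) *K x ≡ (y *K x) +K (z *K x)
  *K-distribʳ x y z = trans (*K-comm (y +K z) x) (trans (*K-distribˡ x y z) (cong₂ _+K_ (*K-comm x y) (*K-comm x z)))

  K-isCommutativeRing : IsCommutativeRing _≡_ _+K_ _*K_ negK 0K 1K
  K-isCommutativeRing = record
    { isRing = record
      { +-isAbelianGroup = record
        { isGroup = record
          { isMonoid = record
            { isSemigroup = record
              { isMagma = record { isEquivalence = isEquivalence ; ∙-cong = cong₂ _+K_ }
              ; assoc = +K-assoc }
            ; identity = +K-identityˡ , +K-identityʳ }
          ; inverse = negK-inverseˡ , negK-inverseʳ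
          ; ⁻¹-cong = cong negK }
        ; comm = +K-comm }
      ; *-cong = cong₂ _*K_
      ; *-assoc = *K-assoc
      ; *-identity = *K-identityˡ , *K-identityʳ
      ; distrib = *K-distribˡ , *K-distribʳ }
    ; *-comm = *K-comm }

  scale-1K : ∀ q → scale q 1K ≡ const q
  scale-1K q = vec5 (ℚₚ.*-identityʳ q) z z z z
    where z = ℚₚ.*-zeroʳ q

  const-* : ∀ q x → const q *K x ≡ scale q x
  const-* q x = begin
    const q *K x ≡⟨ *K-comm (const q) x ⟩
    x *K const q ≡⟨ cong (x *K_) (scale-1K q) ⟨
    x *K scale q 1K ≡⟨ mulAux-scale (toList x) q 1K ⟩
    scale q (x *K 1K) ≡⟨ cong (scale q) (*K-identityʳ x) ⟩
    scale q x ∎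

  θ-* : ∀ x → θn *K x ≡ mulθ x
  θ-* x = begin
    θn *K x ≡⟨ *K-comm θn x ⟩
    x *K θn ≡⟨ cong (x *K_) θn≡mulθ1 ⟩
    x *K mulθ 1K ≡⟨ mulAux-θ (toList x) 1K ⟩
    mulθ (x *K 1K) ≡⟨ cong mulθ (*K-identityʳ x) ⟩
    mulθ x ∎
    where
    θn≡mulθ1 : θn ≡ mulθ 1K
    θn≡mulθ1 = trans (sym (shift-1K 0ℚ 1ℚ 0ℚ 0ℚ 0ℚ)) (trans (cong (_+K mulθ 1K) (scale-1K 0ℚ)) (+K-identityˡ _))

  const-+ : ∀ p q → const (p ℚ.+ q) ≡ const p +K const q
  const-+ p q = vec5 refl z z z z
    where z = sym (ℚₚ.+-identityˡ 0ℚ)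

  const-*-homo : ∀ p q → const (p ℚ.* q) ≡ const p *K const q
  const-*-homo p q = sym (trans (const-* p (const q)) (vec5 refl z z z z))
    where z = ℚₚ.*-zeroʳ p

  const-injective : ∀ {p q} → const p ≡ const q → p ≡ q
  const-injective refl = refl

  -K-def : ∀ x y → x -K y ≡ x +K negK y
  -K-def x y = sub x y
    where
    sub : ∀ {k} (x y : Vec ℚ k) → zipWith ℚ._-_ x y ≡ zipWith ℚ._+_ x (Vec.map (ℚ.-_) y)
    sub [] [] = refl
    sub (x ∷ xs) (y ∷ ys) = cong₂ _∷_ refl (sub xs ys)

  private
    Horner-step : ∀ a y → scale a 1K +K mulθ y ≡ const a +K (θn *K y)
    Horner-step a y = cong₂ _+K_ (scale-1K a) (sym (θ-* y))

  K-cons : ∀ a b0 b1 b2 b3 → a ∷ b0 ∷ b1 ∷ b2 ∷ b3 ∷ [] ≡ const a +K (θn *K (b0 ∷ b1 ∷ b2 ∷ b3 ∷ 0ℚ ∷ []))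
  K-cons a b0 b1 b2 b3 = trans (sym (shift-1K a b0 b1 b2 b3)) (Horner-step a (b0 ∷ b1 ∷ b2 ∷ b3 ∷ 0ℚ ∷ []))

-- Cyclic quintic fields

record ℚAlgebra : Set₁ where
  infixl 6 _+_
  infixl 7 _*_
  infix 8 -_
  field
    K : Set
    _+_ _*_ : K → K → K
    -_ : K → K
    0# 1# : K
    isCommutativeRing : IsCommutativeRing _≡_ _+_ _*_ -_ 0# 1#
    const : ℚ → K
    const-+ : ∀ p q → const (p ℚ.+ q) ≡ const p + const q
    const-* : ∀ p q → const (p ℚ.* q) ≡ const p * const q
    const-1 : const 1ℚ ≡ 1#

  commutativeRing : CommutativeRing 0ℓ 0ℓ
  commutativeRing = record { isCommutativeRing = isCommutativeRing }

  open CommutativeRing commutativeRing public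
    using (_-_; +-assoc; +-comm; +-identityˡ; +-identityʳ; -‿inverseˡ; -‿inverseʳ; *-assoc; *-comm; *-identityˡ; *-identityʳ; distribˡ; distribʳ; zeroˡ; zeroʳ; ring)
  module RingP = Algebra.Properties.Ring ring

  const-0 : const 0ℚ ≡ 0#
  const-0 = RingP.+-identityʳ-unique (const 0ℚ) (const 0ℚ) (sym (const-+ 0ℚ 0ℚ))

  const-neg : ∀ p → const (ℚ.- p) ≡ - const p
  const-neg p = RingP.+-inverseˡ-unique (const (ℚ.- p)) (const p)
    (trans (sym (const-+ (ℚ.- p) p)) (trans (cong const (ℚₚ.+-inverseˡ p)) const-0))

  const-minus : ∀ p q → const (p ℚ.- q) ≡ const p - const q
  const-minus p q = trans (const-+ p (ℚ.- q)) (cong (const p +_) (const-neg q))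

  ι : ℤ → K
  ι z = const (toℚ z)

  ι-+ : ∀ a b → ι (a ℤ.+ b) ≡ ι a + ι b
  ι-+ a b = trans (cong const (toℚ-+ a b)) (const-+ (toℚ a) (toℚ b))

  ι-* : ∀ a b → ι (a ℤ.* b) ≡ ι a * ι b
  ι-* a b = trans (cong const (toℚ-* a b)) (const-* (toℚ a) (toℚ b))

  ι-neg : ∀ a → ι (ℤ.- a) ≡ - ι a
  ι-neg a = trans (cong const (toℚ-neg a)) (const-neg (toℚ a))

  ι-minus : ∀ a b → ι (a ℤ.- b) ≡ ι a - ι b
  ι-minus a b = trans (ι-+ a (ℤ.- b)) (cong (ι a +_) (ι-neg b))

  infixr 8 _^K_
  _^K_ : K → ℕ → K
  x ^K zero = 1#
  x ^K suc k = x * x ^K k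

  private
    ℤ-rawRing : RawRing 0ℓ 0ℓ
    ℤ-rawRing = record { Carrier = ℤ ; _≈_ = _≡_ ; _+_ = ℤ._+_ ; _*_ = ℤ._*_ ; -_ = ℤ.-_ ; 0# = pos 0 ; 1# = pos 1 }

    acr : AlmostCommutativeRing 0ℓ 0ℓ
    acr = fromCommutativeRing commutativeRing

    morphism : ℤ-rawRing -Raw-AlmostCommutative⟶ acr
    morphism = record { ⟦_⟧ = ι ; +-homo = ι-+ ; *-homo = ι-* ; -‿homo = ι-neg ; 0-homo = const-0 ; 1-homo = const-1 }

    ι-≟ : ∀ a b → Maybe (ι a ≡ ι b)
    ι-≟ a b with a ℤₚ.≟ b
    ... | yes e = just (cong ι e)
    ... | no _ = nothing

  module Solver = Algebra.Solver.Ring ℤ-rawRing acr morphism ι-≟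

  ^K-* : ∀ x y k → (x * y) ^K k ≡ x ^K k * y ^K k
  ^K-* x y zero = sym (*-identityˡ 1#)
  ^K-* x y (suc k) = trans (cong (x * y *_) (^K-* x y k))
    (solve 4 (λ x y a b → (x :* y) :* (a :* b) := (x :* a) :* (y :* b)) refl x y (x ^K k) (y ^K k))
    where open Solver

  ^K-+ : ∀ x j k → x ^K (j ℕ.+ k) ≡ x ^K j * x ^K k
  ^K-+ x zero k = sym (*-identityˡ _)
  ^K-+ x (suc j) k = trans (cong (x *_) (^K-+ x j k)) (sym (*-assoc x _ _))

  const-^ : ∀ q k → const q ^K k ≡ const (q ^Q k)
  const-^ q zero = sym const-1
  const-^ q (suc k) = trans (cong (const q *_) (const-^ q k)) (sym (const-* q (q ^Q k)))

  ι-cancel : ∀ z {x y} → z ≢ pos 0 → ι z * x ≡ ι z * y → x ≡ y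
  ι-cancel z {x} {y} z≢0 e = begin
    x ≡⟨ unit x ⟨
    const i * (ι z * x) ≡⟨ cong (const i *_) e ⟩
    const i * (ι z * y) ≡⟨ unit y ⟩
    y ∎
    where
    open ≡-Reasoning
    i = proj₁ (toℚ-inverse z z≢0)
    unit : ∀ x → const i * (ι z * x) ≡ x
    unit x = begin
      const i * (ι z * x) ≡⟨ *-assoc (const i) (ι z) x ⟨
      const i * ι z * x ≡⟨ cong (_* x) (const-* i (toℚ z)) ⟨
      const (i ℚ.* toℚ z) * x ≡⟨ cong (λ t → const t * x) (proj₂ (toℚ-inverse z z≢0)) ⟩
      const 1ℚ * x ≡⟨ cong (_* x) const-1 ⟩
      1# * x ≡⟨ *-identityˡ x ⟩
      x ∎

  ι-divide : ∀ z (z≢0 : z ≢ pos 0) x → ι z * (const (proj₁ (toℚ-inverse z z≢0)) * x) ≡ x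
  ι-divide z z≢0 x = begin
    ι z * (const i * x) ≡⟨ *-assoc (ι z) (const i) x ⟨
    ι z * const i * x ≡⟨ cong (_* x) (trans (*-comm (ι z) (const i)) (trans (sym (const-* i (toℚ z))) (trans (cong const (proj₂ (toℚ-inverse z z≢0))) const-1))) ⟩
    1# * x ≡⟨ *-identityˡ x ⟩
    x ∎
    where
    open ≡-Reasoning
    i = proj₁ (toℚ-inverse z z≢0)

  evalℚK : List ℚ → K → K
  evalℚK [] x = 0#
  evalℚK (c ∷ cs) x = const c + x * evalℚK cs x

  evalℤK : List ℤ → K → K
  evalℤK [] x = 0#
  evalℤK (c ∷ cs) x = ι c + x * evalℤK cs x

  evalMonicK : List ℤ → K → K
  evalMonicK [] x = 1#
  evalMonicK (c ∷ cs) x = ι c + x * evalMonicK cs x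

  pow5 : K → K
  pow5 x = x * (x * (x * (x * x)))

  lc : K → Vec ℚ 5 → K
  lc α (b0 ∷ b1 ∷ b2 ∷ b3 ∷ b4 ∷ []) = const b0 + α * (const b1 + α * (const b2 + α * (const b3 + α * const b4)))

  lcℤ : K → Vec ℤ 5 → K
  lcℤ α (z0 ∷ z1 ∷ z2 ∷ z3 ∷ z4 ∷ []) = ι z0 + α * (ι z1 + α * (ι z2 + α * (ι z3 + α * ι z4)))

  lc-toℚ : ∀ α v → lc α (Vec.map toℚ v) ≡ lcℤ α v
  lc-toℚ α (_ ∷ _ ∷ _ ∷ _ ∷ _ ∷ []) = refl

  lc-+ : ∀ α v w → lc α (Vec.zipWith ℚ._+_ v w) ≡ lc α v + lc α w
  lc-+ α (a0 ∷ a1 ∷ a2 ∷ a3 ∷ a4 ∷ []) (b0 ∷ b1 ∷ b2 ∷ b3 ∷ b4 ∷ []) =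
    step a0 b0 (step a1 b1 (step a2 b2 (step a3 b3 (const-+ a4 b4))))
    where
    open Solver
    step : ∀ a b {y y' s} → s ≡ y + y' → const (a ℚ.+ b) + α * s ≡ (const a + α * y) + (const b + α * y')
    step a b {y} {y'} refl = trans (cong (λ t → t + α * (y + y')) (const-+ a b))
      (solve 5 (λ α x x' y y' → (x :+ x') :+ α :* (y :+ y') := (x :+ α :* y) :+ (x' :+ α :* y')) refl α (const a) (const b) y y')

  lc-scale : ∀ α q b → lc α (Vec.map (q ℚ.*_) b) ≡ const q * lc α b
  lc-scale α q (b0 ∷ b1 ∷ b2 ∷ b3 ∷ b4 ∷ []) =
    step b0 (step b1 (step b2 (step b3 (const-* q b4))))
    where
    open Solver
    step : ∀ b {y s} → s ≡ const q * y → const (q ℚ.* b) + α * s ≡ const q * (const b + α * y)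
    step b {y} refl = trans (cong (λ t → t + α * (const q * y)) (const-* q b))
      (solve 4 (λ α q b y → q :* b :+ α :* (q :* y) := q :* (b :+ α :* y)) refl α (const q) (const b) y)

  lcℤ-⊕ : ∀ α v w → lcℤ α (Vec.zipWith ℤ._+_ v w) ≡ lcℤ α v + lcℤ α w
  lcℤ-⊕ α v w = trans (sym (lc-toℚ α (Vec.zipWith ℤ._+_ v w))) (trans (cong (lc α) (homo v w)) (trans (lc-+ α (Vec.map toℚ v) (Vec.map toℚ w)) (cong₂ _+_ (lc-toℚ α v) (lc-toℚ α w))))
    where
    homo : ∀ {k} (v w : Vec ℤ k) → Vec.map toℚ (Vec.zipWith ℤ._+_ v w) ≡ Vec.zipWith ℚ._+_ (Vec.map toℚ v) (Vec.map toℚ w)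
    homo [] [] = refl
    homo (x ∷ v) (y ∷ w) = cong₂ _∷_ (toℚ-+ x y) (homo v w)

  lcℤ-· : ∀ α z v → lcℤ α (Vec.map (z ℤ.*_) v) ≡ ι z * lcℤ α v
  lcℤ-· α z v = trans (sym (lc-toℚ α (Vec.map (z ℤ.*_) v))) (trans (cong (lc α) (homo v)) (trans (lc-scale α (toℚ z) (Vec.map toℚ v)) (cong (ι z *_) (lc-toℚ α v))))
    where
    homo : ∀ {k} (v : Vec ℤ k) → Vec.map toℚ (Vec.map (z ℤ.*_) v) ≡ Vec.map (toℚ z ℚ.*_) (Vec.map toℚ v)
    homo [] = refl
    homo (x ∷ v) = cong₂ _∷_ (toℚ-* z x) (homo v)

  -- The companion matrix of X⁵ + g(X), applied to b.
  shift : Vec ℤ 5 → Vec ℚ 5 → Vec ℚ 5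
  shift (g0 ∷ g1 ∷ g2 ∷ g3 ∷ g4 ∷ []) (b0 ∷ b1 ∷ b2 ∷ b3 ∷ b4 ∷ []) =
    (0ℚ ℚ.- toℚ g0 ℚ.* b4) ∷ (b0 ℚ.- toℚ g1 ℚ.* b4) ∷ (b1 ℚ.- toℚ g2 ℚ.* b4) ∷ (b2 ℚ.- toℚ g3 ℚ.* b4) ∷ (b3 ℚ.- toℚ g4 ℚ.* b4) ∷ []

  lc-shift : ∀ α g → pow5 α + lcℤ α g ≡ 0# → ∀ b → lc α (shift g b) ≡ α * lc α b
  lc-shift α g@(g0 ∷ g1 ∷ g2 ∷ g3 ∷ g4 ∷ []) α⁵ b@(b0 ∷ b1 ∷ b2 ∷ b3 ∷ b4 ∷ []) = begin
    _ ≡⟨ cong₂ (λ s t → s + α * t) (reduce 0ℚ g0) (cong₂ (λ s t → s + α * t) (reduce b0 g1) (cong₂ (λ s t → s + α * t) (reduce b1 g2) (cong₂ (λ s t → s + α * t) (reduce b2 g3) (reduce b3 g4)))) ⟩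
    (const 0ℚ - ι g0 * B4) + α * ((B0 - ι g1 * B4) + α * ((B1 - ι g2 * B4) + α * ((B2 - ι g3 * B4) + α * (B3 - ι g4 * B4))))
      ≡⟨ solve 11 (λ α b0 b1 b2 b3 b4 g0 g1 g2 g3 g4 →
          (con (pos 0) :- g0 :* b4) :+ α :* ((b0 :- g1 :* b4) :+ α :* ((b1 :- g2 :* b4) :+ α :* ((b2 :- g3 :* b4) :+ α :* (b3 :- g4 :* b4))))
          := α :* (b0 :+ α :* (b1 :+ α :* (b2 :+ α :* (b3 :+ α :* b4)))) :- b4 :* (α :* (α :* (α :* (α :* α))) :+ (g0 :+ α :* (g1 :+ α :* (g2 :+ α :* (g3 :+ α :* g4))))))
        refl α B0 B1 B2 B3 B4 (ι g0) (ι g1) (ι g2) (ι g3) (ι g4) ⟩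
    α * lc α b - B4 * (pow5 α + lcℤ α g) ≡⟨ cong (λ t → α * lc α b - B4 * t) (trans α⁵ (sym const-0)) ⟩
    α * lc α b - B4 * ι (pos 0) ≡⟨ solve 2 (λ x b → x :- b :* con (pos 0) := x) refl (α * lc α b) B4 ⟩
    α * lc α b ∎
    where
    open Solver
    open ≡-Reasoning
    B0 = const b0
    B1 = const b1
    B2 = const b2
    B3 = const b3
    B4 = const b4
    reduce : ∀ b g → const (b ℚ.- toℚ g ℚ.* b4) ≡ const b - ι g * const b4
    reduce b g = trans (const-minus b (toℚ g ℚ.* b4)) (cong (λ t → const b - t) (const-* (toℚ g) b4))

  lcℤ-shift : ∀ α g → pow5 α + lcℤ α g ≡ 0# → ∀ v → Σ (Vec ℤ 5) λ w → α * lcℤ α v ≡ lcℤ α w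
  lcℤ-shift α g@(g0 ∷ g1 ∷ g2 ∷ g3 ∷ g4 ∷ []) α⁵ v@(z0 ∷ z1 ∷ z2 ∷ z3 ∷ z4 ∷ []) = w , (begin
      α * lcℤ α v ≡⟨ lc-shift α g α⁵ (Vec.map toℚ v) ⟨
      lc α (shift g (Vec.map toℚ v)) ≡⟨ cong (lc α) (cong₂ _∷_ (h (pos 0) g0) (cong₂ _∷_ (h z0 g1) (cong₂ _∷_ (h z1 g2) (cong₂ _∷_ (h z2 g3) (cong₂ _∷_ (h z3 g4) refl))))) ⟨
      lcℤ α w ∎)
    where
    open ≡-Reasoning
    w : Vec ℤ 5
    w = (pos 0 ℤ.- g0 ℤ.* z4) ∷ (z0 ℤ.- g1 ℤ.* z4) ∷ (z1 ℤ.- g2 ℤ.* z4) ∷ (z2 ℤ.- g3 ℤ.* z4) ∷ (z3 ℤ.- g4 ℤ.* z4) ∷ []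
    h : ∀ z c → toℚ (z ℤ.- c ℤ.* z4) ≡ toℚ z ℚ.- toℚ c ℚ.* toℚ z4
    h z c = trans (toℚ-minus z (c ℤ.* z4)) (cong (λ t → toℚ z ℚ.- t) (toℚ-* c z4))

-- `Λ` is to be the order ℤ[θ]. It need not be stable under σ, but the bounded denominator
-- `σ-denominator` is enough for σ to act on `A`. Division is by rational scalars only, hence
-- `scalar-cancel`.
record CyclicQuinticField : Set₁ where
  field
    algebra : ℚAlgebra
  open ℚAlgebra algebra public
  field
    const-injective : ∀ {p q} → const p ≡ const q → p ≡ q
    scalar-cancel : ∀ q x → x ≢ 0# → const q * x ≡ 0# → q ≡ 0ℚ
    Λ : K → Set
    Λ-+ : ∀ {x y} → Λ x → Λ y → Λ (x + y)
    Λ-* : ∀ {x y} → Λ x → Λ y → Λ (x * y)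
    Λ-ι : ∀ z → Λ (ι z)
    Λ-rational : ∀ q → Λ (const q) → IsInt q
    Λ-denominator : ∀ x → Σ ℤ λ N → N ≢ pos 0 × Λ (ι N * x)
    σ : K → K
    σ-+ : ∀ x y → σ (x + y) ≡ σ x + σ y
    σ-* : ∀ x y → σ (x * y) ≡ σ x * σ y
    σ-const : ∀ q → σ (const q) ≡ const q
    σ⁵ : ∀ x → σ (σ (σ (σ (σ x)))) ≡ x
    σ-fixed : ∀ x → σ x ≡ x → Σ ℚ λ q → x ≡ const q
    σ-denominator : Σ ℤ λ N → N ≢ pos 0 × (∀ x → Λ x → Λ (ι N * σ x))

  σ-neg : ∀ x → σ (- x) ≡ - σ x
  σ-neg x = RingP.+-inverseˡ-unique (σ (- x)) (σ x)
    (trans (sym (σ-+ (- x) x)) (trans (cong σ (-‿inverseˡ x)) (trans (cong σ (sym const-0)) (trans (σ-const 0ℚ) const-0))))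

  σ-minus : ∀ x y → σ (x - y) ≡ σ x - σ y
  σ-minus x y = trans (σ-+ x (- y)) (cong (σ x +_) (σ-neg y))

  σ-0 : σ 0# ≡ 0#
  σ-0 = trans (cong σ (sym const-0)) (trans (σ-const 0ℚ) const-0)

  σ-1 : σ 1# ≡ 1#
  σ-1 = trans (cong σ (sym const-1)) (trans (σ-const 1ℚ) const-1)

  σ-^ : ∀ x k → σ (x ^K k) ≡ σ x ^K k
  σ-^ x zero = σ-1
  σ-^ x (suc k) = trans (σ-* x (x ^K k)) (cong (σ x *_) (σ-^ x k))

  A : K → Set
  A x = Σ ℤ λ N → N ≢ pos 0 × (∀ k → Λ (ι N * x ^K k))

-- Almost integral elements

prime∣*⇒∣ : ∀ {p} → Prime p → ∀ a b → ¬ p ℕD.∣ ∣ a ∣ → p ℕD.∣ ∣ a ℤ.* b ∣ → p ℕD.∣ ∣ b ∣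
prime∣*⇒∣ pr a b p∤a d with euclidsLemma ∣ a ∣ ∣ b ∣ pr (subst (_ ℕD.∣_) (ℤₚ.∣i*j∣≡∣i∣*∣j∣ a b) d)
... | inj₁ q = contradiction q p∤a
... | inj₂ q = q

prime≢0 : ∀ {p} → Prime p → pos p ≢ pos 0
prime≢0 pr refl with prime⇒nonZero pr
... | ()

∣^⇒∣ : ∀ {p} → Prime p → ∀ r k → p ℕD.∣ r ℕ.^ suc k → p ℕD.∣ r
∣^⇒∣ {p} pr r zero d = subst (p ℕD.∣_) (ℕₚ.*-identityʳ r) d
∣^⇒∣ pr r (suc k) d with euclidsLemma r (r ℕ.^ suc k) pr d
... | inj₁ q = q
... | inj₂ q = ∣^⇒∣ pr r k q

module AlmostIntegral (F : CyclicQuinticField) where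
  open CyclicQuinticField F
  open ≡-Reasoning

  Λ-≡ : ∀ {x y} → x ≡ y → Λ x → Λ y
  Λ-≡ refl l = l

  Λ-0 : Λ 0#
  Λ-0 = Λ-≡ const-0 (Λ-ι (pos 0))

  Λ-1 : Λ 1#
  Λ-1 = Λ-≡ const-1 (Λ-ι (pos 1))

  Λ-ι* : ∀ z {x} → Λ x → Λ (ι z * x)
  Λ-ι* z l = Λ-* (Λ-ι z) l

  Λ-neg : ∀ {x} → Λ x → Λ (- x)
  Λ-neg {x} l = Λ-≡ (solve 1 (λ x → con (ℤ.- pos 1) :* x := :- x) refl x) (Λ-ι* (ℤ.- pos 1) l)
    where open Solver

  A-≡ : ∀ {x y} → x ≡ y → A x → A y
  A-≡ refl a = a

  -- The product N M clears every monomial xⁱ yʲ. The claim carries such a monomial along, so that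
  -- the factors x + y are expanded one at a time and no binomial coefficients appear.
  A-+ : ∀ {x y} → A x → A y → A (x + y)
  A-+ {x} {y} (N , N≢0 , hx) (M , M≢0 , hy) = N ℤ.* M , *-nonzero N≢0 M≢0 ,
    λ k → Λ-≡ (cong (ι (N ℤ.* M) *_) (trans (cong (λ t → t * (x + y) ^K k) (*-identityˡ 1#)) (*-identityˡ _))) (claim k 0 0)
    where
    open Solver
    claim : ∀ k i j → Λ (ι (N ℤ.* M) * (x ^K i * y ^K j * (x + y) ^K k))
    claim zero i j = Λ-≡ (begin
      (ι N * x ^K i) * (ι M * y ^K j) ≡⟨ solve 4 (λ n m a b → (n :* a) :* (m :* b) := (n :* m) :* (a :* b :* con (pos 1))) refl (ι N) (ι M) (x ^K i) (y ^K j) ⟩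
      ι N * ι M * (x ^K i * y ^K j * ι (pos 1)) ≡⟨ cong₂ _*_ (sym (ι-* N M)) (cong (x ^K i * y ^K j *_) const-1) ⟩
      ι (N ℤ.* M) * (x ^K i * y ^K j * 1#) ∎) (Λ-* (hx i) (hy j))
    claim (suc k) i j = Λ-≡ (solve 6 (λ m x y a b c → m :* ((x :* a) :* b :* c) :+ m :* (a :* (y :* b) :* c) := m :* (a :* b :* ((x :+ y) :* c)))
        refl (ι (N ℤ.* M)) x y (x ^K i) (y ^K j) ((x + y) ^K k))
      (Λ-+ (claim k (suc i) j) (claim k i (suc j)))

  A-* : ∀ {x y} → A x → A y → A (x * y)
  A-* {x} {y} (N , N≢0 , hx) (M , M≢0 , hy) = N ℤ.* M , *-nonzero N≢0 M≢0 ,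
    λ k → Λ-≡ (begin
      (ι N * x ^K k) * (ι M * y ^K k) ≡⟨ solve 4 (λ n m a b → (n :* a) :* (m :* b) := (n :* m) :* (a :* b)) refl (ι N) (ι M) (x ^K k) (y ^K k) ⟩
      ι N * ι M * (x ^K k * y ^K k) ≡⟨ cong₂ _*_ (sym (ι-* N M)) (sym (^K-* x y k)) ⟩
      ι (N ℤ.* M) * (x * y) ^K k ∎) (Λ-* (hx k) (hy k))
    where open Solver

  A-Λ : ∀ {x} → Λ x → A x
  A-Λ {x} l = pos 1 , (λ ()) , λ k → Λ-ι* (pos 1) (pw k)
    where
    pw : ∀ k → Λ (x ^K k)
    pw zero = Λ-1
    pw (suc k) = Λ-* l (pw k)

  A-ι : ∀ z → A (ι z)
  A-ι z = A-Λ (Λ-ι z)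

  A-0 : A 0#
  A-0 = A-Λ Λ-0

  A-1 : A 1#
  A-1 = A-Λ Λ-1

  A-neg : ∀ {x} → A x → A (- x)
  A-neg {x} a = A-≡ (solve 1 (λ x → con (ℤ.- pos 1) :* x := :- x) refl x) (A-* (A-ι (ℤ.- pos 1)) a)
    where open Solver

  A-minus : ∀ {x y} → A x → A y → A (x - y)
  A-minus ax ay = A-+ ax (A-neg ay)

  A-^ : ∀ {x} → A x → ∀ k → A (x ^K k)
  A-^ a zero = A-1
  A-^ a (suc k) = A-* a (A-^ a k)

  A-σ : ∀ {x} → A x → A (σ x)
  A-σ {x} (N , N≢0 , h) = proj₁ σ-denominator ℤ.* N , *-nonzero (proj₁ (proj₂ σ-denominator)) N≢0 ,
    λ k → Λ-≡ (begin
      ι D * σ (ι N * x ^K k) ≡⟨ cong (ι D *_) (σ-* (ι N) (x ^K k)) ⟩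
      ι D * (σ (ι N) * σ (x ^K k)) ≡⟨ cong₂ (λ s t → ι D * (s * t)) (σ-const (toℚ N)) (σ-^ x k) ⟩
      ι D * (ι N * σ x ^K k) ≡⟨ *-assoc (ι D) (ι N) (σ x ^K k) ⟨
      ι D * ι N * σ x ^K k ≡⟨ cong (_* σ x ^K k) (ι-* D N) ⟨
      ι (D ℤ.* N) * σ x ^K k ∎) (proj₂ (proj₂ σ-denominator) _ (h k))
    where D = proj₁ σ-denominator

  A-rational : ∀ q → A (const q) → IsInt q
  A-rational q (N , N≢0 , h) = almost-integral-rational q N N≢0 λ k →
    Λ-rational (toℚ N ℚ.* q ^Q k) (Λ-≡ (trans (cong (ι N *_) (const-^ q k)) (sym (const-* (toℚ N) (q ^Q k)))) (h k))

  -- The quotient s / p lies in A, and A ∩ ℚ = ℤ; so divisibility of integers may be tested in A.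
  A-∣ : ∀ {y} p s → p ≢ pos 0 → A y → ι p * y ≡ ι s → ∣ p ∣ ℕD.∣ ∣ s ∣
  A-∣ {y} p s p≢0 a e = ℕD.divides ∣ z ∣ (begin
      ∣ s ∣ ≡⟨ cong ∣_∣ (toℚ-injective {s} {z ℤ.* p} s≡zp) ⟩
      ∣ z ℤ.* p ∣ ≡⟨ ℤₚ.∣i*j∣≡∣i∣*∣j∣ z p ⟩
      ∣ z ∣ ℕ.* ∣ p ∣ ∎)
    where
    i = proj₁ (toℚ-inverse p p≢0)
    q = toℚ s ℚ.* i
    pq≡s : toℚ p ℚ.* q ≡ toℚ s
    pq≡s = trans (ℚₚ.*-comm (toℚ p) q) (trans (ℚₚ.*-assoc (toℚ s) i (toℚ p)) (trans (cong (toℚ s ℚ.*_) (proj₂ (toℚ-inverse p p≢0))) (ℚₚ.*-identityʳ (toℚ s))))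
    y≡q : y ≡ const q
    y≡q = ι-cancel p p≢0 (trans e (trans (cong const (sym pq≡s)) (const-* (toℚ p) q)))
    int : IsInt q
    int = A-rational q (A-≡ y≡q a)
    z = proj₁ int
    s≡zp : toℚ s ≡ toℚ (z ℤ.* p)
    s≡zp = trans (sym pq≡s) (trans (cong (toℚ p ℚ.*_) (proj₂ int)) (trans (ℚₚ.*-comm (toℚ p) (toℚ z)) (sym (toℚ-* z p))))

  1≢0 : 1# ≢ 0#
  1≢0 e with const-injective {1ℚ} {0ℚ} (trans const-1 (trans e (sym const-0)))
  ... | ()

  -- The monic polynomial is solved for its leading term. The multiplier M ranges over K rather than
  -- ℤ, so that the induction can absorb a factor x into it.
  top-power : ∀ cs M x → (∀ i → i ℕ.< length cs → Λ (M * x ^K i)) → Λ (M * evalMonicK cs x) → Λ (M * x ^K length cs)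
  top-power [] M x h l = l
  top-power (c ∷ cs) M x h l = Λ-≡ (*-assoc M x _)
    (top-power cs (M * x) x (λ i i< → Λ-≡ (sym (*-assoc M x _)) (h (suc i) (ℕ.s≤s i<)))
      (Λ-≡ (solve 4 (λ m c x e → m :* (c :+ x :* e) :- c :* (m :* con (pos 1)) := (m :* x) :* e) refl M (ι c) x (evalMonicK cs x))
        (Λ-+ l (Λ-neg (Λ-ι* c (Λ-≡ (cong (M *_) (sym const-1)) (h 0 (ℕ.s≤s ℕ.z≤n))))))))
    where open Solver

  common-denominator : ∀ x d → Σ ℤ λ N → N ≢ pos 0 × (∀ i → i ℕ.< d → Λ (ι N * x ^K i))
  common-denominator x zero = pos 1 , (λ ()) , λ i ()
  common-denominator x (suc d) with common-denominator x d | Λ-denominator (x ^K d)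
  ... | N , N≢0 , h | M , M≢0 , l = M ℤ.* N , *-nonzero M≢0 N≢0 , go
    where
    open Solver
    go : ∀ i → i ℕ.< suc d → Λ (ι (M ℤ.* N) * x ^K i)
    go i i< with i ℕ.≟ d
    ... | yes refl = Λ-≡ (trans (solve 3 (λ m n x → n :* (m :* x) := (m :* n) :* x) refl (ι M) (ι N) (x ^K d)) (cong (_* x ^K d) (sym (ι-* M N)))) (Λ-ι* N l)
    ... | no i≢d = Λ-≡ (trans (sym (*-assoc (ι M) (ι N) _)) (cong (_* x ^K i) (sym (ι-* M N)))) (Λ-ι* M (h i (ℕₚ.≤∧≢⇒< (ℕₚ.≤-pred i<) i≢d)))

  Integralᶠ : K → Set
  Integralᶠ x = Σ (List ℤ) λ cs → evalMonicK cs x ≡ 0#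

  -- A denominator common to 1, x, ..., x^(d-1) serves for all powers, since the monic relation
  -- expresses each power by the d preceding ones. The induction moves a window of d consecutive
  -- exponents.
  Integral⇒A : ∀ {x} → Integralᶠ x → A x
  Integral⇒A ([] , e) = contradiction e 1≢0
  Integral⇒A {x} (cs@(_ ∷ _) , e) = N , N≢0 , λ k → Λ-≡ (cong (λ t → ι N * x ^K t) (ℕₚ.+-identityʳ k)) (powers k 0 (ℕ.s≤s ℕ.z≤n))
    where
    d = length cs
    N = proj₁ (common-denominator x d)
    N≢0 = proj₁ (proj₂ (common-denominator x d))
    powers : ∀ k i → i ℕ.< d → Λ (ι N * x ^K (k ℕ.+ i))
    powers zero i i< = proj₂ (proj₂ (common-denominator x d)) i i<
    powers (suc k) i i< with suc i ℕ.≟ d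
    ... | no i≢ = Λ-≡ (cong (λ t → ι N * x ^K t) (ℕₚ.+-suc k i)) (powers k (suc i) (ℕₚ.≤∧≢⇒< i< i≢))
    ... | yes refl = Λ-≡ (begin
        (ι N * x ^K k) * x ^K d ≡⟨ *-assoc (ι N) _ _ ⟩
        ι N * (x ^K k * x ^K d) ≡⟨ cong (ι N *_) (^K-+ x k d) ⟨
        ι N * x ^K (k ℕ.+ d) ≡⟨ cong (λ t → ι N * x ^K t) (ℕₚ.+-suc k i) ⟩
        ι N * x ^K suc (k ℕ.+ i) ∎)
      (top-power cs (ι N * x ^K k) x
        (λ j j< → Λ-≡ (trans (cong (ι N *_) (^K-+ x k j)) (sym (*-assoc (ι N) _ _))) (powers k j j<))
        (Λ-≡ (sym (trans (cong (ι N * x ^K k *_) e) (zeroʳ _))) Λ-0))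

  -- All five conjugates are named: sums and products over an orbit are then fixed by a cyclic
  -- reordering, and products of rotated orbits are orbits again. This gives every elementary
  -- symmetric function of the conjugates.
  record Orbit (a b c d e : K) : Set where
    constructor orbit
    field
      σa : σ a ≡ b
      σb : σ b ≡ c
      σc : σ c ≡ d
      σd : σ d ≡ e
      σe : σ e ≡ a

  orbit-of : ∀ x → Orbit x (σ x) (σ (σ x)) (σ (σ (σ x))) (σ (σ (σ (σ x))))
  orbit-of x = orbit refl refl refl refl (σ⁵ x)

  rotate : ∀ {a b c d e} → Orbit a b c d e → Orbit b c d e a
  rotate (orbit p q r s t) = orbit q r s t p

  orbit-* : ∀ {a b c d e a' b' c' d' e'} → Orbit a b c d e → Orbit a' b' c' d' e' → Orbit (a * a') (b * b') (c * c') (d * d') (e * e')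
  orbit-* (orbit p q r s t) (orbit p' q' r' s' t') = orbit (mul p p') (mul q q') (mul r r') (mul s s') (mul t t')
    where
    mul : ∀ {a a' b b'} → σ a ≡ b → σ a' ≡ b' → σ (a * a') ≡ b * b'
    mul {a} {a'} p p' = trans (σ-* a a') (cong₂ _*_ p p')

  orbit-sum-fixed : ∀ {a b c d e} → Orbit a b c d e → σ (a + b + c + d + e) ≡ a + b + c + d + e
  orbit-sum-fixed {a} {b} {c} {d} {e} (orbit p q r s t) = begin
    σ (a + b + c + d + e) ≡⟨ trans (σ-+ _ e) (cong₂ _+_ (trans (σ-+ _ d) (cong₂ _+_ (trans (σ-+ _ c) (cong₂ _+_ (trans (σ-+ a b) (cong₂ _+_ p q)) r)) s)) t) ⟩
    b + c + d + e + a ≡⟨ solve 5 (λ a b c d e → b :+ c :+ d :+ e :+ a := a :+ b :+ c :+ d :+ e) refl a b c d e ⟩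
    a + b + c + d + e ∎
    where open Solver

  orbit-product-fixed : ∀ {a b c d e} → Orbit a b c d e → σ (a * b * c * d * e) ≡ a * b * c * d * e
  orbit-product-fixed {a} {b} {c} {d} {e} (orbit p q r s t) = begin
    σ (a * b * c * d * e) ≡⟨ trans (σ-* _ e) (cong₂ _*_ (trans (σ-* _ d) (cong₂ _*_ (trans (σ-* _ c) (cong₂ _*_ (trans (σ-* a b) (cong₂ _*_ p q)) r)) s)) t) ⟩
    b * c * d * e * a ≡⟨ solve 5 (λ a b c d e → b :* c :* d :* e :* a := a :* b :* c :* d :* e) refl a b c d e ⟩
    a * b * c * d * e ∎
    where open Solver

  fixed-A⇒ι : ∀ {x} → A x → σ x ≡ x → Σ ℤ λ z → x ≡ ι z
  fixed-A⇒ι {x} a f with σ-fixed x f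
  ... | q , refl with A-rational q a
  ... | z , refl = z , refl

  trace norm : K → K
  trace x = x + σ x + σ (σ x) + σ (σ (σ x)) + σ (σ (σ (σ x)))
  norm x = x * σ x * σ (σ x) * σ (σ (σ x)) * σ (σ (σ (σ x)))

  A-sum5 : ∀ {a b c d e} → A a → A b → A c → A d → A e → A (a + b + c + d + e)
  A-sum5 a b c d e = A-+ (A-+ (A-+ (A-+ a b) c) d) e

  A-product5 : ∀ {a b c d e} → A a → A b → A c → A d → A e → A (a * b * c * d * e)
  A-product5 a b c d e = A-* (A-* (A-* (A-* a b) c) d) e

  trace-ι : ∀ {x} → A x → Σ ℤ λ z → trace x ≡ ι z
  trace-ι {x} a = fixed-A⇒ι (A-sum5 a (A-σ a) (A-σ (A-σ a)) (A-σ (A-σ (A-σ a))) (A-σ (A-σ (A-σ (A-σ a))))) (orbit-sum-fixed (orbit-of x))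

  norm-ι : ∀ {x} → A x → Σ ℤ λ z → norm x ≡ ι z
  norm-ι {x} a = fixed-A⇒ι (A-product5 a (A-σ a) (A-σ (A-σ a)) (A-σ (A-σ (A-σ a))) (A-σ (A-σ (A-σ (A-σ a))))) (orbit-product-fixed (orbit-of x))

  -- The characteristic polynomial of x, i.e. the product of X - σʲ x.
  A⇒Integral : ∀ {x} → A x → Integralᶠ x
  A⇒Integral {x} ax = ℤ.- z5 ∷ z4 ∷ ℤ.- z3 ∷ z2 ∷ ℤ.- z1 ∷ [] , (begin
      ι (ℤ.- z5) + x * (ι z4 + x * (ι (ℤ.- z3) + x * (ι z2 + x * (ι (ℤ.- z1) + x * 1#))))
        ≡⟨ cong₂ (λ s t → s + x * (ι z4 + x * t)) (ι-neg z5) (cong₂ (λ s t → s + x * (ι z2 + x * t)) (ι-neg z3) (cong₂ (λ s t → s + x * t) (ι-neg z1) (sym const-1))) ⟩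
      - ι z5 + x * (ι z4 + x * (- ι z3 + x * (ι z2 + x * (- ι z1 + x * ι (pos 1)))))
        ≡⟨ cong₂ (λ s t → s + x * t) (cong -_ (sym (proj₂ e5))) (cong₂ (λ s t → s + x * t) (sym (proj₂ e4)) (cong₂ (λ s t → - s + x * t) (sym (proj₂ e3)) (cong₂ (λ s t → s + x * (- t + x * ι (pos 1))) (sym (proj₂ e2)) (sym (proj₂ e1))))) ⟩
      _ ≡⟨ solve 5 (λ a b c d e →
             :- (a :* b :* c :* d :* e) :+ a :* (
             ((a :* b :* c :* d) :+ (b :* c :* d :* e) :+ (c :* d :* e :* a) :+ (d :* e :* a :* b) :+ (e :* a :* b :* c)) :+ a :* (
             :- (((a :* b :* c) :+ (b :* c :* d) :+ (c :* d :* e) :+ (d :* e :* a) :+ (e :* a :* b)) :+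
                 ((a :* b :* d) :+ (b :* c :* e) :+ (c :* d :* a) :+ (d :* e :* b) :+ (e :* a :* c))) :+ a :* (
             (((a :* b) :+ (b :* c) :+ (c :* d) :+ (d :* e) :+ (e :* a)) :+
              ((a :* c) :+ (b :* d) :+ (c :* e) :+ (d :* a) :+ (e :* b))) :+ a :* (
             :- (a :+ b :+ c :+ d :+ e) :+ a :* con (pos 1))))) := con (pos 0)) refl x0 x1 x2 x3 x4 ⟩
      ι (pos 0) ≡⟨ const-0 ⟩
      0# ∎)
    where
    open Solver
    x0 = x
    x1 = σ x0
    x2 = σ x1
    x3 = σ x2
    x4 = σ x3
    a1 = A-σ ax
    a2 = A-σ a1
    a3 = A-σ a2
    a4 = A-σ a3
    o = orbit-of x
    o1 = rotate o
    o2 = rotate o1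
    o3 = rotate o2
    σ-sum : ∀ {u v} → σ u ≡ u → σ v ≡ v → σ (u + v) ≡ u + v
    σ-sum {u} {v} p q = trans (σ-+ u v) (cong₂ _+_ p q)
    e1 = fixed-A⇒ι (A-sum5 ax a1 a2 a3 a4) (orbit-sum-fixed o)
    -- The ten products of two conjugates form two orbits, of index distance 1 and 2; the ten
    -- products of three form two orbits as well.
    e2 = fixed-A⇒ι (A-+ (A-sum5 (A-* ax a1) (A-* a1 a2) (A-* a2 a3) (A-* a3 a4) (A-* a4 ax))
                        (A-sum5 (A-* ax a2) (A-* a1 a3) (A-* a2 a4) (A-* a3 ax) (A-* a4 a1)))
                   (σ-sum (orbit-sum-fixed (orbit-* o o1)) (orbit-sum-fixed (orbit-* o o2)))
    e3 = fixed-A⇒ι (A-+ (A-sum5 (A-* (A-* ax a1) a2) (A-* (A-* a1 a2) a3) (A-* (A-* a2 a3) a4) (A-* (A-* a3 a4) ax) (A-* (A-* a4 ax) a1))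
                        (A-sum5 (A-* (A-* ax a1) a3) (A-* (A-* a1 a2) a4) (A-* (A-* a2 a3) ax) (A-* (A-* a3 a4) a1) (A-* (A-* a4 ax) a2)))
                   (σ-sum (orbit-sum-fixed (orbit-* (orbit-* o o1) o2)) (orbit-sum-fixed (orbit-* (orbit-* o o1) o3)))
    e4 = fixed-A⇒ι (A-sum5 (A-* (A-* (A-* ax a1) a2) a3) (A-* (A-* (A-* a1 a2) a3) a4) (A-* (A-* (A-* a2 a3) a4) ax) (A-* (A-* (A-* a3 a4) ax) a1) (A-* (A-* (A-* a4 ax) a1) a2))
                   (orbit-sum-fixed (orbit-* (orbit-* (orbit-* o o1) o2) o3))
    e5 = fixed-A⇒ι (A-product5 ax a1 a2 a3 a4) (orbit-product-fixed o)
    z1 = proj₁ e1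
    z2 = proj₁ e2
    z3 = proj₁ e3
    z4 = proj₁ e4
    z5 = proj₁ e5

-- Eisenstein polynomials and dual bases

module Local (F : CyclicQuinticField) where
  open CyclicQuinticField F
  open AlmostIntegral F
  open ≡-Reasoning

  ^K-5 : ∀ x → x ^K 5 ≡ pow5 x
  ^K-5 x = cong (λ t → x * (x * (x * (x * t)))) (*-identityʳ x)

  A-pow5 : ∀ {x} → A x → A (pow5 x)
  A-pow5 a = A-* a (A-* a (A-* a (A-* a a)))

  ι-^ : ∀ z k → ι (z ℤ.^ k) ≡ ι z ^K k
  ι-^ z zero = const-1
  ι-^ z (suc k) = trans (ι-* z (z ℤ.^ k)) (cong (ι z *_) (ι-^ z k))

  ι-pow5 : ∀ z → ι (z ℤ.^ 5) ≡ pow5 (ι z)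
  ι-pow5 z = trans (ι-^ z 5) (^K-5 (ι z))

  A-lcℤ : ∀ {α} → A α → ∀ v → A (lcℤ α v)
  A-lcℤ aα (z0 ∷ z1 ∷ z2 ∷ z3 ∷ z4 ∷ []) =
    A-+ (A-ι z0) (A-* aα (A-+ (A-ι z1) (A-* aα (A-+ (A-ι z2) (A-* aα (A-+ (A-ι z3) (A-* aα (A-ι z4))))))))

  module Eisenstein (p : ℕ) (pr : Prime p) (α : K) (aα : A α) (c0 c1 c2 c3 c4 : ℤ) (p∤c0 : ¬ p ℕD.∣ ∣ c0 ∣)
    (α⁵ : pow5 α + ι (pos p) * lcℤ α (c0 ∷ c1 ∷ c2 ∷ c3 ∷ c4 ∷ []) ≡ 0#) where
    open Solver

    private
      P = ι (pos p)
      u' = ι c1 + α * (ι c2 + α * (ι c3 + α * ι c4))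
      u = ι c0 + α * u'
      a-u' : A u'
      a-u' = A-+ (A-ι c1) (A-* aα (A-+ (A-ι c2) (A-* aα (A-+ (A-ι c3) (A-* aα (A-ι c4))))))
      p≢0 : pos p ≢ pos 0
      p≢0 = prime≢0 pr

    -- The ideal (p, α) meets ℤ in pℤ: modulo pA the fifth power of P y + α w is α⁵ w⁵ = -P u w⁵,
    -- which is 0, so p ∣ r⁵.
    ideal-rational : ∀ r {y w} → A y → A w → ι r ≡ P * y + α * w → p ℕD.∣ ∣ r ∣
    ideal-rational r {y} {w} ay aw e = ∣^⇒∣ pr ∣ r ∣ 4 (subst (p ℕD.∣_) (∣∣-^ r 5)
      (A-∣ (pos p) (r ℤ.^ 5) p≢0 (A-minus (A-* ay aQ) (A-* (A-+ (A-ι c0) (A-* aα a-u')) (A-pow5 aw))) (sym (begin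
        ι (r ℤ.^ 5) ≡⟨ ι-pow5 r ⟩
        pow5 (ι r) ≡⟨ cong pow5 e ⟩
        pow5 (P * y + α * w) ≡⟨ solve 5 (λ P y α w u →
            (let s = P :* y :+ α :* w in s :* (s :* (s :* (s :* s))))
          := P :* (y :* (let a = P :* y ; s = α :* w in a :* a :* a :* a :+ con (pos 5) :* (a :* a :* a :* s) :+ con (pos 10) :* (a :* a :* s :* s) :+ con (pos 10) :* (a :* s :* s :* s) :+ con (pos 5) :* (s :* s :* s :* s))
                   :- u :* (w :* (w :* (w :* (w :* w)))))
             :+ (w :* (w :* (w :* (w :* w)))) :* (α :* (α :* (α :* (α :* α))) :+ P :* u)) refl P y α w u ⟩
        P * (y * Q - u * pow5 w) + pow5 w * (pow5 α + P * u) ≡⟨ cong (λ t → P * (y * Q - u * pow5 w) + pow5 w * t) α⁵ ⟩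
        P * (y * Q - u * pow5 w) + pow5 w * 0# ≡⟨ cong (P * (y * Q - u * pow5 w) +_) (zeroʳ (pow5 w)) ⟩
        P * (y * Q - u * pow5 w) + 0# ≡⟨ +-identityʳ _ ⟩
        P * (y * Q - u * pow5 w) ∎))))
      where
      a = P * y
      s = α * w
      aa = A-* (A-ι (pos p)) ay
      as = A-* aα aw
      Q = a * a * a * a + ι (pos 5) * (a * a * a * s) + ι (pos 10) * (a * a * s * s) + ι (pos 10) * (a * s * s * s) + ι (pos 5) * (s * s * s * s)
      aQ : A Q
      aQ = A-+ (A-+ (A-+ (A-+ (A-* (A-* (A-* aa aa) aa) aa) (A-* (A-ι (pos 5)) (A-* (A-* (A-* aa aa) aa) as)))
        (A-* (A-ι (pos 10)) (A-* (A-* (A-* aa aa) as) as))) (A-* (A-ι (pos 10)) (A-* (A-* (A-* aa as) as) as)))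
        (A-* (A-ι (pos 5)) (A-* (A-* (A-* as as) as) as))

    -- Multiplying by α^(i+1) raises αʲ to α⁵ = -P u. After cancelling P this says α^(i+1) x = -u (d
    -- + α w'), whose right side is -c0 d modulo α. So c0 d lies in αA, and p ∣ d by
    -- `ideal-rational`. Subtracting (d / p) αʲ from x removes this digit and prepares the next one.
    digit : ∀ {x w'} d i j → i ℕ.+ j ≡ 4 → A x → A w' → P * x ≡ α ^K j * (ι d + α * w') →
      Σ ℤ λ e → d ≡ e ℤ.* pos p × A (x - ι e * α ^K j) × P * (x - ι e * α ^K j) ≡ α ^K suc j * w'
    digit {x} {w'} d i j i+j≡4 ax aw' h = e , d≡ep , A-minus ax (A-* (A-ι e) (A-^ aα j)) , (begin
        P * (x - ι e * α ^K j) ≡⟨ solve 4 (λ P x e a → P :* (x :- e :* a) := P :* x :- a :* (e :* P)) refl P x (ι e) (α ^K j) ⟩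
        P * x - α ^K j * (ι e * P) ≡⟨ cong₂ (λ s t → s - α ^K j * t) h (trans (sym (ι-* e (pos p))) (cong ι (sym d≡ep))) ⟩
        α ^K j * (ι d + α * w') - α ^K j * ι d ≡⟨ solve 4 (λ a d α w → a :* (d :+ α :* w) :- a :* d := (α :* a) :* w) refl (α ^K j) (ι d) α w' ⟩
        α ^K suc j * w' ∎)
      where
      w = ι d + α * w'
      αi+1x : α ^K suc i * x ≡ - (u * w)
      αi+1x = ι-cancel (pos p) p≢0 (begin
        P * (α ^K suc i * x) ≡⟨ solve 3 (λ P a x → P :* (a :* x) := a :* (P :* x)) refl P (α ^K suc i) x ⟩
        α ^K suc i * (P * x) ≡⟨ cong (α ^K suc i *_) h ⟩
        α ^K suc i * (α ^K j * w) ≡⟨ *-assoc _ _ _ ⟨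
        α ^K suc i * α ^K j * w ≡⟨ cong (_* w) (^K-+ α (suc i) j) ⟨
        α ^K (suc i ℕ.+ j) * w ≡⟨ cong (λ t → α ^K suc t * w) i+j≡4 ⟩
        α ^K 5 * w ≡⟨ cong (_* w) (^K-5 α) ⟩
        pow5 α * w ≡⟨ solve 4 (λ a P u w → a :* w := w :* (a :+ P :* u) :+ P :* (:- (u :* w))) refl (pow5 α) P u w ⟩
        w * (pow5 α + P * u) + P * (- (u * w)) ≡⟨ cong (λ t → w * t + P * (- (u * w))) α⁵ ⟩
        w * 0# + P * (- (u * w)) ≡⟨ cong (_+ P * (- (u * w))) (zeroʳ w) ⟩
        0# + P * (- (u * w)) ≡⟨ +-identityˡ _ ⟩
        P * (- (u * w)) ∎)
      eq : ι (c0 ℤ.* d) ≡ P * 0# + α * (- (α ^K i * x) - ι c0 * w' - u' * (ι d + α * w'))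
      eq = begin
        ι (c0 ℤ.* d) ≡⟨ ι-* c0 d ⟩
        ι c0 * ι d ≡⟨ solve 5 (λ c d α w u → c :* d := :- (:- ((c :+ α :* u) :* (d :+ α :* w))) :- α :* (c :* w) :- α :* (u :* (d :+ α :* w))) refl (ι c0) (ι d) α w' u' ⟩
        - (- (u * w)) - α * (ι c0 * w') - α * (u' * w) ≡⟨ cong (λ t → - t - α * (ι c0 * w') - α * (u' * w)) αi+1x ⟨
        - (α ^K suc i * x) - α * (ι c0 * w') - α * (u' * w)
          ≡⟨ solve 6 (λ a α x c w v → :- ((α :* a) :* x) :- α :* (c :* w) :- α :* v := α :* (:- (a :* x) :- c :* w :- v)) refl (α ^K i) α x (ι c0) w' (u' * w) ⟩
        α * (- (α ^K i * x) - ι c0 * w' - u' * w) ≡⟨ +-identityˡ _ ⟨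
        0# + α * (- (α ^K i * x) - ι c0 * w' - u' * w) ≡⟨ cong (_+ α * (- (α ^K i * x) - ι c0 * w' - u' * w)) (zeroʳ P) ⟨
        P * 0# + α * (- (α ^K i * x) - ι c0 * w' - u' * w) ∎
      p∣d : p ℕD.∣ ∣ d ∣
      p∣d = prime∣*⇒∣ pr c0 d p∤c0 (ideal-rational (c0 ℤ.* d) A-0
        (A-minus (A-minus (A-neg (A-* (A-^ aα i) ax)) (A-* (A-ι c0) aw')) (A-* a-u' (A-+ (A-ι d) (A-* aα aw')))) eq)
      e = proj₁ (∣-signed p d p∣d)
      d≡ep = proj₂ (∣-signed p d p∣d)

    digits : ∀ {x} d0 d1 d2 d3 d4 → A x → P * x ≡ lcℤ α (d0 ∷ d1 ∷ d2 ∷ d3 ∷ d4 ∷ []) →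
      (Σ ℤ λ e → d0 ≡ e ℤ.* pos p) × (Σ ℤ λ e → d1 ≡ e ℤ.* pos p) × (Σ ℤ λ e → d2 ≡ e ℤ.* pos p) × (Σ ℤ λ e → d3 ≡ e ℤ.* pos p) × (Σ ℤ λ e → d4 ≡ e ℤ.* pos p)
    digits {x} d0 d1 d2 d3 d4 ax h = (e0 , q0) , (e1 , q1) , (e2 , q2) , (e3 , q3) , (e4 , q4)
      where
      a3 = A-+ (A-ι d3) (A-* aα (A-ι d4))
      a2 = A-+ (A-ι d2) (A-* aα a3)
      a1 = A-+ (A-ι d1) (A-* aα a2)
      s0 = digit d0 4 0 refl ax a1 (trans h (sym (*-identityˡ _)))
      e0 = proj₁ s0
      q0 = proj₁ (proj₂ s0)
      s1 = digit d1 3 1 refl (proj₁ (proj₂ (proj₂ s0))) a2 (proj₂ (proj₂ (proj₂ s0)))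
      e1 = proj₁ s1
      q1 = proj₁ (proj₂ s1)
      s2 = digit d2 2 2 refl (proj₁ (proj₂ (proj₂ s1))) a3 (proj₂ (proj₂ (proj₂ s1)))
      e2 = proj₁ s2
      q2 = proj₁ (proj₂ s2)
      s3 = digit d3 1 3 refl (proj₁ (proj₂ (proj₂ s2))) (A-ι d4) (proj₂ (proj₂ (proj₂ s2)))
      e3 = proj₁ s3
      q3 = proj₁ (proj₂ s3)
      s4 = digit d4 0 4 refl (proj₁ (proj₂ (proj₂ s3))) A-0
        (trans (proj₂ (proj₂ (proj₂ s3))) (cong (α ^K 4 *_) (sym (trans (cong (ι d4 +_) (zeroʳ α)) (+-identityʳ (ι d4))))))
      e4 = proj₁ s4
      q4 = proj₁ (proj₂ s4)

  -- Here y stands for Δ / f'(α), with f the polynomial of α. The trace of y x is Δ times the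
  -- α⁴-coefficient of x, and it is an integer for x in A. The lower coefficients are brought to the
  -- top by multiplying x by α.
  module DualBasis (α : K) (aα : A α) (g0 g1 g2 g3 g4 : ℤ)
    (α⁵ : pow5 α + lcℤ α (g0 ∷ g1 ∷ g2 ∷ g3 ∷ g4 ∷ []) ≡ 0#)
    (y : K) (ay : A y) (Δ : ℤ)
    (t0 : trace y ≡ 0#) (t1 : trace (y * α) ≡ 0#) (t2 : trace (y * (α * α)) ≡ 0#) (t3 : trace (y * (α * (α * α))) ≡ 0#)
    (t4 : trace (y * (α * (α * (α * α)))) ≡ ι Δ) where
    open Solver

    trace-+ : ∀ u v → trace (u + v) ≡ trace u + trace v
    trace-+ u v = trans
      (cong₂ _+_ (cong₂ _+_ (cong₂ _+_ (cong (u + v +_) s1) s2) s3) s4)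
      (solve 10 (λ a a' b b' c c' d d' e e' → (a :+ a') :+ (b :+ b') :+ (c :+ c') :+ (d :+ d') :+ (e :+ e') := (a :+ b :+ c :+ d :+ e) :+ (a' :+ b' :+ c' :+ d' :+ e'))
        refl u v (σ u) (σ v) (σ (σ u)) (σ (σ v)) (σ (σ (σ u))) (σ (σ (σ v))) (σ (σ (σ (σ u)))) (σ (σ (σ (σ v)))))
      where
      s1 = σ-+ u v
      s2 = trans (cong σ s1) (σ-+ _ _)
      s3 = trans (cong σ s2) (σ-+ _ _)
      s4 = trans (cong σ s3) (σ-+ _ _)

    trace-const : ∀ q u → trace (const q * u) ≡ const q * trace u
    trace-const q u = trans
      (cong₂ _+_ (cong₂ _+_ (cong₂ _+_ (cong (const q * u +_) s1) s2) s3) s4)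
      (solve 6 (λ q a b c d e → q :* a :+ q :* b :+ q :* c :+ q :* d :+ q :* e := q :* (a :+ b :+ c :+ d :+ e)) refl (const q) u (σ u) (σ (σ u)) (σ (σ (σ u))) (σ (σ (σ (σ u)))))
      where
      step : ∀ {v w} → v ≡ const q * w → σ v ≡ const q * σ w
      step {w = w} refl = trans (σ-* (const q) w) (cong (_* σ w) (σ-const q))
      s1 = step refl
      s2 = step s1
      s3 = step s2
      s4 = step s3

    top-coefficient : ∀ b0 b1 b2 b3 b4 → A (lc α (b0 ∷ b1 ∷ b2 ∷ b3 ∷ b4 ∷ [])) → IsInt (toℚ Δ ℚ.* b4)
    top-coefficient b0 b1 b2 b3 b4 a = subst IsInt (const-injective (trans (sym (proj₂ tr)) e)) (proj₁ tr , refl)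
      where
      x = lc α (b0 ∷ b1 ∷ b2 ∷ b3 ∷ b4 ∷ [])
      tr = trace-ι (A-* ay a)
      e : trace (y * x) ≡ const (toℚ Δ ℚ.* b4)
      e = begin
        trace (y * x) ≡⟨ cong trace (solve 7 (λ y α b0 b1 b2 b3 b4 → y :* (b0 :+ α :* (b1 :+ α :* (b2 :+ α :* (b3 :+ α :* b4)))) :=
            b0 :* y :+ (b1 :* (y :* α) :+ (b2 :* (y :* (α :* α)) :+ (b3 :* (y :* (α :* (α :* α))) :+ b4 :* (y :* (α :* (α :* (α :* α)))))))) refl y α (const b0) (const b1) (const b2) (const b3) (const b4)) ⟩
        trace (const b0 * y + (const b1 * (y * α) + (const b2 * (y * (α * α)) + (const b3 * (y * (α * (α * α))) + const b4 * (y * (α * (α * (α * α))))))))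
          ≡⟨ trans (trace-+ _ _) (cong₂ _+_ (trace-const b0 _) (trans (trace-+ _ _) (cong₂ _+_ (trace-const b1 _) (trans (trace-+ _ _) (cong₂ _+_ (trace-const b2 _) (trans (trace-+ _ _) (cong₂ _+_ (trace-const b3 _) (trace-const b4 _)))))))) ⟩
        const b0 * trace y + (const b1 * trace (y * α) + (const b2 * trace (y * (α * α)) + (const b3 * trace (y * (α * (α * α))) + const b4 * trace (y * (α * (α * (α * α)))))))
          ≡⟨ cong₂ _+_ (cong (const b0 *_) t0) (cong₂ _+_ (cong (const b1 *_) t1) (cong₂ _+_ (cong (const b2 *_) t2) (cong₂ _+_ (cong (const b3 *_) t3) (cong (const b4 *_) t4)))) ⟩
        const b0 * 0# + (const b1 * 0# + (const b2 * 0# + (const b3 * 0# + const b4 * ι Δ)))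
          ≡⟨ cong₂ _+_ (zeroʳ _) (cong₂ _+_ (zeroʳ _) (cong₂ _+_ (zeroʳ _) (cong (_+ const b4 * ι Δ) (zeroʳ _)))) ⟩
        0# + (0# + (0# + (0# + const b4 * ι Δ))) ≡⟨ trans (+-identityˡ _) (trans (+-identityˡ _) (trans (+-identityˡ _) (+-identityˡ _))) ⟩
        const b4 * ι Δ ≡⟨ *-comm _ _ ⟩
        ι Δ * const b4 ≡⟨ const-* (toℚ Δ) b4 ⟨
        const (toℚ Δ ℚ.* b4) ∎

    private
      g : Vec ℤ 5
      g = g0 ∷ g1 ∷ g2 ∷ g3 ∷ g4 ∷ []

      A-shift : ∀ b → A (lc α b) → A (lc α (shift g b))
      A-shift b a = A-≡ (sym (lc-shift α g α⁵ b)) (A-* aα a)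

      -- Multiplication by α moves a coefficient b to the next place, less g times the top
      -- coefficient c, for which the bound is already known.
      un-reduce : ∀ g {b c} → IsInt (toℚ Δ ℚ.* (b ℚ.- toℚ g ℚ.* c)) → IsInt (toℚ Δ ℚ.* c) → IsInt (toℚ Δ ℚ.* b)
      un-reduce g {b} {c} i j = subst IsInt
        (S.solve 4 (λ D b g c → D S.:* (b S.:- g S.:* c) S.:+ g S.:* (D S.:* c) S.:= D S.:* b) refl (toℚ Δ) b (toℚ g) c)
        (int-+ i (int-* (int-toℚ g) j))
        where
        module S = +-*-Solver

      coefficient4 : ∀ b → A (lc α b) → IsInt (toℚ Δ ℚ.* Vec.lookup b 4F)
      coefficient4 (b0 ∷ b1 ∷ b2 ∷ b3 ∷ b4 ∷ []) = top-coefficient b0 b1 b2 b3 b4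

      coefficient3 : ∀ b → A (lc α b) → IsInt (toℚ Δ ℚ.* Vec.lookup b 3F)
      coefficient3 b@(_ ∷ _ ∷ _ ∷ _ ∷ _ ∷ []) a = un-reduce g4 (coefficient4 (shift g b) (A-shift b a)) (coefficient4 b a)

      coefficient2 : ∀ b → A (lc α b) → IsInt (toℚ Δ ℚ.* Vec.lookup b 2F)
      coefficient2 b@(_ ∷ _ ∷ _ ∷ _ ∷ _ ∷ []) a = un-reduce g3 (coefficient3 (shift g b) (A-shift b a)) (coefficient4 b a)

      coefficient1 : ∀ b → A (lc α b) → IsInt (toℚ Δ ℚ.* Vec.lookup b 1F)
      coefficient1 b@(_ ∷ _ ∷ _ ∷ _ ∷ _ ∷ []) a = un-reduce g2 (coefficient2 (shift g b) (A-shift b a)) (coefficient4 b a)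

      coefficient0 : ∀ b → A (lc α b) → IsInt (toℚ Δ ℚ.* Vec.lookup b 0F)
      coefficient0 b@(_ ∷ _ ∷ _ ∷ _ ∷ _ ∷ []) a = un-reduce g1 (coefficient1 (shift g b) (A-shift b a)) (coefficient4 b a)

    bounded-denominators : ∀ b → A (lc α b) → ∀ i → IsInt (toℚ Δ ℚ.* Vec.lookup b i)
    bounded-denominators b a 0F = coefficient0 b a
    bounded-denominators b a 1F = coefficient1 b a
    bounded-denominators b a 2F = coefficient2 b a
    bounded-denominators b a 3F = coefficient3 b a
    bounded-denominators b a 4F = coefficient4 b a

-- The wildly ramified prime

prime5 : Prime 5
prime5 = from-yes (prime? 5)

module WildPrime (F : CyclicQuinticField) where
  open CyclicQuinticField F
  open AlmostIntegral F
  open Local F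
  open ≡-Reasoning
  open Solver

  private
    five : K
    five = ι (pos 5)

  -- The prime above 5. As 5 is totally ramified, it consists of the elements whose fifth power lies
  -- in 5A; closure under addition then rests on the inner binomial coefficients of the fifth power
  -- being divisible by 5, and stability under σ is immediate.
  𝔓 : K → Set
  𝔓 x = A x × Σ K λ y → A y × pow5 x ≡ five * y

  𝔓-≡ : ∀ {x y} → x ≡ y → 𝔓 x → 𝔓 y
  𝔓-≡ refl h = h

  𝔓-+ : ∀ {x y} → 𝔓 x → 𝔓 y → 𝔓 (x + y)
  𝔓-+ {x} {y} (ax , u , au , p) (ay , v , av , q) = A-+ ax ay , u + v + w ,
    A-+ (A-+ au av) (A-+ (A-+ (A-+ (A-* (A-* (A-* (A-* ax ax) ax) ax) ay) (A-* (A-ι (pos 2)) (A-* (A-* (A-* (A-* ax ax) ax) ay) ay)))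
      (A-* (A-ι (pos 2)) (A-* (A-* (A-* (A-* ax ax) ay) ay) ay))) (A-* (A-* (A-* (A-* ax ay) ay) ay) ay)) , (begin
    pow5 (x + y) ≡⟨ solve 2 (λ x y → (let s = x :+ y in s :* (s :* (s :* (s :* s)))) :=
        (x :* (x :* (x :* (x :* x)))) :+ (y :* (y :* (y :* (y :* y)))) :+ con (pos 5) :* (x :* x :* x :* x :* y :+ con (pos 2) :* (x :* x :* x :* y :* y) :+ con (pos 2) :* (x :* x :* y :* y :* y) :+ x :* y :* y :* y :* y)) refl x y ⟩
    pow5 x + pow5 y + five * w ≡⟨ cong₂ (λ s t → s + t + five * w) p q ⟩
    five * u + five * v + five * w ≡⟨ solve 4 (λ f u v w → f :* u :+ f :* v :+ f :* w := f :* (u :+ v :+ w)) refl five u v w ⟩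
    five * (u + v + w) ∎)
    where
    w = x * x * x * x * y + ι (pos 2) * (x * x * x * y * y) + ι (pos 2) * (x * x * y * y * y) + x * y * y * y * y

  𝔓-*ˡ : ∀ {x y} → A x → 𝔓 y → 𝔓 (x * y)
  𝔓-*ˡ {x} {y} ax (ay , v , av , q) = A-* ax ay , pow5 x * v , A-* (A-pow5 ax) av , (begin
    pow5 (x * y) ≡⟨ solve 2 (λ x y → (let s = x :* y in s :* (s :* (s :* (s :* s)))) := (x :* (x :* (x :* (x :* x)))) :* (y :* (y :* (y :* (y :* y))))) refl x y ⟩
    pow5 x * pow5 y ≡⟨ cong (pow5 x *_) q ⟩
    pow5 x * (five * v) ≡⟨ solve 3 (λ f x v → x :* (f :* v) := f :* (x :* v)) refl five (pow5 x) v ⟩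
    five * (pow5 x * v) ∎)

  𝔓-*ʳ : ∀ {x y} → 𝔓 x → A y → 𝔓 (x * y)
  𝔓-*ʳ px ay = 𝔓-≡ (*-comm _ _) (𝔓-*ˡ ay px)

  𝔓-five : ∀ {y} → A y → 𝔓 (five * y)
  𝔓-five {y} ay = A-* (A-ι (pos 5)) ay , five * (five * (five * five)) * pow5 y , A-* (A-* (A-ι (pos 5)) (A-* (A-ι (pos 5)) (A-* (A-ι (pos 5)) (A-ι (pos 5))))) (A-pow5 ay) ,
    solve 2 (λ f y → (let s = f :* y in s :* (s :* (s :* (s :* s)))) := f :* (f :* (f :* (f :* f)) :* (y :* (y :* (y :* (y :* y)))))) refl five y

  σ-pow5 : ∀ x → σ (pow5 x) ≡ pow5 (σ x)
  σ-pow5 x = trans (cong σ (sym (^K-5 x))) (trans (σ-^ x 5) (^K-5 (σ x)))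

  𝔓-σ : ∀ {x} → 𝔓 x → 𝔓 (σ x)
  𝔓-σ {x} (ax , u , au , p) = A-σ ax , σ u , A-σ au ,
    trans (sym (σ-pow5 x)) (trans (cong σ p) (trans (σ-* five u) (cong (_* σ u) (σ-const (toℚ (pos 5))))))

  𝔓-rational : ∀ r → 𝔓 (ι r) → 5 ℕD.∣ ∣ r ∣
  𝔓-rational r (_ , y , ay , e) = ∣^⇒∣ prime5 ∣ r ∣ 4 (subst (5 ℕD.∣_) (∣∣-^ r 5)
    (A-∣ (pos 5) (r ℤ.^ 5) (λ ()) ay (trans (sym e) (sym (ι-pow5 r)))))

  infix 4 _≡𝔓_
  _≡𝔓_ : K → K → Set
  x ≡𝔓 y = 𝔓 (x - y)

  ≡𝔓-* : ∀ {x y u v} → A x → A v → x ≡𝔓 u → y ≡𝔓 v → x * y ≡𝔓 u * v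
  ≡𝔓-* {x} {y} {u} {v} ax av p q = 𝔓-≡ (solve 4 (λ x y u v → x :* (y :- v) :+ (x :- u) :* v := x :* y :- u :* v) refl x y u v)
    (𝔓-+ (𝔓-*ˡ ax q) (𝔓-*ʳ p av))

  -- Since 𝔓 is stable under σ and a is fixed by it, all five conjugates of x are congruent to a.
  norm-≡𝔓 : ∀ {x} a → A x → x ≡𝔓 ι a → norm x ≡𝔓 ι (a ℤ.^ 5)
  norm-≡𝔓 {x} a ax p = 𝔓-≡ (cong (λ t → norm x - t) (trans (solve 1 (λ a → a :* a :* a :* a :* a := a :* (a :* (a :* (a :* a)))) refl (ι a)) (sym (ι-pow5 a))))
    (≡𝔓-* (A-* (A-* (A-* ax a1) a2) a3) ai (≡𝔓-* (A-* (A-* ax a1) a2) ai (≡𝔓-* (A-* ax a1) ai (≡𝔓-* ax ai p p1) p2) p3) p4)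
    where
    ai = A-ι a
    st : ∀ {y} → y ≡𝔓 ι a → σ y ≡𝔓 ι a
    st {y} h = 𝔓-≡ (trans (σ-minus y (ι a)) (cong (λ t → σ y - t) (σ-const (toℚ a)))) (𝔓-σ h)
    p1 = st p
    p2 = st p1
    p3 = st p2
    p4 = st p3
    a1 = A-σ ax
    a2 = A-σ a1
    a3 = A-σ a2

  ι-≡𝔓 : ∀ {x} a b → x ≡ ι b → x ≡𝔓 ι a → 5 ℕD.∣ ∣ b ℤ.- a ∣
  ι-≡𝔓 a b refl p = 𝔓-rational (b ℤ.- a) (𝔓-≡ (sym (ι-minus b a)) p)

  norm-* : ∀ x y → norm (x * y) ≡ norm x * norm y
  norm-* x y = trans
    (cong₂ _*_ (cong₂ _*_ (cong₂ _*_ (cong (x * y *_) s1) s2) s3) s4)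
    (solve 10 (λ a a' b b' c c' d d' e e' → (a :* a') :* (b :* b') :* (c :* c') :* (d :* d') :* (e :* e') := (a :* b :* c :* d :* e) :* (a' :* b' :* c' :* d' :* e'))
      refl x y (σ x) (σ y) (σ (σ x)) (σ (σ y)) (σ (σ (σ x))) (σ (σ (σ y))) (σ (σ (σ (σ x)))) (σ (σ (σ (σ y)))))
    where
    s1 = σ-* x y
    s2 = trans (cong σ s1) (σ-* _ _)
    s3 = trans (cong σ s2) (σ-* _ _)
    s4 = trans (cong σ s3) (σ-* _ _)

  A-evalℤ : ∀ cs {x} → A x → A (evalℤK cs x)
  A-evalℤ [] ax = A-0
  A-evalℤ (c ∷ cs) ax = A-+ (A-ι c) (A-* ax (A-evalℤ cs ax))

  σ-eval : ∀ cs x → σ (evalℤK cs x) ≡ evalℤK cs (σ x)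
  σ-eval [] x = σ-0
  σ-eval (c ∷ cs) x = trans (σ-+ _ _) (cong₂ _+_ (σ-const (toℚ c)) (trans (σ-* x _) (cong (σ x *_) (σ-eval cs x))))

  -- The usual factor x' - x of a difference of polynomial values, with cofactor in A. If σα is a
  -- polynomial in α, it makes σ²α - σα a multiple of σα - α.
  eval-difference : ∀ cs {x x'} → A x → A x' → Σ K λ q → A q × evalℤK cs x' - evalℤK cs x ≡ (x' - x) * q
  eval-difference [] {x} {x'} ax ax' = 0# , A-0 , trans (-‿inverseʳ 0#) (sym (zeroʳ (x' - x)))
  eval-difference (c ∷ cs) {x} {x'} ax ax' = evalℤK cs x' + x * q , A-+ (A-evalℤ cs ax') (A-* ax aq) , (begin
    (ι c + x' * e') - (ι c + x * e) ≡⟨ solve 5 (λ c x x' e e' → (c :+ x' :* e') :- (c :+ x :* e) := (x' :- x) :* e' :+ x :* (e' :- e)) refl (ι c) x x' e e' ⟩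
    (x' - x) * e' + x * (e' - e) ≡⟨ cong (λ t → (x' - x) * e' + x * t) h ⟩
    (x' - x) * e' + x * ((x' - x) * q) ≡⟨ solve 4 (λ d x e q → d :* e :+ x :* (d :* q) := d :* (e :+ x :* q)) refl (x' - x) x e' q ⟩
    (x' - x) * (e' + x * q) ∎)
    where
    ih = eval-difference cs ax ax'
    q = proj₁ ih
    aq = proj₁ (proj₂ ih)
    h = proj₂ (proj₂ ih)
    e = evalℤK cs x
    e' = evalℤK cs x'

  private
    minus-zero : ∀ {x y} → x - y ≡ 0# → x ≡ y
    minus-zero {x} {y} e = trans (solve 2 (λ x y → x := (x :- y) :+ y) refl x y) (trans (cong (_+ y) e) (+-identityˡ y))

  -- The norm is an integer z with (z - 1) a = 0. Only the scalar z - 1 has to be shown to vanish,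
  -- so a is not inverted.
  norm-fixing : ∀ {a v} → A v → a ≢ 0# → a * norm v ≡ a → norm v ≡ 1#
  norm-fixing {a} {v} av a≢0 e = trans nz (trans (cong const z≡1) const-1)
    where
    z = proj₁ (norm-ι av)
    nz = proj₂ (norm-ι av)
    z-1≡0 : toℚ z ℚ.- 1ℚ ≡ 0ℚ
    z-1≡0 = scalar-cancel (toℚ z ℚ.- 1ℚ) a a≢0 (begin
      const (toℚ z ℚ.- 1ℚ) * a ≡⟨ cong (_* a) (const-minus (toℚ z) 1ℚ) ⟩
      (ι z - ι (pos 1)) * a ≡⟨ solve 2 (λ z a → (z :- con (pos 1)) :* a := a :* z :- a) refl (ι z) a ⟩
      a * ι z - a ≡⟨ cong (_- a) (trans (cong (a *_) (sym nz)) e) ⟩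
      a - a ≡⟨ -‿inverseʳ a ⟩
      0# ∎)
    z≡1 : toℚ z ≡ 1ℚ
    z≡1 = trans (GroupP.inverseˡ-unique (toℚ z) (ℚ.- 1ℚ) z-1≡0) refl

  module _ (residue : ∀ x → A x → Σ ℕ λ r → r ℕ.< 5 × x ≡𝔓 ι (pos r)) (θ : K) (σθ≢θ : σ θ ≢ θ) where

    -- With a = σ α − α and b = σ² α − α, the quotients ε = σ a / a and b / a = 1 + ε are units.
    -- Modulo 𝔓 the unit ε of norm 1 becomes a fifth root of 1 in 𝔽₅, that is 1,
    -- so that 1 + ε has norm 2⁵ ≡ 2, which is not ±1.
    no-power-basis : ∀ α → A α → (∀ x → A x → Σ (List ℤ) λ cs → evalℤK cs α ≡ x) → ⊥
    no-power-basis α aα gen = impossible (proj₁ (residue ε aε)) (proj₁ (proj₂ (residue ε aε))) (proj₂ (proj₂ (residue ε aε)))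
      where
      a b : K
      a = σ α - α
      b = σ (σ α) - α
      -- If σ fixed α, it would fix all of ℤ[α], which contains a nonzero multiple of θ.
      a≢0 : a ≢ 0#
      a≢0 e = σθ≢θ (ι-cancel N N≢0 (begin
        ι N * σ θ ≡⟨ cong (_* σ θ) (σ-const (toℚ N)) ⟨
        σ (ι N) * σ θ ≡⟨ σ-* (ι N) θ ⟨
        σ (ι N * θ) ≡⟨ cong σ Nθ ⟨
        σ (evalℤK cs α) ≡⟨ σ-eval cs α ⟩
        evalℤK cs (σ α) ≡⟨ cong (evalℤK cs) (minus-zero e) ⟩
        evalℤK cs α ≡⟨ Nθ ⟩
        ι N * θ ∎))
        where
        N = proj₁ (Λ-denominator θ)
        N≢0 = proj₁ (proj₂ (Λ-denominator θ))
        cs = proj₁ (gen (ι N * θ) (A-Λ (proj₂ (proj₂ (Λ-denominator θ)))))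
        Nθ = proj₂ (gen (ι N * θ) (A-Λ (proj₂ (proj₂ (Λ-denominator θ)))))
      g1 = gen (σ α) (A-σ aα)
      d1 = eval-difference (proj₁ g1) aα (A-σ aα)
      ε = proj₁ d1
      aε = proj₁ (proj₂ d1)
      σa : σ a ≡ a * ε
      σa = trans (σ-minus (σ α) α) (trans (cong₂ _-_ (trans (cong σ (sym (proj₂ g1))) (σ-eval (proj₁ g1) α)) (sym (proj₂ g1))) (proj₂ (proj₂ d1)))
      g2 = gen (σ (σ α)) (A-σ (A-σ aα))
      d2 = eval-difference (proj₁ g2) aα (A-σ (A-σ aα))
      η = proj₁ d2
      aη = proj₁ (proj₂ d2)
      σσb : σ (σ b) ≡ b * η
      σσb = trans (trans (cong σ (σ-minus _ _)) (σ-minus _ _))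
        (trans (cong₂ _-_ (trans (cong (λ t → σ (σ t)) (sym (proj₂ g2))) (trans (cong σ (σ-eval (proj₁ g2) α)) (σ-eval (proj₁ g2) (σ α)))) (sym (proj₂ g2))) (proj₂ (proj₂ d2)))
      b≡a[1+ε] : b ≡ a * (ι (pos 1) + ε)
      b≡a[1+ε] = begin
        σ (σ α) - α ≡⟨ solve 3 (λ x y z → x :- z := (x :- y) :+ (y :- z)) refl (σ (σ α)) (σ α) α ⟩
        (σ (σ α) - σ α) + a ≡⟨ cong (_+ a) (trans (sym (σ-minus (σ α) α)) σa) ⟩
        a * ε + a ≡⟨ solve 2 (λ a e → a :* e :+ a := a :* (con (pos 1) :+ e)) refl a ε ⟩
        a * (ι (pos 1) + ε) ∎
      -- Since σ⁶ = σ, the difference a = σ⁶α - α telescopes into steps of σ². These are b, σ²b = b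
      -- η and σ⁴b = b η σ²η, so a = b κ, and v = (1 + ε) κ satisfies a v = a.
      κ v : K
      κ = ι (pos 1) + η + η * σ (σ η)
      v = (ι (pos 1) + ε) * κ
      a1+ε = A-+ (A-ι (pos 1)) aε
      aκ = A-+ (A-+ (A-ι (pos 1)) aη) (A-* aη (A-σ (A-σ aη)))
      a≡bκ : a ≡ b * κ
      a≡bκ = begin
        σ α - α ≡⟨ cong (λ t → t - α) (σ⁵ (σ α)) ⟨
        σ (σ (σ (σ (σ (σ α))))) - α ≡⟨ solve 4 (λ x y z w → x :- w := (x :- y) :+ (y :- z) :+ (z :- w)) refl (σ (σ (σ (σ (σ (σ α)))))) (σ (σ (σ (σ α)))) (σ (σ α)) α ⟩
        (σ (σ (σ (σ (σ (σ α))))) - σ (σ (σ (σ α)))) + (σ (σ (σ (σ α))) - σ (σ α)) + b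
          ≡⟨ cong₂ (λ s t → s + t + b) (trans (sym (trans (cong σ (trans (cong σ (trans (cong σ (σ-minus _ _)) (σ-minus _ _))) (σ-minus _ _))) (σ-minus _ _))) (trans (cong (λ t → σ (σ t)) σσb) (trans (cong σ (σ-* b η)) (trans (σ-* _ _) (cong (_* σ (σ η)) σσb)))))
                              (trans (sym (trans (cong σ (σ-minus _ _)) (σ-minus _ _))) σσb) ⟩
        b * η * σ (σ η) + b * η + b ≡⟨ solve 3 (λ b h k → b :* h :* k :+ b :* h :+ b := b :* (con (pos 1) :+ h :+ h :* k)) refl b η (σ (σ η)) ⟩
        b * κ ∎
      ε1 ε2 ε3 ε4 : K
      ε1 = σ ε
      ε2 = σ ε1
      ε3 = σ ε2
      ε4 = σ ε3
      -- Each application of σ multiplies a by one more conjugate of ε, and σ⁵ is the identity.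
      a*norm-ε : a * norm ε ≡ a
      a*norm-ε = begin
        a * (ε * ε1 * ε2 * ε3 * ε4) ≡⟨ solve 6 (λ a e e1 e2 e3 e4 → a :* (e :* e1 :* e2 :* e3 :* e4) := a :* e :* e1 :* e2 :* e3 :* e4) refl a ε ε1 ε2 ε3 ε4 ⟩
        a * ε * ε1 * ε2 * ε3 * ε4 ≡⟨ s5 ⟨
        σ (σ (σ (σ (σ a)))) ≡⟨ σ⁵ a ⟩
        a ∎
        where
        s2 = trans (cong σ σa) (trans (σ-* _ _) (cong (_* ε1) σa))
        s3 = trans (cong σ s2) (trans (σ-* _ _) (cong (_* ε2) (trans (σ-* _ _) (cong (_* ε1) σa))))
        s4 = trans (cong σ s3) (trans (σ-* _ _) (cong (_* ε3) (trans (σ-* _ _) (cong (_* ε2) (trans (σ-* _ _) (cong (_* ε1) σa))))))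
        s5 = trans (cong σ s4) (trans (σ-* _ _) (cong (_* ε4) (trans (σ-* _ _) (cong (_* ε3) (trans (σ-* _ _) (cong (_* ε2) (trans (σ-* _ _) (cong (_* ε1) σa))))))))
      norm-ε : norm ε ≡ 1#
      norm-ε = norm-fixing aε a≢0 a*norm-ε
      -- Applying σ to a w = a gives a ε σw = a ε. The factor ε is removed by multiplying with its
      -- other four conjugates, because a times the norm of ε is a.
      fix-σ : ∀ {w} → a * w ≡ a → a * σ w ≡ a
      fix-σ {w} e = begin
        a * σ w ≡⟨ cong (_* σ w) a*norm-ε ⟨
        a * norm ε * σ w ≡⟨ solve 7 (λ a e e1 e2 e3 e4 w → a :* (e :* e1 :* e2 :* e3 :* e4) :* w := (a :* e :* w) :* (e1 :* e2 :* e3 :* e4)) refl a ε ε1 ε2 ε3 ε4 (σ w) ⟩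
        a * ε * σ w * (ε1 * ε2 * ε3 * ε4) ≡⟨ cong (_* (ε1 * ε2 * ε3 * ε4)) (trans (cong (_* σ w) (sym σa)) (trans (sym (σ-* a w)) (trans (cong σ e) σa))) ⟩
        a * ε * (ε1 * ε2 * ε3 * ε4) ≡⟨ solve 6 (λ a e e1 e2 e3 e4 → a :* e :* (e1 :* e2 :* e3 :* e4) := a :* (e :* e1 :* e2 :* e3 :* e4)) refl a ε ε1 ε2 ε3 ε4 ⟩
        a * norm ε ≡⟨ a*norm-ε ⟩
        a ∎
      av≡a : a * v ≡ a
      av≡a = trans (sym (*-assoc _ _ _)) (trans (cong (_* κ) (sym b≡a[1+ε])) (sym a≡bκ))
      a*norm-v : a * norm v ≡ a
      a*norm-v = begin
        a * (v * σ v * σ (σ v) * σ (σ (σ v)) * σ (σ (σ (σ v)))) ≡⟨ solve 6 (λ a e e1 e2 e3 e4 → a :* (e :* e1 :* e2 :* e3 :* e4) := a :* e :* e1 :* e2 :* e3 :* e4) refl a v (σ v) (σ (σ v)) (σ (σ (σ v))) (σ (σ (σ (σ v)))) ⟩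
        a * v * σ v * σ (σ v) * σ (σ (σ v)) * σ (σ (σ (σ v)))
          ≡⟨ trans (cong (_* σ (σ (σ (σ v)))) (trans (cong (_* σ (σ (σ v))) (trans (cong (_* σ (σ v)) (trans (cong (_* σ v) av≡a) f1)) f2)) f3)) (fix-σ f3) ⟩
        a ∎
        where
        f1 = fix-σ av≡a
        f2 = fix-σ f1
        f3 = fix-σ f2
      u w : ℤ
      u = proj₁ (norm-ι a1+ε)
      w = proj₁ (norm-ι aκ)
      uw≡1 : u ℤ.* w ≡ pos 1
      uw≡1 = toℚ-injective {u ℤ.* w} {pos 1} (const-injective (begin
        ι (u ℤ.* w) ≡⟨ ι-* u w ⟩
        ι u * ι w ≡⟨ cong₂ _*_ (proj₂ (norm-ι a1+ε)) (proj₂ (norm-ι aκ)) ⟨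
        norm (ι (pos 1) + ε) * norm κ ≡⟨ norm-* _ _ ⟨
        norm v ≡⟨ norm-fixing (A-* a1+ε aκ) a≢0 a*norm-v ⟩
        1# ≡⟨ const-1 ⟨
        ι (pos 1) ∎))
      unit : ∀ u → ∣ u ∣ ≡ 1 → ¬ 5 ℕD.∣ ∣ u ℤ.- pos 32 ∣
      unit (pos 1) refl = from-no (5 ∣? 31)
      unit (ℤ.-[1+ 0 ]) refl = from-no (5 ∣? 33)
      from-one : ε ≡𝔓 ι (pos 1) → ⊥
      from-one h = unit u (ℕₚ.m*n≡1⇒m≡1 ∣ u ∣ ∣ w ∣ (trans (sym (ℤₚ.∣i*j∣≡∣i∣*∣j∣ u w)) (cong ∣_∣ uw≡1)))
        (ι-≡𝔓 (pos 32) u (proj₂ (norm-ι a1+ε)) (norm-≡𝔓 (pos 2) a1+ε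
          (𝔓-≡ (solve 1 (λ e → e :- con (pos 1) := con (pos 1) :+ e :- con (pos 2)) refl ε) h)))
      power : ∀ r → ε ≡𝔓 ι (pos r) → 5 ℕD.∣ ∣ pos 1 ℤ.- pos r ℤ.^ 5 ∣
      power r h = ι-≡𝔓 (pos r ℤ.^ 5) (pos 1) (trans norm-ε (sym const-1)) (norm-≡𝔓 (pos r) aε h)
      impossible : ∀ r → r ℕ.< 5 → ε ≡𝔓 ι (pos r) → ⊥
      impossible 0 _ h = from-no (5 ∣? 1) (power 0 h)
      impossible 1 _ h = from-one h
      impossible 2 _ h = from-no (5 ∣? 31) (power 2 h)
      impossible 3 _ h = from-no (5 ∣? 242) (power 3 h)
      impossible 4 _ h = from-no (5 ∣? 1023) (power 4 h)
      impossible (suc (suc (suc (suc (suc r))))) (ℕ.s≤s (ℕ.s≤s (ℕ.s≤s (ℕ.s≤s (ℕ.s≤s ()))))) h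

-- Lattices and linear relations

ℤ-bézout : ∀ {m n} → Cop.Coprime m n → Σ ℤ λ u → Σ ℤ λ v → u ℤ.* pos m ℤ.+ v ℤ.* pos n ≡ pos 1
ℤ-bézout {m} {n} c with Cop.coprime-Bézout c
... | Bézout.+- x y eq = pos x , ℤ.- pos y , (begin
    pos x ℤ.* pos m ℤ.+ ℤ.- pos y ℤ.* pos n ≡⟨ cong (λ t → t ℤ.+ ℤ.- pos y ℤ.* pos n) (trans (sym (ℤₚ.pos-* x m)) (trans (cong pos (sym eq)) (cong (λ t → pos 1 ℤ.+ t) (ℤₚ.pos-* y n)))) ⟩
    pos 1 ℤ.+ pos y ℤ.* pos n ℤ.+ ℤ.- pos y ℤ.* pos n ≡⟨ solve 2 (λ y n → con (pos 1) :+ y :* n :+ :- y :* n := con (pos 1)) refl (pos y) (pos n) ⟩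
    pos 1 ∎)
  where open ≡-Reasoning
        open ℤSolver.+-*-Solver
... | Bézout.-+ x y eq = ℤ.- pos x , pos y , (begin
    ℤ.- pos x ℤ.* pos m ℤ.+ pos y ℤ.* pos n ≡⟨ cong (λ t → ℤ.- pos x ℤ.* pos m ℤ.+ t) (trans (sym (ℤₚ.pos-* y n)) (trans (cong pos (sym eq)) (cong (λ t → pos 1 ℤ.+ t) (ℤₚ.pos-* x m)))) ⟩
    ℤ.- pos x ℤ.* pos m ℤ.+ (pos 1 ℤ.+ pos x ℤ.* pos m) ≡⟨ solve 2 (λ y n → :- y :* n :+ (con (pos 1) :+ y :* n) := con (pos 1)) refl (pos x) (pos m) ⟩
    pos 1 ∎)
  where open ≡-Reasoning
        open ℤSolver.+-*-Solver

prime-coprime : ∀ {p} → Prime p → ∀ {n} → ¬ p ℕD.∣ n → Cop.Coprime p n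
prime-coprime pr p∤n {d} (d∣p , d∣n) with prime⇒irreducible pr d∣p
... | inj₁ e = e
... | inj₂ refl = contradiction d∣n p∤n

-- The property C will involve membership in A, which is not decided; hence a least witness only up
-- to double negation.
¬¬-minimal : (C : ℕ → Set) → ∀ e → C e → ¬ ¬ (Σ ℕ λ e → C e × (∀ e' → e' ℕ.< e → ¬ C e'))
¬¬-minimal C = <-rec (λ e → C e → ¬ ¬ _) λ e ih c k → k (e , c , λ e' e'<e c' → ih e'<e c' k)

infixl 6 _⊕_
infixl 7 _·_
_⊕_ : ∀ {k} → Vec ℤ k → Vec ℤ k → Vec ℤ k
_⊕_ = zipWith ℤ._+_

_·_ : ∀ {k} → ℤ → Vec ℤ k → Vec ℤ k
z · v = Vec.map (z ℤ.*_) v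

zeros : ∀ {k} → Vec ℤ k
zeros = Vec.replicate _ (pos 0)

Congruent : ∀ {k} → ℕ → Vec ℤ k → Vec ℤ k → Set
Congruent D v w = Σ _ λ u → v ≡ w ⊕ pos D · u

record Lattice {k} (D : ℕ) (L : Vec ℤ k → Set) : Set where
  field
    ⊕-closed : ∀ {v w} → L v → L w → L (v ⊕ w)
    ·-closed : ∀ z {v} → L v → L (z · v)
    contains : ∀ u → L (pos D · u)

-- Representatives of L modulo Dℤᵏ. They will be used for L consisting of the coordinates of D·A in
-- the powers of α, where the quotient is A / ℤ[α]. By `size∣` a prime not dividing D does not
-- divide its order.
record Representatives {k} (D : ℕ) (L : Vec ℤ k → Set) : Set where
  field
    size : ℕ
    size∣ : size ℕD.∣ D ℕ.^ k
    rep : Fin size → Vec ℤ k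
    rep∈ : ∀ i → L (rep i)
    distinct : ∀ i j → Congruent D (rep i) (rep j) → i ≡ j
    exhaustive : ∀ v → L v → Σ (Fin size) λ i → Congruent D v (rep i)

private
  ⊕-cancel : ∀ {k} (a b c d : Vec ℤ k) → a ⊕ b ≡ (a ⊕ c) ⊕ d → b ≡ c ⊕ d
  ⊕-cancel [] [] [] [] e = refl
  ⊕-cancel (a ∷ as) (b ∷ bs) (c ∷ cs) (d ∷ ds) e = cong₂ _∷_
    (ℤGroup.∙-cancelˡ a b (c ℤ.+ d) (trans (cong Vec.head e) (ℤₚ.+-assoc a c d)))
    (⊕-cancel as bs cs ds (cong Vec.tail e))

  ⊕-solve : ∀ {k} z D (a b c d : Vec ℤ k) → a ⊕ (ℤ.- z) · b ⊕ D · zeros ≡ c ⊕ D · d → a ≡ (z · b ⊕ c) ⊕ D · d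
  ⊕-solve z D [] [] [] [] e = refl
  ⊕-solve z D (a ∷ as) (b ∷ bs) (c ∷ cs) (d ∷ ds) e = cong₂ _∷_
    (begin
      a ≡⟨ solve 4 (λ a b z D → a := z :* b :+ (a :+ (:- z) :* b :+ D :* con (pos 0))) refl a b z D ⟩
      z ℤ.* b ℤ.+ (a ℤ.+ (ℤ.- z) ℤ.* b ℤ.+ D ℤ.* pos 0) ≡⟨ cong (λ t → z ℤ.* b ℤ.+ t) (cong Vec.head e) ⟩
      z ℤ.* b ℤ.+ (c ℤ.+ D ℤ.* d) ≡⟨ ℤₚ.+-assoc (z ℤ.* b) c (D ℤ.* d) ⟨
      z ℤ.* b ℤ.+ c ℤ.+ D ℤ.* d ∎)
    (⊕-solve z D as bs cs ds (cong Vec.tail e))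
    where open ≡-Reasoning
          open ℤSolver.+-*-Solver

  small-difference : ∀ {i j f} → i ℕ.< f → j ℕ.< f → ∀ u → pos i ≡ pos j ℤ.+ pos f ℤ.* u → i ≡ j
  small-difference {i} {j} {f} i< j< (pos n) e = nonneg n (ℤₚ.+-injective (trans e (cong (λ t → pos j ℤ.+ t) (sym (ℤₚ.pos-* f n)))))
    where
    nonneg : ∀ n → i ≡ j ℕ.+ f ℕ.* n → i ≡ j
    nonneg zero e = trans e (trans (cong (j ℕ.+_) (ℕₚ.*-zeroʳ f)) (ℕₚ.+-identityʳ j))
    nonneg (suc n) e = contradiction (ℕₚ.≤-<-trans (ℕₚ.≤-trans (ℕₚ.m≤m*n f (suc n)) (ℕₚ.≤-trans (ℕₚ.m≤n+m _ j) (ℕₚ.≤-reflexive (sym e)))) i<) (ℕₚ.<-irrefl refl)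
  small-difference {i} {j} {f} i< j< ℤ.-[1+ n ] e = contradiction (ℕₚ.≤-<-trans (ℕₚ.≤-trans (ℕₚ.m≤m*n f (suc n)) (ℕₚ.≤-trans (ℕₚ.m≤n+m _ i) (ℕₚ.≤-reflexive e'))) j<) (ℕₚ.<-irrefl refl)
    where
    e' : i ℕ.+ f ℕ.* suc n ≡ j
    e' = ℤₚ.+-injective (begin
      pos i ℤ.+ pos (f ℕ.* suc n) ≡⟨ cong₂ ℤ._+_ e (ℤₚ.pos-* f (suc n)) ⟩
      pos j ℤ.+ pos f ℤ.* (ℤ.- pos (suc n)) ℤ.+ pos f ℤ.* pos (suc n) ≡⟨ solve 3 (λ j f n → j :+ f :* (:- n) :+ f :* n := j) refl (pos j) (pos f) (pos (suc n)) ⟩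
      pos j ∎)
      where open ≡-Reasoning
            open ℤSolver.+-*-Solver

-- The lattice is triangularised: e is the least positive first coordinate of an element of L,
-- so the first coordinates form eℤ with e ∣ D, and the rest is done in the sublattice 0 ∷ L'.
¬¬-representatives : ∀ {k} D → D ≢ 0 → (L : Vec ℤ k → Set) → Lattice D L → ¬ ¬ Representatives D L
¬¬-representatives {zero} D D≢0 L lat none = none record
  { size = 1 ; size∣ = ℕD.∣-refl ; rep = λ _ → [] ; rep∈ = λ _ → Lattice.contains lat [] ; distinct = λ { zero zero _ → refl } ; exhaustive = λ { [] _ → zero , [] , refl } }
¬¬-representatives {suc k} D D≢0 L lat none =
  ¬¬-minimal C D (D≢0 , Vec.map (pos D ℤ.*_) zeros , subst (λ t → L (t ∷ pos D · zeros)) (ℤₚ.*-identityʳ (pos D)) (contains (pos 1 ∷ zeros))) λ (e , (e≢0 , w , Lw) , minimal) →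
  ¬¬-representatives D D≢0 (λ v → L (pos 0 ∷ v)) sub λ R → none (extend e e≢0 w Lw minimal R)
  where
  open Lattice lat
  C : ℕ → Set
  C e = e ≢ 0 × Σ (Vec ℤ k) λ v → L (pos e ∷ v)
  sub : Lattice D (λ v → L (pos 0 ∷ v))
  sub = record
    { ⊕-closed = ⊕-closed
    ; ·-closed = λ z {v} Lv → subst (λ t → L (t ∷ z · v)) (ℤₚ.*-zeroʳ z) (·-closed z Lv)
    ; contains = λ u → subst (λ t → L (t ∷ pos D · u)) (ℤₚ.*-zeroʳ (pos D)) (contains (pos 0 ∷ u)) }
  module _ (e : ℕ) (e≢0 : e ≢ 0) (w : Vec ℤ k) (Lw : L (pos e ∷ w)) (minimal : ∀ e' → e' ℕ.< e → ¬ C e') (R : Representatives D (λ v → L (pos 0 ∷ v))) where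
    open Representatives R
    open ≡-Reasoning
    open ℤSolver.+-*-Solver
    instance
      e-nonZero : ℕ.NonZero e
      e-nonZero = ℕ.≢-nonZero e≢0
    first-multiple : ∀ z v → L (z ∷ v) → Σ ℤ λ q → z ≡ q ℤ.* pos e
    first-multiple z v Lv = q , trans z≡ (trans (cong (λ t → pos t ℤ.+ q ℤ.* pos e) r≡0) (ℤₚ.+-identityˡ _))
      where
      q = z ℤDM./ℕ e
      r = z ℤDM.%ℕ e
      z≡ : z ≡ pos r ℤ.+ q ℤ.* pos e
      z≡ = ℤDM.a≡a%ℕn+[a/ℕn]*n z e
      Lr : L (pos r ∷ v ⊕ (ℤ.- q) · w)
      Lr = subst (λ t → L (t ∷ v ⊕ (ℤ.- q) · w)) (trans (cong (ℤ._+ (ℤ.- q) ℤ.* pos e) z≡)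
        (solve 3 (λ r q e → r :+ q :* e :+ (:- q) :* e := r) refl (pos r) q (pos e))) (⊕-closed Lv (·-closed (ℤ.- q) Lw))
      -- Minimality only refutes smaller positive first coordinates; since r = 0 is decidable, that
      -- suffices.
      r≡0 : r ≡ 0
      r≡0 = decidable-stable (r ℕ.≟ 0) λ r≢0 → minimal r (ℤDM.n%ℕd<d z e) (r≢0 , _ , Lr)
    e∣D : Σ ℕ λ f → D ≡ f ℕ.* e
    e∣D with first-multiple (pos D) (pos D · zeros) (subst (λ t → L (t ∷ pos D · zeros)) (ℤₚ.*-identityʳ (pos D)) (contains (pos 1 ∷ zeros)))
    ... | q , eq = ∣ q ∣ , trans (cong ∣_∣ eq) (ℤₚ.∣i*j∣≡∣i∣*∣j∣ q (pos e))
    f : ℕ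
    f = proj₁ e∣D
    D≡fe : pos D ≡ pos f ℤ.* pos e
    D≡fe = trans (cong pos (proj₂ e∣D)) (ℤₚ.pos-* f e)
    instance
      f-nonZero : ℕ.NonZero f
      f-nonZero = ℕ.≢-nonZero λ f≡0 → D≢0 (trans (proj₂ e∣D) (cong (ℕ._* e) f≡0))
    -- With D = f e, the multiples i e for i < f represent the first coordinates modulo D, and the
    -- `rep j` represent what is left once the first coordinate is 0.
    new : Fin f → Fin size → Vec ℤ (suc k)
    new i j = pos (toℕ i) · (pos e ∷ w) ⊕ (pos 0 ∷ rep j)
    new-distinct : ∀ i j i' j' → Congruent D (new i j) (new i' j') → i ≡ i' × j ≡ j'
    new-distinct i j i' j' (u0 ∷ u , eq) = i≡i' , distinct j j' (u , ⊕-cancel (pos (toℕ i) · w) (rep j) (rep j') (pos D · u)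
        (trans (cong Vec.tail eq) (cong (λ t → pos (toℕ t) · w ⊕ rep j' ⊕ pos D · u) (sym i≡i'))))
      where
      i≡i' : i ≡ i'
      i≡i' = Finₚ.toℕ-injective (small-difference (Finₚ.toℕ<n i) (Finₚ.toℕ<n i') u0 (ℤₚ.*-cancelʳ-≡ _ _ (pos e) (begin
        pos (toℕ i) ℤ.* pos e ≡⟨ ℤₚ.+-identityʳ _ ⟨
        pos (toℕ i) ℤ.* pos e ℤ.+ pos 0 ≡⟨ cong Vec.head eq ⟩
        pos (toℕ i') ℤ.* pos e ℤ.+ pos 0 ℤ.+ pos D ℤ.* u0 ≡⟨ cong (λ t → pos (toℕ i') ℤ.* pos e ℤ.+ pos 0 ℤ.+ t ℤ.* u0) D≡fe ⟩
        pos (toℕ i') ℤ.* pos e ℤ.+ pos 0 ℤ.+ pos f ℤ.* pos e ℤ.* u0 ≡⟨ solve 4 (λ i e f u → i :* e :+ con (pos 0) :+ f :* e :* u := (i :+ f :* u) :* e) refl (pos (toℕ i')) (pos e) (pos f) u0 ⟩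
        (pos (toℕ i') ℤ.+ pos f ℤ.* u0) ℤ.* pos e ∎)))
    new-exhaustive : ∀ v → L v → Σ (Fin f) λ i → Σ (Fin size) λ j → Congruent D v (new i j)
    new-exhaustive (z ∷ v) Lv = i , j , q1 ∷ proj₁ (proj₂ ex) , cong₂ _∷_
        (trans z≡ (trans (cong (λ t → pos (toℕ i) ℤ.* pos e ℤ.+ t ℤ.* q1) (sym D≡fe)) (cong (ℤ._+ pos D ℤ.* q1) (sym (ℤₚ.+-identityʳ (pos (toℕ i) ℤ.* pos e))))))
        (⊕-solve (pos (toℕ i)) (pos D) v w (rep j) (proj₁ (proj₂ ex)) (proj₂ (proj₂ ex)))
      where
      q = proj₁ (first-multiple z v Lv)
      q1 = q ℤDM./ℕ f
      i = Fin.fromℕ< (ℤDM.n%ℕd<d q f)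
      q≡ : q ≡ pos (toℕ i) ℤ.+ q1 ℤ.* pos f
      q≡ = trans (ℤDM.a≡a%ℕn+[a/ℕn]*n q f) (cong (λ t → pos t ℤ.+ q1 ℤ.* pos f) (sym (Finₚ.toℕ-fromℕ< (ℤDM.n%ℕd<d q f))))
      z≡ : z ≡ pos (toℕ i) ℤ.* pos e ℤ.+ pos f ℤ.* pos e ℤ.* q1
      z≡ = trans (proj₂ (first-multiple z v Lv)) (trans (cong (ℤ._* pos e) q≡)
        (solve 4 (λ i e f q → (i :+ q :* f) :* e := i :* e :+ f :* e :* q) refl (pos (toℕ i)) (pos e) (pos f) q1))
      head≡0 : z ℤ.+ (ℤ.- pos (toℕ i)) ℤ.* pos e ℤ.+ pos D ℤ.* (ℤ.- q1) ≡ pos 0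
      head≡0 = trans (cong₂ (λ s t → s ℤ.+ (ℤ.- pos (toℕ i)) ℤ.* pos e ℤ.+ t ℤ.* (ℤ.- q1)) z≡ D≡fe)
        (solve 4 (λ i e f q → i :* e :+ f :* e :* q :+ (:- i) :* e :+ f :* e :* (:- q) := con (pos 0)) refl (pos (toℕ i)) (pos e) (pos f) q1)
      ex = exhaustive (v ⊕ (ℤ.- pos (toℕ i)) · w ⊕ pos D · zeros)
        (subst (λ t → L (t ∷ v ⊕ (ℤ.- pos (toℕ i)) · w ⊕ pos D · zeros)) head≡0 (⊕-closed (⊕-closed Lv (·-closed (ℤ.- pos (toℕ i)) Lw)) (contains (ℤ.- q1 ∷ zeros))))
      j = proj₁ ex
    extend : Representatives D L
    extend = record
      { size = f ℕ.* size
      ; size∣ = ℕD.*-pres-∣ (ℕD.divides e (trans (proj₂ e∣D) (ℕₚ.*-comm f e))) size∣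
      ; rep = λ l → new (proj₁ (remQuot {f} size l)) (proj₂ (remQuot {f} size l))
      ; rep∈ = λ l → ⊕-closed (·-closed (pos (toℕ (proj₁ (remQuot {f} size l)))) Lw) (rep∈ (proj₂ (remQuot {f} size l)))
      ; distinct = λ l l' c → let d = new-distinct _ _ _ _ c in
          trans (sym (Finₚ.combine-remQuot {f} size l)) (trans (cong₂ combine (proj₁ d) (proj₂ d)) (Finₚ.combine-remQuot {f} size l'))
      ; exhaustive = λ v Lv → let (i , j , c) = new-exhaustive v Lv in
          combine i j , subst (λ (i , j) → Congruent D v (new i j)) (sym (Finₚ.remQuot-combine i j)) c }

private
  module Sumℚ = Algebra.Properties.Semiring.Sum (CommutativeRing.semiring ℚₚ.+-*-commutativeRing)
  module SumCM = Algebra.Properties.CommutativeMonoid.Sum ℚₚ.+-0-commutativeMonoid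

open SumCM using (sum) public

-- Gaussian elimination on n + 1 vectors of length n. If the first column vanishes, it is dropped
-- together with one vector. Otherwise a pivot row j clears the column, and its coefficient `aj` is
-- chosen so as to undo the subtracted multiples of that row.
linear-relation : ∀ n (u : Fin (suc n) → Fin n → ℚ) →
  Σ (Fin (suc n) → ℚ) λ a → (Σ (Fin (suc n)) λ i → a i ≢ 0ℚ) × (∀ c → sum (λ i → a i ℚ.* u i c) ≡ 0ℚ)
linear-relation zero u = (λ _ → 1ℚ) , (zero , λ ()) , λ ()
linear-relation (suc n) u with Finₚ.any? (λ i → ¬? (u i zero ℚₚ.≟ 0ℚ))
... | no none = a , (suc (proj₁ (proj₁ (proj₂ ih))) , proj₂ (proj₁ (proj₂ ih))) , rel
  where
  ih = linear-relation n (λ i c → u (suc i) (suc c))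
  a : Fin (suc (suc n)) → ℚ
  a zero = 0ℚ
  a (suc i) = proj₁ ih i
  vanish : ∀ i → u i zero ≡ 0ℚ
  vanish i = decidable-stable (u i zero ℚₚ.≟ 0ℚ) λ h → none (i , h)
  rel : ∀ c → sum (λ i → a i ℚ.* u i c) ≡ 0ℚ
  rel zero = trans (SumCM.sum-cong-≗ {suc (suc n)} λ i → trans (cong (a i ℚ.*_) (vanish i)) (ℚₚ.*-zeroʳ (a i))) (SumCM.sum-replicate-zero (suc (suc n)))
  rel (suc c) = trans (cong₂ ℚ._+_ (ℚₚ.*-zeroˡ (u zero (suc c))) (proj₂ (proj₂ ih) c)) (ℚₚ.+-identityˡ 0ℚ)
... | yes (j , pivot≢0) = a , nonzero , rel
  where
  open ≡-Reasoning
  instance pivot-nonZero : ℚ.NonZero (u j zero)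
           pivot-nonZero = ℚ.≢-nonZero pivot≢0
  t : ℚ
  t = ℚ.1/ u j zero
  s : Fin (suc n) → ℚ
  s i = u (punchIn j i) zero ℚ.* t
  u' : Fin (suc n) → Fin (suc n) → ℚ
  u' i c = u (punchIn j i) c ℚ.- s i ℚ.* u j c
  ih = linear-relation n (λ i c → u' i (suc c))
  a' = proj₁ ih
  aj : ℚ
  aj = ℚ.- sum (λ i → a' i ℚ.* s i)
  a : Fin (suc (suc n)) → ℚ
  a i with i Fin.≟ j
  ... | yes _ = aj
  ... | no i≢j = a' (Fin.punchOut (i≢j ∘ sym))
  a-j : a j ≡ aj
  a-j with j Fin.≟ j
  ... | yes _ = refl
  ... | no j≢j = contradiction refl j≢j
  a-punchIn : ∀ i → a (punchIn j i) ≡ a' i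
  a-punchIn i with punchIn j i Fin.≟ j
  ... | yes e = contradiction e (Finₚ.punchInᵢ≢i j i)
  ... | no e = cong a' (trans (Finₚ.punchOut-cong j refl) (Finₚ.punchOut-punchIn j))
  nonzero : Σ (Fin (suc (suc n))) λ i → a i ≢ 0ℚ
  nonzero = punchIn j (proj₁ (proj₁ (proj₂ ih))) , λ e → proj₂ (proj₁ (proj₂ ih)) (trans (sym (a-punchIn _)) e)
  rel' : ∀ c → sum (λ i → a' i ℚ.* u' i c) ≡ 0ℚ
  rel' zero = trans (SumCM.sum-cong-≗ {suc n} λ i → trans (cong (a' i ℚ.*_) (begin
      u (punchIn j i) zero ℚ.- u (punchIn j i) zero ℚ.* t ℚ.* u j zero ≡⟨ cong (λ r → u (punchIn j i) zero ℚ.- r) (trans (ℚₚ.*-assoc (u (punchIn j i) zero) t (u j zero)) (trans (cong (u (punchIn j i) zero ℚ.*_) (ℚₚ.*-inverseˡ (u j zero))) (ℚₚ.*-identityʳ (u (punchIn j i) zero)))) ⟩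
      u (punchIn j i) zero ℚ.- u (punchIn j i) zero ≡⟨ ℚₚ.+-inverseʳ (u (punchIn j i) zero) ⟩
      0ℚ ∎)) (ℚₚ.*-zeroʳ (a' i))) (SumCM.sum-replicate-zero (suc n))
  rel' (suc c) = proj₂ (proj₂ ih) c
  rel : ∀ c → sum (λ i → a i ℚ.* u i c) ≡ 0ℚ
  rel c = begin
    sum (λ i → a i ℚ.* u i c) ≡⟨ SumCM.sum-remove {i = j} (λ i → a i ℚ.* u i c) ⟩
    a j ℚ.* u j c ℚ.+ sum (λ i → a (punchIn j i) ℚ.* u (punchIn j i) c)
      ≡⟨ cong₂ ℚ._+_ (cong (ℚ._* u j c) a-j) (SumCM.sum-cong-≗ {suc n} λ i → trans (cong (ℚ._* u (punchIn j i) c) (a-punchIn i)) (split (a' i) (u (punchIn j i) c) (s i) (u j c))) ⟩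
    aj ℚ.* u j c ℚ.+ sum (λ i → a' i ℚ.* u' i c ℚ.+ a' i ℚ.* s i ℚ.* u j c)
      ≡⟨ cong (aj ℚ.* u j c ℚ.+_) (trans (SumCM.∑-distrib-+ (λ i → a' i ℚ.* u' i c) (λ i → a' i ℚ.* s i ℚ.* u j c)) (cong₂ ℚ._+_ (rel' c) (sym (Sumℚ.*-distribʳ-sum (u j c) (λ i → a' i ℚ.* s i))))) ⟩
    aj ℚ.* u j c ℚ.+ (0ℚ ℚ.+ sum (λ i → a' i ℚ.* s i) ℚ.* u j c) ≡⟨ cancel (sum (λ i → a' i ℚ.* s i)) (u j c) ⟩
    0ℚ ∎
    where
    open ℚSolver.+-*-Solver
    split : ∀ a u s v → a ℚ.* u ≡ a ℚ.* (u ℚ.- s ℚ.* v) ℚ.+ a ℚ.* s ℚ.* v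
    split = solve 4 (λ a u s v → a :* u := a :* (u :- s :* v) :+ a :* s :* v) refl
    cancel : ∀ a v → (ℚ.- a) ℚ.* v ℚ.+ (0ℚ ℚ.+ a ℚ.* v) ≡ 0ℚ
    cancel = solve 2 (λ a v → (:- a) :* v :+ (con 0ℚ :+ a :* v) := con 0ℚ) refl

-- Orders maximal at a prime

-- The local ring ℤ₍ₚ₎ inside ℚ.
PInt : ℕ → ℚ → Set
PInt p q = Σ ℤ λ s → ¬ p ℕD.∣ ∣ s ∣ × IsInt (toℚ s ℚ.* q)

∤-* : ∀ {p} → Prime p → ∀ {a b} → ¬ p ℕD.∣ ∣ a ∣ → ¬ p ℕD.∣ ∣ b ∣ → ¬ p ℕD.∣ ∣ a ℤ.* b ∣
∤-* pr {a} {b} na nb d = nb (prime∣*⇒∣ pr a b na d)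

prime∤1 : ∀ {p} → Prime p → ¬ p ℕD.∣ 1
prime∤1 pr p∣1 = Data.Nat.Primality.¬prime[1] (subst Prime (ℕD.∣1⇒≡1 p∣1) pr)
  where import Data.Nat.Primality

-- Stated for a multiplicative class P because it serves twice, for the nonzero integers and for the
-- integers prime to p.
common-multiplier : ∀ (P : ℤ → Set) → P (pos 1) → (∀ {a b} → P a → P b → P (a ℤ.* b)) →
  ∀ {k} (b : Vec ℚ k) → (∀ i → Σ ℤ λ s → P s × IsInt (toℚ s ℚ.* lookup b i)) →
  Σ ℤ λ s → P s × Σ (Vec ℤ k) λ v → Vec.map (toℚ s ℚ.*_) b ≡ Vec.map toℚ v
common-multiplier P P1 P* [] h = pos 1 , P1 , [] , refl
common-multiplier P P1 P* (q ∷ b) h =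
  let (s , Ps , (z , e)) = h zero
      (t , Pt , v , f) = common-multiplier P P1 P* b (λ i → h (suc i))
  in s ℤ.* t , P* Ps Pt , t ℤ.* z ∷ s · v , cong₂ _∷_
    (trans (cong (ℚ._* q) (trans (cong toℚ (ℤₚ.*-comm s t)) (toℚ-* t s))) (trans (ℚₚ.*-assoc (toℚ t) (toℚ s) q) (trans (cong (toℚ t ℚ.*_) e) (sym (toℚ-* t z)))))
    (tails s t b v f)
  where
  tails : ∀ {k} s t (b : Vec ℚ k) (v : Vec ℤ k) → Vec.map (toℚ t ℚ.*_) b ≡ Vec.map toℚ v → Vec.map (toℚ (s ℤ.* t) ℚ.*_) b ≡ Vec.map toℚ (s · v)
  tails s t [] [] e = refl
  tails s t (x ∷ b) (z ∷ v) e = cong₂ _∷_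
    (trans (cong (ℚ._* x) (toℚ-* s t)) (trans (ℚₚ.*-assoc (toℚ s) (toℚ t) x) (trans (cong (toℚ s ℚ.*_) (cong Vec.head e)) (sym (toℚ-* s z)))))
    (tails s t b v (cong Vec.tail e))

remove-prime : ∀ {p} → Prime p → ∀ n → n ≢ 0 → Σ ℕ λ k → Σ ℕ λ s → n ≡ p ℕ.^ k ℕ.* s × ¬ p ℕD.∣ s
remove-prime {p} pr = <-rec _ λ n ih n≢0 → go n ih n≢0 (p ℕD.∣? n)
  where
  instance _ = prime⇒nonZero pr
  go : ∀ n → (∀ {m} → m ℕ.< n → m ≢ 0 → Σ ℕ λ k → Σ ℕ λ s → m ≡ p ℕ.^ k ℕ.* s × ¬ p ℕD.∣ s) → n ≢ 0 → Dec (p ℕD.∣ n) →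
    Σ ℕ λ k → Σ ℕ λ s → n ≡ p ℕ.^ k ℕ.* s × ¬ p ℕD.∣ s
  go n ih n≢0 (no p∤n) = 0 , n , sym (ℕₚ.*-identityˡ n) , p∤n
  go n ih n≢0 (yes (ℕD.divides q refl)) =
    let (k , s , e , p∤s) = ih (ℕₚ.m<m*n q p {{ℕ.≢-nonZero q≢0}} (ℕ.nonTrivial⇒n>1 p {{Data.Nat.Primality.prime⇒nonTrivial pr}})) q≢0
    in suc k , s , trans (ℕₚ.*-comm q p) (trans (cong (p ℕ.*_) e) (sym (ℕₚ.*-assoc p (p ℕ.^ k) s))) , p∤s
    where
    import Data.Nat.Primality
    q≢0 : q ≢ 0
    q≢0 refl = n≢0 refl

module PMaximality (F : CyclicQuinticField) where
  open CyclicQuinticField F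
  open AlmostIntegral F
  open Local F
  open ≡-Reasoning

  -- This is A ⊆ ℤ₍ₚ₎[α]. The quantification over every coordinate vector b, and not over one vector
  -- for each element, makes it imply that the powers of α are linearly independent.
  PMaximal : ℕ → K → Set
  PMaximal p α = ∀ b → A (lc α b) → ∀ i → PInt p (lookup b i)

  dual⇒PMaximal : ∀ {p α} Δ → ¬ p ℕD.∣ ∣ Δ ∣ → (∀ b → A (lc α b) → ∀ i → IsInt (toℚ Δ ℚ.* lookup b i)) → PMaximal p α
  dual⇒PMaximal Δ p∤Δ h b a i = Δ , p∤Δ , h b a i

  -- A common denominator of b is pᵏ s up to sign, with p ∤ s. After multiplication by s only pᵏ is
  -- left, and `digits` removes its factors p one at a time; so the multiplier s works for every
  -- coordinate.
  eisenstein⇒PMaximal : ∀ {p} (pr : Prime p) {α} (aα : A α) c0 c1 c2 c3 c4 → ¬ p ℕD.∣ ∣ c0 ∣ →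
    pow5 α + ι (pos p) * lcℤ α (c0 ∷ c1 ∷ c2 ∷ c3 ∷ c4 ∷ []) ≡ 0# → PMaximal p α
  eisenstein⇒PMaximal {p} pr {α} aα c0 c1 c2 c3 c4 p∤c0 α⁵ b a i = sℤ , p∤s , ints
    where
    cm = common-multiplier (_≢ pos 0) (λ ()) *-nonzero b (λ i → ℚ.↧ (lookup b i) , (λ ()) , (ℚ.↥ (lookup b i) , toℚ-↥ (lookup b i)))
    N = proj₁ cm
    N≢0 = proj₁ (proj₂ cm)
    v = proj₁ (proj₂ (proj₂ cm))
    Nb = proj₂ (proj₂ (proj₂ cm))
    rp = remove-prime pr ∣ N ∣ (λ e → N≢0 (ℤₚ.∣i∣≡0⇒i≡0 e))
    k = proj₁ rp
    s = proj₁ (proj₂ rp)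
    sℤ = pos s
    p∤s = proj₂ (proj₂ (proj₂ rp))
    N≡ : pos ∣ N ∣ ≡ pos p ℤ.^ k ℤ.* pos s
    N≡ = trans (cong pos (proj₁ (proj₂ (proj₂ rp)))) (trans (ℤₚ.pos-* (p ℕ.^ k) s) (cong (ℤ._* pos s) (pos-^ k)))
      where
      pos-^ : ∀ k → pos (p ℕ.^ k) ≡ pos p ℤ.^ k
      pos-^ zero = refl
      pos-^ (suc k) = trans (ℤₚ.pos-* p (p ℕ.^ k)) (cong (pos p ℤ.*_) (pos-^ k))
    -- The vector pᵏ b belongs to an element of A and has denominators at most p, so it is integral
    -- by `digits`, and the exponent drops by one.
    descend : ∀ k (b : Vec ℚ 5) → A (lc α b) → (∀ i → IsInt (toℚ (pos p ℤ.^ k) ℚ.* lookup b i)) → ∀ i → IsInt (lookup b i)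
    descend zero b a h i = subst IsInt (ℚₚ.*-identityˡ (lookup b i)) (h i)
    descend (suc k) b a h i = descend k b a next i
      where
      b' = Vec.map (toℚ (pos p ℤ.^ k) ℚ.*_) b
      ab' : A (lc α b')
      ab' = A-≡ (sym (lc-scale α (toℚ (pos p ℤ.^ k)) b)) (A-* (A-ι (pos p ℤ.^ k)) a)
      pb' : ∀ i → IsInt (toℚ (pos p) ℚ.* lookup b' i)
      pb' i = subst IsInt (trans (cong (ℚ._* lookup b i) (toℚ-* (pos p) (pos p ℤ.^ k))) (trans (ℚₚ.*-assoc (toℚ (pos p)) (toℚ (pos p ℤ.^ k)) (lookup b i)) (cong (toℚ (pos p) ℚ.*_) (sym (Vecₚ.lookup-map i (toℚ (pos p ℤ.^ k) ℚ.*_) b))))) (h i)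
      p≢0 : pos p ≢ pos 0
      p≢0 = prime≢0 pr
      module E = Eisenstein p pr α aα c0 c1 c2 c3 c4 p∤c0 α⁵
      int' : ∀ (b : Vec ℚ 5) → A (lc α b) → (∀ i → IsInt (toℚ (pos p) ℚ.* lookup b i)) → ∀ i → IsInt (lookup b i)
      int' b@(b0 ∷ b1 ∷ b2 ∷ b3 ∷ b4 ∷ []) a h = λ where
          zero → quotient {q = b0} (h zero) (proj₁ ds)
          1F → quotient {q = b1} (h 1F) (proj₁ (proj₂ ds))
          2F → quotient {q = b2} (h 2F) (proj₁ (proj₂ (proj₂ ds)))
          3F → quotient {q = b3} (h 3F) (proj₁ (proj₂ (proj₂ (proj₂ ds))))
          4F → quotient {q = b4} (h 4F) (proj₂ (proj₂ (proj₂ (proj₂ ds))))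
        where
        d : Fin 5 → ℤ
        d i = proj₁ (h i)
        vec≡ : ∀ {k} {x y : ℚ} {xs ys : Vec ℚ k} → x ≡ y → xs ≡ ys → x ∷ xs ≡ y ∷ ys
        vec≡ = cong₂ _∷_
        ds = E.digits (d zero) (d 1F) (d 2F) (d 3F) (d 4F) a
          (trans (sym (lc-scale α (toℚ (pos p)) b)) (cong (lc α)
            (vec≡ (proj₂ (h zero)) (vec≡ (proj₂ (h 1F)) (vec≡ (proj₂ (h 2F)) (vec≡ (proj₂ (h 3F)) (vec≡ (proj₂ (h 4F)) refl)))))))
        quotient : ∀ {q} (i : IsInt (toℚ (pos p) ℚ.* q)) → (Σ ℤ λ e → proj₁ i ≡ e ℤ.* pos p) → IsInt q
        quotient {q} (z , eq) (e , refl) = e , toℚ-cancel (pos p) p≢0 (trans eq (trans (toℚ-* e (pos p)) (ℚₚ.*-comm (toℚ e) (toℚ (pos p)))))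
      next : ∀ i → IsInt (toℚ (pos p ℤ.^ k) ℚ.* lookup b i)
      next i = subst IsInt (Vecₚ.lookup-map i (toℚ (pos p ℤ.^ k) ℚ.*_) b) (int' b' ab' pb' i)
    sb = Vec.map (toℚ (pos s) ℚ.*_) b
    ints : IsInt (toℚ (pos s) ℚ.* lookup b i)
    ints = subst IsInt (Vecₚ.lookup-map i (toℚ (pos s) ℚ.*_) b)
      (descend k sb (A-≡ (sym (lc-scale α (toℚ (pos s)) b)) (A-* (A-ι (pos s)) a)) ∣N∣b i)
      where
      N* : ∀ i → IsInt (toℚ N ℚ.* lookup b i)
      N* i = lookup v i , trans (sym (Vecₚ.lookup-map i (toℚ N ℚ.*_) b)) (trans (cong (λ w → lookup w i) Nb) (Vecₚ.lookup-map i toℚ v))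
      abs : ∀ N q → IsInt (toℚ N ℚ.* q) → IsInt (toℚ (pos ∣ N ∣) ℚ.* q)
      abs (pos n) q h = h
      abs (ℤ.-[1+ n ]) q h = subst IsInt (trans (ℚₚ.neg-distribˡ-* (toℚ ℤ.-[1+ n ]) q) (cong (ℚ._* q) (sym (toℚ-neg ℤ.-[1+ n ])))) (int-neg h)
      ∣N∣b : ∀ i → IsInt (toℚ (pos p ℤ.^ k) ℚ.* lookup sb i)
      ∣N∣b i = subst IsInt (begin
        toℚ (pos ∣ N ∣) ℚ.* lookup b i ≡⟨ cong (λ t → toℚ t ℚ.* lookup b i) N≡ ⟩
        toℚ (pos p ℤ.^ k ℤ.* pos s) ℚ.* lookup b i ≡⟨ cong (ℚ._* lookup b i) (toℚ-* (pos p ℤ.^ k) (pos s)) ⟩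
        toℚ (pos p ℤ.^ k) ℚ.* toℚ (pos s) ℚ.* lookup b i ≡⟨ ℚₚ.*-assoc (toℚ (pos p ℤ.^ k)) (toℚ (pos s)) (lookup b i) ⟩
        toℚ (pos p ℤ.^ k) ℚ.* (toℚ (pos s) ℚ.* lookup b i) ≡⟨ cong (toℚ (pos p ℤ.^ k) ℚ.*_) (Vecₚ.lookup-map i (toℚ (pos s) ℚ.*_) b) ⟨
        toℚ (pos p ℤ.^ k) ℚ.* lookup sb i ∎) (abs N (lookup b i) (N* i))

-- Indices of power bases

-- The coordinates supply the dimension 5 for a linear algebra argument. The uniform bound
-- `A-denominator` keeps all of A within one lattice.
record Coordinates (F : CyclicQuinticField) : Set where
  open CyclicQuinticField F
  open AlmostIntegral F
  open Local F
  field
    coordinate : Fin 5 → K → ℚ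
    coordinate-+ : ∀ c x y → coordinate c (x + y) ≡ coordinate c x ℚ.+ coordinate c y
    coordinate-const* : ∀ c q x → coordinate c (const q * x) ≡ q ℚ.* coordinate c x
    coordinate-injective : ∀ x → (∀ c → coordinate c x ≡ 0ℚ) → x ≡ 0#
    θ : K
    Λ-generated : ∀ {x} → Λ x → Σ (Vec ℤ 5) λ v → x ≡ lcℤ θ v
    discriminant : ℤ
    discriminant≢0 : discriminant ≢ pos 0
    A-denominator : ∀ {x} → A x → Λ (ι discriminant * x)

module PowerBasis (F : CyclicQuinticField) (C : Coordinates F) where
  open CyclicQuinticField F
  open AlmostIntegral F
  open Local F
  open PMaximality F
  open Coordinates C
  open ≡-Reasoning

  sumK : ∀ {n} → (Fin n → K) → K
  sumK {zero} f = 0#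
  sumK {suc n} f = f zero + sumK (λ i → f (suc i))

  coordinate-0 : ∀ c → coordinate c 0# ≡ 0ℚ
  coordinate-0 c = trans (cong (coordinate c) (sym (zeroʳ (const 0ℚ)))) (trans (coordinate-const* c 0ℚ 0#) (ℚₚ.*-zeroˡ (coordinate c 0#)))

  coordinate-sum : ∀ {n} c (a : Fin n → ℚ) (w : Fin n → K) → coordinate c (sumK (λ i → const (a i) * w i)) ≡ sum (λ i → a i ℚ.* coordinate c (w i))
  coordinate-sum {zero} c a w = coordinate-0 c
  coordinate-sum {suc n} c a w = trans (coordinate-+ c _ _) (cong₂ ℚ._+_ (coordinate-const* c (a zero) (w zero)) (coordinate-sum c (λ i → a (suc i)) (λ i → w (suc i))))

  lc≡sumK : ∀ α (a : Fin 5 → ℚ) → lc α (Vec.tabulate a) ≡ sumK (λ i → const (a i) * lookup (1# ∷ α ∷ α * α ∷ α * (α * α) ∷ α * (α * (α * α)) ∷ []) i)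
  lc≡sumK α a = begin
    _ ≡⟨ solve 6 (λ α b0 b1 b2 b3 b4 → b0 :+ α :* (b1 :+ α :* (b2 :+ α :* (b3 :+ α :* b4))) :=
        b0 :* con (pos 1) :+ (b1 :* α :+ (b2 :* (α :* α) :+ (b3 :* (α :* (α :* α)) :+ (b4 :* (α :* (α :* (α :* α))) :+ con (pos 0))))))
        refl α (const (a zero)) (const (a 1F)) (const (a 2F)) (const (a 3F)) (const (a 4F)) ⟩
    _ ≡⟨ cong₂ (λ s t → const (a zero) * s + (const (a 1F) * α + (const (a 2F) * (α * α) + (const (a 3F) * (α * (α * α)) + (const (a 4F) * (α * (α * (α * α))) + t))))) const-1 const-0 ⟩
    _ ∎
    where open Solver

  module _ (p : ℕ) (pr : Prime p) (α : K) (aα : A α) (maximal : PMaximal p α) where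

    private
      p≢0 : pos p ≢ pos 0
      p≢0 = prime≢0 pr

    -- A linear relation may be rescaled freely. Scaled to have a coefficient 1 / p it represents 0,
    -- an element of A, against the maximality at p.
    independent : ∀ b → lc α b ≡ 0# → ∀ i → lookup b i ≡ 0ℚ
    independent b e i = decidable-stable (lookup b i ℚₚ.≟ 0ℚ) λ b≢0 → absurd b≢0
      where
      absurd : lookup b i ≢ 0ℚ → ⊥
      absurd b≢0 = proj₁ (proj₂ h) (ℕD.divides ∣ z ∣ (trans (cong ∣_∣ s≡zp) (ℤₚ.∣i*j∣≡∣i∣*∣j∣ z (pos p))))
        where
        instance _ = ℚ.≢-nonZero b≢0
        r = proj₁ (toℚ-inverse (pos p) p≢0)
        q = r ℚ.* ℚ.1/ lookup b i
        h = maximal (Vec.map (q ℚ.*_) b) (A-≡ (sym (trans (lc-scale α q b) (trans (cong (const q *_) e) (zeroʳ (const q))))) A-0) i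
        s = proj₁ h
        z = proj₁ (proj₂ (proj₂ h))
        qb≡r : q ℚ.* lookup b i ≡ r
        qb≡r = trans (ℚₚ.*-assoc r _ (lookup b i)) (trans (cong (r ℚ.*_) (ℚₚ.*-inverseˡ (lookup b i))) (ℚₚ.*-identityʳ r))
        s≡zp : s ≡ z ℤ.* pos p
        s≡zp = toℚ-injective {s} {z ℤ.* pos p} (begin
          toℚ s ≡⟨ ℚₚ.*-identityʳ (toℚ s) ⟨
          toℚ s ℚ.* 1ℚ ≡⟨ cong (toℚ s ℚ.*_) (proj₂ (toℚ-inverse (pos p) p≢0)) ⟨
          toℚ s ℚ.* (r ℚ.* toℚ (pos p)) ≡⟨ ℚₚ.*-assoc (toℚ s) r (toℚ (pos p)) ⟨
          toℚ s ℚ.* r ℚ.* toℚ (pos p) ≡⟨ cong (λ t → toℚ s ℚ.* t ℚ.* toℚ (pos p)) (trans (Vecₚ.lookup-map i (q ℚ.*_) b) qb≡r) ⟨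
          toℚ s ℚ.* lookup (Vec.map (q ℚ.*_) b) i ℚ.* toℚ (pos p) ≡⟨ cong (ℚ._* toℚ (pos p)) (proj₂ (proj₂ (proj₂ h))) ⟩
          toℚ z ℚ.* toℚ (pos p) ≡⟨ toℚ-* z (pos p) ⟨
          toℚ (z ℤ.* pos p) ∎)

    -- The six elements x, 1, α, ..., α⁴ satisfy a linear relation in dimension 5, and by
    -- independence of the powers the coefficient of x in it is nonzero.
    spanning : ∀ x → Σ (Vec ℚ 5) λ b → lc α b ≡ x
    spanning x = go (a zero ℚₚ.≟ 0ℚ)
      where
      w : Fin 6 → K
      w = lookup (x ∷ 1# ∷ α ∷ α * α ∷ α * (α * α) ∷ α * (α * (α * α)) ∷ [])
      lr = linear-relation 5 (λ i c → coordinate c (w i))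
      a : Fin 6 → ℚ
      a = proj₁ lr
      relation : sumK (λ i → const (a i) * w i) ≡ 0#
      relation = coordinate-injective _ λ c → trans (coordinate-sum c a w) (proj₂ (proj₂ lr) c)
      b : Vec ℚ 5
      b = Vec.tabulate (λ i → a (suc i))
      relation' : const (a zero) * x + lc α b ≡ 0#
      relation' = trans (cong (const (a zero) * x +_) (lc≡sumK α (λ i → a (suc i)))) relation
      go : Dec (a zero ≡ 0ℚ) → Σ (Vec ℚ 5) λ b → lc α b ≡ x
      go (yes a0≡0) = contradiction (vanish (proj₁ (proj₁ (proj₂ lr)))) (proj₂ (proj₁ (proj₂ lr)))
        where
        lcb≡0 : lc α b ≡ 0#
        lcb≡0 = begin
          lc α b ≡⟨ +-identityˡ (lc α b) ⟨
          0# + lc α b ≡⟨ cong (_+ lc α b) (trans (cong (λ t → const t * x) a0≡0) (trans (cong (_* x) const-0) (zeroˡ x))) ⟨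
          const (a zero) * x + lc α b ≡⟨ relation' ⟩
          0# ∎
        vanish : ∀ i → a i ≡ 0ℚ
        vanish zero = a0≡0
        vanish (suc i) = trans (sym (Vecₚ.lookup∘tabulate (λ i → a (suc i)) i)) (independent b lcb≡0 i)
      go (no a0≢0) = Vec.map (r ℚ.*_) b , (begin
          lc α (Vec.map (r ℚ.*_) b) ≡⟨ lc-scale α r b ⟩
          const r * lc α b ≡⟨ solve 4 (λ r l a x → r :* l := r :* (a :* x :+ l) :- (r :* a) :* x) refl (const r) (lc α b) (const (a zero)) x ⟩
          const r * (const (a zero) * x + lc α b) - const r * const (a zero) * x ≡⟨ cong₂ (λ s t → const r * s - t * x) (trans relation' (sym const-0)) (trans (sym (const-* r (a zero))) (trans (cong const r*a) (ι-neg (pos 1)))) ⟩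
          const r * ι (pos 0) - (- ι (pos 1)) * x ≡⟨ solve 2 (λ r x → r :* con (pos 0) :- (:- con (pos 1)) :* x := x) refl (const r) x ⟩
          x ∎)
        where
        open Solver
        instance _ = ℚ.≢-nonZero a0≢0
        r = ℚ.- (ℚ.1/ a zero)
        r*a : r ℚ.* a zero ≡ toℚ (ℤ.- pos 1)
        r*a = trans (sym (ℚₚ.neg-distribˡ-* (ℚ.1/ a zero) (a zero))) (cong (ℚ.-_) (ℚₚ.*-inverseˡ (a zero)))

    Zα : K → Set
    Zα x = Σ (Vec ℤ 5) λ v → x ≡ lcℤ α v

    Zα-≡ : ∀ {x y} → x ≡ y → Zα x → Zα y
    Zα-≡ refl h = h

    Zα-+ : ∀ {x y} → Zα x → Zα y → Zα (x + y)
    Zα-+ (v , refl) (w , refl) = v ⊕ w , sym (lcℤ-⊕ α v w)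

    Zα-ι* : ∀ z {x} → Zα x → Zα (ι z * x)
    Zα-ι* z (v , refl) = z · v , sym (lcℤ-· α z v)

    denominator : ∀ (P : ℤ → Set) → P (pos 1) → (∀ {a b} → P a → P b → P (a ℤ.* b)) → ∀ x b → lc α b ≡ x →
      (∀ i → Σ ℤ λ s → P s × IsInt (toℚ s ℚ.* lookup b i)) → Σ ℤ λ s → P s × Zα (ι s * x)
    denominator P P1 P* x b refl h = let (s , Ps , v , e) = common-multiplier P P1 P* b h in
      s , Ps , v , trans (sym (lc-scale α (toℚ s) b)) (trans (cong (lc α) e) (lc-toℚ α v))

    some-denominator : ∀ x → Σ ℤ λ N → N ≢ pos 0 × Zα (ι N * x)
    some-denominator x = let (b , e) = spanning x in
      denominator (_≢ pos 0) (λ ()) *-nonzero x b e (λ i → ℚ.↧ (lookup b i) , (λ ()) , (ℚ.↥ (lookup b i) , toℚ-↥ (lookup b i)))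

    prime-denominator : ∀ x → A x → Σ ℤ λ s → ¬ p ℕD.∣ ∣ s ∣ × Zα (ι s * x)
    prime-denominator x ax = let (b , e) = spanning x in
      denominator (λ s → ¬ p ℕD.∣ ∣ s ∣) (prime∤1 pr) (λ {a} {b} → ∤-* pr {a} {b}) x b e (maximal b (A-≡ (sym e) ax))

    private
      Zα-multiple : ∀ M N {x} → Zα (ι N * x) → Zα (ι (M ℤ.* N) * x)
      Zα-multiple M N {x} h = Zα-≡ (trans (sym (*-assoc (ι M) (ι N) x)) (cong (_* x) (sym (ι-* M N)))) (Zα-ι* M h)

      Zα-multipleʳ : ∀ M N {x} → Zα (ι N * x) → Zα (ι (N ℤ.* M) * x)
      Zα-multipleʳ M N {x} h = Zα-≡ (cong (λ t → ι t * x) (ℤₚ.*-comm M N)) (Zα-multiple M N h)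

    powers⇒lattice : ∀ M → (∀ i → i ℕ.< 5 → Zα (ι M * θ ^K i)) → ∀ v → Zα (ι M * lcℤ θ v)
    powers⇒lattice M powers (z0 ∷ z1 ∷ z2 ∷ z3 ∷ z4 ∷ []) = Zα-≡ eq
        (Zα-+ (Zα-ι* z0 (powers 0 (ℕ.s≤s ℕ.z≤n))) (Zα-+ (Zα-ι* z1 (powers 1 (ℕ.s≤s (ℕ.s≤s ℕ.z≤n)))) (Zα-+ (Zα-ι* z2 (powers 2 (ℕ.s≤s (ℕ.s≤s (ℕ.s≤s ℕ.z≤n)))))
          (Zα-+ (Zα-ι* z3 (powers 3 (ℕ.s≤s (ℕ.s≤s (ℕ.s≤s (ℕ.s≤s ℕ.z≤n)))))) (Zα-ι* z4 (powers 4 (ℕ.s≤s (ℕ.s≤s (ℕ.s≤s (ℕ.s≤s (ℕ.s≤s ℕ.z≤n)))))))))))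
      where
      open Solver
      eq : ι z0 * (ι M * 1#) + (ι z1 * (ι M * (θ * 1#)) + (ι z2 * (ι M * (θ * (θ * 1#))) + (ι z3 * (ι M * (θ * (θ * (θ * 1#)))) + ι z4 * (ι M * (θ * (θ * (θ * (θ * 1#)))))))) ≡ ι M * lcℤ θ (z0 ∷ z1 ∷ z2 ∷ z3 ∷ z4 ∷ [])
      eq = trans (cong (λ u → ι z0 * (ι M * u) + (ι z1 * (ι M * (θ * u)) + (ι z2 * (ι M * (θ * (θ * u))) + (ι z3 * (ι M * (θ * (θ * (θ * u)))) + ι z4 * (ι M * (θ * (θ * (θ * (θ * u))))))))) (sym const-1))
        (solve 7 (λ M θ z0 z1 z2 z3 z4 → let u = con (pos 1) in z0 :* (M :* u) :+ (z1 :* (M :* (θ :* u)) :+ (z2 :* (M :* (θ :* (θ :* u))) :+ (z3 :* (M :* (θ :* (θ :* (θ :* u)))) :+ z4 :* (M :* (θ :* (θ :* (θ :* (θ :* u))))))))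
          := M :* (z0 :+ θ :* (z1 :+ θ :* (z2 :+ θ :* (z3 :+ θ :* z4))))) refl (ι M) θ (ι z0) (ι z1) (ι z2) (ι z3) (ι z4))

    -- Two inclusions are composed: `discriminant` carries A into ℤ[θ], and a common denominator M
    -- of 1, θ, ..., θ⁴ carries ℤ[θ] into ℤ[α].
    lattice-denominator : Σ ℤ λ N → N ≢ pos 0 × (∀ {x} → A x → Zα (ι N * x))
    lattice-denominator = finish (common 5)
      where
      finish : (Σ ℤ λ M → M ≢ pos 0 × (∀ i → i ℕ.< 5 → Zα (ι M * θ ^K i))) → Σ ℤ λ N → N ≢ pos 0 × (∀ {x} → A x → Zα (ι N * x))
      finish (M , M≢0 , powers) = M ℤ.* discriminant , *-nonzero M≢0 discriminant≢0 , λ {x} ax →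
        let (v , e) = Λ-generated (A-denominator ax) in
        Zα-≡ (trans (cong (ι M *_) (sym e)) (trans (sym (*-assoc (ι M) (ι discriminant) x)) (cong (_* x) (sym (ι-* M discriminant))))) (powers⇒lattice M powers v)
      common : ∀ k → Σ ℤ λ N → N ≢ pos 0 × (∀ i → i ℕ.< k → Zα (ι N * θ ^K i))
      common zero = pos 1 , (λ ()) , λ i ()
      common (suc k) = let (N , N≢0 , h) = common k ; (N' , N'≢0 , h') = some-denominator (θ ^K k) in
        N ℤ.* N' , *-nonzero N≢0 N'≢0 , λ i i< → case i (i ℕ.≟ k) N N' h h' i<
        where
        case : ∀ i → Dec (i ≡ k) → ∀ N N' → (∀ i → i ℕ.< k → Zα (ι N * θ ^K i)) → Zα (ι N' * θ ^K k) → i ℕ.< suc k → Zα (ι (N ℤ.* N') * θ ^K i)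
        case i (yes refl) N N' h h' i< = Zα-multiple N N' h'
        case i (no i≢k) N N' h h' i< = Zα-multipleʳ N' N (h i (ℕₚ.≤∧≢⇒< (ℕₚ.≤-pred i<) i≢k))

    -- A uniform denominator pᵏ s clears x, and so does some t prime to p that depends on x. From u
    -- pᵏ + v t = 1 it follows that s clears x, and s is uniform again.
    prime-free-denominator : Σ ℕ λ D → ¬ p ℕD.∣ D × (∀ {x} → A x → Zα (ι (pos D) * x))
    prime-free-denominator = s , p∤s , λ {x} ax → result x ax (prime-denominator x ax)
      where
      N = proj₁ lattice-denominator
      rp = remove-prime pr ∣ N ∣ (λ e → proj₁ (proj₂ lattice-denominator) (ℤₚ.∣i∣≡0⇒i≡0 e))
      k = proj₁ rp
      s = proj₁ (proj₂ rp)
      N≡ = proj₁ (proj₂ (proj₂ rp))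
      p∤s = proj₂ (proj₂ (proj₂ rp))
      abs : ∀ z {x} → Zα (ι z * x) → Zα (ι (pos ∣ z ∣) * x)
      abs (pos n) h = h
      abs (ℤ.-[1+ n ]) {x} h = Zα-≡ (cong (λ t → ι t * x) (ℤₚ.-1*i≡-i ℤ.-[1+ n ])) (Zα-multiple (ℤ.- pos 1) ℤ.-[1+ n ] h)
      result : ∀ x → A x → (Σ ℤ λ t → ¬ p ℕD.∣ ∣ t ∣ × Zα (ι t * x)) → Zα (ι (pos s) * x)
      result x ax (t , p∤t , ht) = Zα-≡ eq (Zα-+ (Zα-ι* u hN) (Zα-ι* (v ℤ.* pos s) hT))
        where
        open Solver
        t⁺ = ∣ t ∣
        hN : Zα (ι (pos (p ℕ.^ k ℕ.* s)) * x)
        hN = Zα-≡ (cong (λ n → ι (pos n) * x) N≡) (abs N (proj₂ (proj₂ lattice-denominator) ax))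
        hT : Zα (ι (pos t⁺) * x)
        hT = abs t ht
        bz = ℤ-bézout (Cop.sym (coprime-^ʳ k (Cop.sym (prime-coprime pr p∤t))))
        u = proj₁ bz
        v = proj₁ (proj₂ bz)
        eq : ι u * (ι (pos (p ℕ.^ k ℕ.* s)) * x) + ι (v ℤ.* pos s) * (ι (pos t⁺) * x) ≡ ι (pos s) * x
        eq = begin
          ι u * (ι (pos (p ℕ.^ k ℕ.* s)) * x) + ι (v ℤ.* pos s) * (ι (pos t⁺) * x)
            ≡⟨ cong₂ (λ a b → ι u * (a * x) + b * (ι (pos t⁺) * x)) (trans (cong ι (ℤₚ.pos-* (p ℕ.^ k) s)) (ι-* (pos (p ℕ.^ k)) (pos s))) (ι-* v (pos s)) ⟩
          ι u * (ι (pos (p ℕ.^ k)) * ι (pos s) * x) + ι v * ι (pos s) * (ι (pos t⁺) * x)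
            ≡⟨ solve 6 (λ u P s x v T → u :* (P :* s :* x) :+ v :* s :* (T :* x) := (u :* P :+ v :* T) :* (s :* x)) refl (ι u) (ι (pos (p ℕ.^ k))) (ι (pos s)) x (ι v) (ι (pos t⁺)) ⟩
          (ι u * ι (pos (p ℕ.^ k)) + ι v * ι (pos t⁺)) * (ι (pos s) * x)
            ≡⟨ cong (_* (ι (pos s) * x)) (trans (sym (trans (ι-+ (u ℤ.* pos (p ℕ.^ k)) (v ℤ.* pos t⁺)) (cong₂ _+_ (ι-* u (pos (p ℕ.^ k))) (ι-* v (pos t⁺))))) (trans (cong ι (proj₂ (proj₂ bz))) const-1)) ⟩
          1# * (ι (pos s) * x) ≡⟨ *-identityˡ _ ⟩
          ι (pos s) * x ∎

    -- In coordinates D·A is a lattice between Dℤ⁵ and ℤ⁵ with p ∤ D, so the index of ℤ[α] in A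
    -- divides D⁵ and is prime to p.
    ¬¬-index : ¬ ¬ (Σ ℕ λ d → ¬ p ℕD.∣ d × Σ (Fin d → K) λ r → (∀ i → A (r i)) × (∀ i j → Zα (r i - r j) → i ≡ j) × (∀ x → A x → Σ (Fin d) λ i → Zα (x - r i)))
    ¬¬-index none = ¬¬-representatives D D≢0 L lattice λ R → none (build R)
      where
      open Solver
      D = proj₁ prime-free-denominator
      p∤D = proj₁ (proj₂ prime-free-denominator)
      D-clears : ∀ {x} → A x → Zα (ι (pos D) * x)
      D-clears = proj₂ (proj₂ prime-free-denominator)
      D≢0 : D ≢ 0
      D≢0 e = p∤D (subst (p ℕD.∣_) (sym e) (p ℕD.∣0))
      posD≢0 : pos D ≢ pos 0
      posD≢0 e = D≢0 (ℤₚ.+-injective e)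
      L : Vec ℤ 5 → Set
      L v = Σ K λ x → A x × ι (pos D) * x ≡ lcℤ α v
      lattice : Lattice D L
      lattice = record
        { ⊕-closed = λ { {v} {w} (x , ax , e) (y , ay , f) → x + y , A-+ ax ay , trans (distribˡ _ x y) (trans (cong₂ _+_ e f) (sym (lcℤ-⊕ α v w))) }
        ; ·-closed = λ { z {v} (x , ax , e) → ι z * x , A-* (A-ι z) ax , trans (solve 3 (λ d z x → d :* (z :* x) := z :* (d :* x)) refl (ι (pos D)) (ι z) x) (trans (cong (ι z *_) e) (sym (lcℤ-· α z v))) }
        ; contains = λ u → lcℤ α u , A-lcℤ aα u , sym (lcℤ-· α (pos D) u) }
      lcℤ-injective : ∀ v w → lcℤ α v ≡ lcℤ α w → v ≡ w
      lcℤ-injective v w e = pointwise v w (independent b lcb≡0)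
        where
        b = Vec.map toℚ (v ⊕ (ℤ.- pos 1) · w)
        lcb≡0 : lc α b ≡ 0#
        lcb≡0 = trans (lc-toℚ α (v ⊕ (ℤ.- pos 1) · w)) (trans (lcℤ-⊕ α v ((ℤ.- pos 1) · w)) (trans (cong₂ _+_ e (lcℤ-· α (ℤ.- pos 1) w))
          (trans (solve 1 (λ x → x :+ con (ℤ.- pos 1) :* x := con (pos 0)) refl (lcℤ α w)) const-0)))
        pointwise : ∀ {k} (v w : Vec ℤ k) → (∀ i → lookup (Vec.map toℚ (v ⊕ (ℤ.- pos 1) · w)) i ≡ 0ℚ) → v ≡ w
        pointwise [] [] h = refl
        pointwise (x ∷ v) (y ∷ w) h = cong₂ _∷_ (ℤₚ.i-j≡0⇒i≡j x y (trans (cong (λ t → x ℤ.+ t) (sym (ℤₚ.-1*i≡-i y))) (toℚ-injective {x ℤ.+ (ℤ.- pos 1) ℤ.* y} {pos 0} (h zero)))) (pointwise v w (λ i → h (suc i)))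
      ∣^ : ∀ k → p ℕD.∣ D ℕ.^ k → ⊥
      ∣^ zero d = prime∤1 pr d
      ∣^ (suc k) d = p∤D (∣^⇒∣ pr D k d)
      build : Representatives D L → _
      build R = size , (λ p∣d → ∣^ 5 (ℕD.∣-trans p∣d size∣)) , (λ i → proj₁ (rep∈ i)) , (λ i → proj₁ (proj₂ (rep∈ i))) , distinct' , exhaustive'
        where
        open Representatives R
        distinct' : ∀ i j → Zα (proj₁ (rep∈ i) - proj₁ (rep∈ j)) → i ≡ j
        distinct' i j (u , e) = distinct i j (u , lcℤ-injective (rep i) (rep j ⊕ pos D · u) (begin
          lcℤ α (rep i) ≡⟨ proj₂ (proj₂ (rep∈ i)) ⟨
          ι (pos D) * x ≡⟨ solve 3 (λ d x y → d :* x := d :* y :+ d :* (x :- y)) refl (ι (pos D)) x y ⟩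
          ι (pos D) * y + ι (pos D) * (x - y) ≡⟨ cong₂ (λ s t → s + ι (pos D) * t) (proj₂ (proj₂ (rep∈ j))) e ⟩
          lcℤ α (rep j) + ι (pos D) * lcℤ α u ≡⟨ cong (lcℤ α (rep j) +_) (lcℤ-· α (pos D) u) ⟨
          lcℤ α (rep j) + lcℤ α (pos D · u) ≡⟨ lcℤ-⊕ α (rep j) (pos D · u) ⟨
          lcℤ α (rep j ⊕ pos D · u) ∎))
          where
          x = proj₁ (rep∈ i)
          y = proj₁ (rep∈ j)
        exhaustive' : ∀ x → A x → Σ (Fin size) λ i → Zα (x - proj₁ (rep∈ i))
        exhaustive' x ax = let (v , e) = D-clears ax ; (i , u , c) = exhaustive v (x , ax , e) in i , u , ι-cancel (pos D) posD≢0 (difference v e i u c)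
          where
          difference : ∀ v → ι (pos D) * x ≡ lcℤ α v → ∀ i u → v ≡ rep i ⊕ pos D · u → ι (pos D) * (x - proj₁ (rep∈ i)) ≡ ι (pos D) * lcℤ α u
          difference v e i u c = begin
            ι (pos D) * (x - y) ≡⟨ solve 3 (λ d x y → d :* (x :- y) := d :* x :- d :* y) refl (ι (pos D)) x y ⟩
            ι (pos D) * x - ι (pos D) * y ≡⟨ cong₂ _-_ (trans e (trans (cong (lcℤ α) c) (trans (lcℤ-⊕ α (rep i) (pos D · u)) (cong (lcℤ α (rep i) +_) (lcℤ-· α (pos D) u))))) (proj₂ (proj₂ (rep∈ i))) ⟩
            lcℤ α (rep i) + ι (pos D) * lcℤ α u - lcℤ α (rep i) ≡⟨ solve 2 (λ a b → a :+ b :- a := b) refl (lcℤ α (rep i)) (ι (pos D) * lcℤ α u) ⟩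
            ι (pos D) * lcℤ α u ∎
            where y = proj₁ (rep∈ i)

  module Residue (α : K) (aα : A α) (c0 c1 c2 c3 c4 : ℤ) (5∤c0 : ¬ 5 ℕD.∣ ∣ c0 ∣)
    (α⁵ : pow5 α + ι (pos 5) * lcℤ α (c0 ∷ c1 ∷ c2 ∷ c3 ∷ c4 ∷ []) ≡ 0#) (prime5 : Prime 5) where
    open WildPrime F
    open Solver

    α∈𝔓 : 𝔓 α
    α∈𝔓 = aα , - u , A-neg (A-lcℤ aα (c0 ∷ c1 ∷ c2 ∷ c3 ∷ c4 ∷ [])) , (begin
      pow5 α ≡⟨ solve 3 (λ a f u → a := (a :+ f :* u) :+ f :* (:- u)) refl (pow5 α) (ι (pos 5)) u ⟩
      pow5 α + ι (pos 5) * u + ι (pos 5) * (- u) ≡⟨ cong (_+ ι (pos 5) * (- u)) α⁵ ⟩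
      0# + ι (pos 5) * (- u) ≡⟨ +-identityˡ _ ⟩
      ι (pos 5) * (- u) ∎)
      where u = lcℤ α (c0 ∷ c1 ∷ c2 ∷ c3 ∷ c4 ∷ [])

    -- Some multiple s x with 5 ∤ s is a polynomial in α, and modulo 𝔓 only its constant term z0
    -- survives. So x is congruent to t z0, where t inverts s modulo 5.
    residue : ∀ x → A x → Σ ℕ λ r → r ℕ.< 5 × x ≡𝔓 ι (pos r)
    residue x ax = go (prime-denominator 5 prime5 α aα (eisenstein⇒PMaximal prime5 aα c0 c1 c2 c3 c4 5∤c0 α⁵) x ax)
      where
      import Data.Integer.DivMod as DM
      go : (Σ ℤ λ s → ¬ 5 ℕD.∣ ∣ s ∣ × Σ (Vec ℤ 5) λ v → ι s * x ≡ lcℤ α v) → Σ ℕ λ r → r ℕ.< 5 × x ≡𝔓 ι (pos r)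
      go (s , 5∤s , (z0 ∷ z1 ∷ z2 ∷ z3 ∷ z4 ∷ []) , e) = r , DM.n%ℕd<d (t ℤ.* z0) 5 , 𝔓-≡ eq
        (𝔓-+ (𝔓-*ʳ α∈𝔓 (A-* (A-ι t) aw)) (𝔓-five (A-+ (A-ι q) (A-* (A-ι v) ax))))
        where
        sign : ∀ s → ¬ 5 ℕD.∣ ∣ s ∣ → Σ ℤ λ t → Σ ℤ λ v → t ℤ.* s ℤ.+ v ℤ.* pos 5 ≡ pos 1
        sign (pos n) h = ℤ-bézout (Cop.sym (prime-coprime prime5 h))
        sign (ℤ.-[1+ n ]) h = let (t , v , e) = ℤ-bézout (Cop.sym (prime-coprime prime5 h)) in
          ℤ.- t , v , trans (cong (ℤ._+ v ℤ.* pos 5) (trans (sym (ℤₚ.neg-distribˡ-* t ℤ.-[1+ n ])) (ℤₚ.neg-distribʳ-* t ℤ.-[1+ n ]))) e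
        t = proj₁ (sign s 5∤s)
        v = proj₁ (proj₂ (sign s 5∤s))
        r = (t ℤ.* z0) ℤ.%ℕ 5
        q = (t ℤ.* z0) ℤ./ℕ 5
        w = ι z1 + α * (ι z2 + α * (ι z3 + α * ι z4))
        aw = A-+ (A-ι z1) (A-* aα (A-+ (A-ι z2) (A-* aα (A-+ (A-ι z3) (A-* aα (A-ι z4))))))
        tz0 : ι t * ι z0 ≡ ι (pos r) + ι q * ι (pos 5)
        tz0 = trans (sym (ι-* t z0)) (trans (cong ι (DM.a≡a%ℕn+[a/ℕn]*n (t ℤ.* z0) 5)) (trans (ι-+ (pos r) (q ℤ.* pos 5)) (cong (ι (pos r) +_) (ι-* q (pos 5)))))
        ts : ι t * ι s + ι v * ι (pos 5) ≡ 1#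
        ts = trans (sym (trans (ι-+ (t ℤ.* s) (v ℤ.* pos 5)) (cong₂ _+_ (ι-* t s) (ι-* v (pos 5))))) (trans (cong ι (proj₂ (proj₂ (sign s 5∤s)))) const-1)
        eq : α * (ι t * w) + ι (pos 5) * (ι q + ι v * x) ≡ x - ι (pos r)
        eq = begin
          α * (ι t * w) + ι (pos 5) * (ι q + ι v * x)
            ≡⟨ solve 8 (λ α t w f q v x r → α :* (t :* w) :+ f :* (q :+ v :* x) := (r :+ q :* f) :+ t :* (α :* w) :+ v :* f :* x :- r) refl α (ι t) w (ι (pos 5)) (ι q) (ι v) x (ι (pos r)) ⟩
          (ι (pos r) + ι q * ι (pos 5)) + ι t * (α * w) + ι v * ι (pos 5) * x - ι (pos r) ≡⟨ cong (λ y → y + ι t * (α * w) + ι v * ι (pos 5) * x - ι (pos r)) tz0 ⟨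
          ι t * ι z0 + ι t * (α * w) + ι v * ι (pos 5) * x - ι (pos r) ≡⟨ cong (λ y → y + ι v * ι (pos 5) * x - ι (pos r)) (trans (sym (distribˡ (ι t) (ι z0) (α * w))) (cong (ι t *_) (sym e))) ⟩
          ι t * (ι s * x) + ι v * ι (pos 5) * x - ι (pos r) ≡⟨ solve 6 (λ t s x v f r → t :* (s :* x) :+ v :* f :* x :- r := (t :* s :+ v :* f) :* x :- r) refl (ι t) (ι s) x (ι v) (ι (pos 5)) (ι (pos r)) ⟩
          (ι t * ι s + ι v * ι (pos 5)) * x - ι (pos r) ≡⟨ cong (λ y → y * x - ι (pos r)) ts ⟩
          1# * x - ι (pos r) ≡⟨ cong (λ y → y - ι (pos r)) (*-identityˡ x) ⟩
          x - ι (pos r) ∎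

-- Identities with polynomial coefficients in n

record QuinticAlgebra (n : ℤ) : Set₁ where
  open Coeffs n
  field
    algebra : ℚAlgebra
  open ℚAlgebra algebra public
  field
    θ : K
    coords : K → Vec ℚ 5
    lc-coords : ∀ x → lc θ (coords x) ≡ x
    coords-lc : ∀ b → coords (lc θ b) ≡ b
    θ⁵ : pow5 θ + lcℤ θ (c0 ∷ c1 ∷ c2 ∷ c3 ∷ c4 ∷ []) ≡ 0#

neg : ℕ → ℤ
neg k = ℤ.- pos k

-- Polynomials in the parameter n, constant term first. An identity in K is checked once by
-- computing with these coefficients and then holds for every n.
Poly : Set
Poly = List ℤ

infixl 6 _+P_ _-P_
infixl 7 _*P_
_+P_ : Poly → Poly → Poly
[] +P q = q
(a ∷ p) +P [] = a ∷ p
(a ∷ p) +P (b ∷ q) = (a ℤ.+ b) ∷ (p +P q)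

scaleP : ℤ → Poly → Poly
scaleP a [] = []
scaleP a (b ∷ p) = a ℤ.* b ∷ scaleP a p

_-P_ : Poly → Poly → Poly
p -P q = p +P scaleP (neg 1) q

_*P_ : Poly → Poly → Poly
[] *P q = []
(a ∷ p) *P q = scaleP a q +P (pos 0 ∷ (p *P q))

_^P_ : Poly → ℕ → Poly
p ^P zero = pos 1 ∷ []
p ^P suc k = p *P (p ^P k)

vanishesℤ : ℤ → Bool
vanishesℤ (pos 0) = true
vanishesℤ _ = false

vanishes : Poly → Bool
vanishes [] = true
vanishes (a ∷ p) = vanishesℤ a ∧ vanishes p

vanishesV : ∀ {k} → Vec Poly k → Bool
vanishesV [] = true
vanishesV (p ∷ v) = vanishes p ∧ vanishesV v

PolyVec : Set
PolyVec = Vec Poly 5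

coefficientsP : PolyVec
coefficientsP = (pos 1 ∷ []) ∷ (pos 10 ∷ pos 10 ∷ pos 4 ∷ pos 1 ∷ []) ∷ (pos 5 ∷ pos 15 ∷ pos 11 ∷ pos 5 ∷ pos 1 ∷ [])
  ∷ (neg 10 ∷ neg 10 ∷ neg 6 ∷ neg 2 ∷ []) ∷ (pos 0 ∷ pos 0 ∷ pos 1 ∷ []) ∷ []

mulθP : PolyVec → PolyVec
mulθP (a0 ∷ a1 ∷ a2 ∷ a3 ∷ a4 ∷ []) = go coefficientsP
  where
  go : PolyVec → PolyVec
  go (g0 ∷ g1 ∷ g2 ∷ g3 ∷ g4 ∷ []) = ([] -P g0 *P a4) ∷ (a0 -P g1 *P a4) ∷ (a1 -P g2 *P a4) ∷ (a2 -P g3 *P a4) ∷ (a3 -P g4 *P a4) ∷ []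

addV : ∀ {k} → Vec Poly k → Vec Poly k → Vec Poly k
addV = Vec.zipWith _+P_

scaleV : ∀ {k} → Poly → Vec Poly k → Vec Poly k
scaleV p = Vec.map (p *P_)

mulV : List Poly → PolyVec → PolyVec
mulV [] y = [] ∷ [] ∷ [] ∷ [] ∷ [] ∷ []
mulV (a ∷ as) y = addV (scaleV a y) (mulθP (mulV as y))

data Expr : Set where
  lit : PolyVec → Expr
  scalar : Poly → Expr
  _⊞_ _⊠_ : Expr → Expr → Expr
infixl 6 _⊞_
infixl 7 _⊠_

compute : Expr → PolyVec
compute (lit X) = X
compute (scalar p) = p ∷ [] ∷ [] ∷ [] ∷ [] ∷ []
compute (e ⊞ e') = addV (compute e) (compute e')
compute (e ⊠ e') = mulV (toList (compute e)) (compute e')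

-- Differences are tested for vanishing, so that trailing zero coefficients do no harm.
agree : Expr → Expr → Bool
agree e e' = vanishesV (Vec.zipWith _-P_ (compute e) (compute e'))

-- Soundness of the computation with polynomial coefficients

module Evaluation (n : ℤ) where
  open ≡-Reasoning
  open ℤSolver.+-*-Solver

  ⟪_⟫ : Poly → ℤ
  ⟪ [] ⟫ = pos 0
  ⟪ a ∷ p ⟫ = a ℤ.+ n ℤ.* ⟪ p ⟫

  ⟪⟫-+ : ∀ p q → ⟪ p +P q ⟫ ≡ ⟪ p ⟫ ℤ.+ ⟪ q ⟫
  ⟪⟫-+ [] q = sym (ℤₚ.+-identityˡ ⟪ q ⟫)
  ⟪⟫-+ (a ∷ p) [] = sym (ℤₚ.+-identityʳ _)
  ⟪⟫-+ (a ∷ p) (b ∷ q) = trans (cong (λ t → a ℤ.+ b ℤ.+ n ℤ.* t) (⟪⟫-+ p q))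
    (solve 5 (λ a b n p q → a :+ b :+ n :* (p :+ q) := (a :+ n :* p) :+ (b :+ n :* q)) refl a b n ⟪ p ⟫ ⟪ q ⟫)

  ⟪⟫-scale : ∀ a p → ⟪ scaleP a p ⟫ ≡ a ℤ.* ⟪ p ⟫
  ⟪⟫-scale a [] = sym (ℤₚ.*-zeroʳ a)
  ⟪⟫-scale a (b ∷ p) = trans (cong (λ t → a ℤ.* b ℤ.+ n ℤ.* t) (⟪⟫-scale a p))
    (solve 4 (λ a b n p → a :* b :+ n :* (a :* p) := a :* (b :+ n :* p)) refl a b n ⟪ p ⟫)

  ⟪⟫-minus : ∀ p q → ⟪ p -P q ⟫ ≡ ⟪ p ⟫ ℤ.- ⟪ q ⟫
  ⟪⟫-minus p q = trans (⟪⟫-+ p (scaleP (neg 1) q)) (cong (λ t → ⟪ p ⟫ ℤ.+ t) (trans (⟪⟫-scale (neg 1) q) (ℤₚ.-1*i≡-i ⟪ q ⟫)))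

  ⟪⟫-* : ∀ p q → ⟪ p *P q ⟫ ≡ ⟪ p ⟫ ℤ.* ⟪ q ⟫
  ⟪⟫-* [] q = refl
  ⟪⟫-* (a ∷ p) q = trans (⟪⟫-+ (scaleP a q) (pos 0 ∷ p *P q)) (trans (cong₂ (λ s t → s ℤ.+ (pos 0 ℤ.+ n ℤ.* t)) (⟪⟫-scale a q) (⟪⟫-* p q))
    (solve 4 (λ a q n p → a :* q :+ (con (pos 0) :+ n :* (p :* q)) := (a :+ n :* p) :* q) refl a ⟪ q ⟫ n ⟪ p ⟫))

  vanishes-sound : ∀ p → T (vanishes p) → ⟪ p ⟫ ≡ pos 0
  vanishes-sound [] _ = refl
  vanishes-sound (pos 0 ∷ p) h = trans (ℤₚ.+-identityˡ _) (trans (cong (n ℤ.*_) (vanishes-sound p h)) (ℤₚ.*-zeroʳ n))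

  poly-≡ : ∀ p q → T (vanishes (p -P q)) → ⟪ p ⟫ ≡ ⟪ q ⟫
  poly-≡ p q h = ℤₚ.i-j≡0⇒i≡j ⟪ p ⟫ ⟪ q ⟫ (trans (sym (⟪⟫-minus p q)) (vanishes-sound (p -P q) h))

module Reflection (n : ℤ) (Q : QuinticAlgebra n) where
  open QuinticAlgebra Q
  open Evaluation n
  open ≡-Reasoning

  E : PolyVec → K
  E X = lcℤ θ (Vec.map ⟪_⟫ X)

  coefficients-correct : let open Coeffs n in Vec.map ⟪_⟫ coefficientsP ≡ c0 ∷ c1 ∷ c2 ∷ c3 ∷ c4 ∷ []
  coefficients-correct = cong₂ _∷_ (solve 1 (λ n → con (pos 1) :+ n :* con (pos 0) := con (pos 1)) refl n) (cong₂ _∷_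
    (solve 1 (λ n → con (pos 10) :+ n :* (con (pos 10) :+ n :* (con (pos 4) :+ n :* (con (pos 1) :+ n :* con (pos 0)))) := n :* n :* n :+ con (pos 4) :* n :* n :+ con (pos 10) :* n :+ con (pos 10)) refl n) (cong₂ _∷_
    (solve 1 (λ n → con (pos 5) :+ n :* (con (pos 15) :+ n :* (con (pos 11) :+ n :* (con (pos 5) :+ n :* (con (pos 1) :+ n :* con (pos 0))))) := n :* n :* n :* n :+ con (pos 5) :* n :* n :* n :+ con (pos 11) :* n :* n :+ con (pos 15) :* n :+ con (pos 5)) refl n) (cong₂ _∷_
    (solve 1 (λ n → con (neg 10) :+ n :* (con (neg 10) :+ n :* (con (neg 6) :+ n :* (con (neg 2) :+ n :* con (pos 0)))) := :- (con (pos 2) :* n :* n :* n :+ con (pos 6) :* n :* n :+ con (pos 10) :* n :+ con (pos 10))) refl n) (cong₂ _∷_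
    (solve 1 (λ n → con (pos 0) :+ n :* (con (pos 0) :+ n :* (con (pos 1) :+ n :* con (pos 0))) := n :* n) refl n) refl))))
    where open ℤSolver.+-*-Solver

  E-+ : ∀ X Y → E (addV X Y) ≡ E X + E Y
  E-+ X Y = trans (cong (lcℤ θ) (homo X Y)) (lcℤ-⊕ θ (Vec.map ⟪_⟫ X) (Vec.map ⟪_⟫ Y))
    where
    homo : ∀ {k} (X Y : Vec Poly k) → Vec.map ⟪_⟫ (addV X Y) ≡ Vec.zipWith ℤ._+_ (Vec.map ⟪_⟫ X) (Vec.map ⟪_⟫ Y)
    homo [] [] = refl
    homo (p ∷ X) (q ∷ Y) = cong₂ _∷_ (⟪⟫-+ p q) (homo X Y)

  E-scale : ∀ p X → E (scaleV p X) ≡ ι ⟪ p ⟫ * E X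
  E-scale p X = trans (cong (lcℤ θ) (homo X)) (lcℤ-· θ ⟪ p ⟫ (Vec.map ⟪_⟫ X))
    where
    homo : ∀ {k} (X : Vec Poly k) → Vec.map ⟪_⟫ (scaleV p X) ≡ Vec.map (⟪ p ⟫ ℤ.*_) (Vec.map ⟪_⟫ X)
    homo [] = refl
    homo (q ∷ X) = cong₂ _∷_ (⟪⟫-* p q) (homo X)

  E-θ : ∀ X → E (mulθP X) ≡ θ * E X
  E-θ X@(a0 ∷ a1 ∷ a2 ∷ a3 ∷ a4 ∷ []) = begin
    E (mulθP X) ≡⟨ lc-toℚ θ (Vec.map ⟪_⟫ (mulθP X)) ⟨
    lc θ (Vec.map toℚ (Vec.map ⟪_⟫ (mulθP X))) ≡⟨ cong (lc θ) homo ⟩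
    lc θ (shift (Vec.map ⟪_⟫ coefficientsP) (Vec.map toℚ (Vec.map ⟪_⟫ X))) ≡⟨ lc-shift θ (Vec.map ⟪_⟫ coefficientsP) (trans (cong (λ g → pow5 θ + lcℤ θ g) coefficients-correct) θ⁵) (Vec.map toℚ (Vec.map ⟪_⟫ X)) ⟩
    θ * lc θ (Vec.map toℚ (Vec.map ⟪_⟫ X)) ≡⟨ cong (θ *_) (lc-toℚ θ (Vec.map ⟪_⟫ X)) ⟩
    θ * E X ∎
    where
    h : ∀ a g → toℚ ⟪ a -P g *P a4 ⟫ ≡ toℚ ⟪ a ⟫ ℚ.- toℚ ⟪ g ⟫ ℚ.* toℚ ⟪ a4 ⟫
    h a g = trans (cong toℚ (trans (⟪⟫-minus a (g *P a4)) (cong (λ t → ⟪ a ⟫ ℤ.- t) (⟪⟫-* g a4)))) (trans (toℚ-minus ⟪ a ⟫ (⟪ g ⟫ ℤ.* ⟪ a4 ⟫)) (cong (λ t → toℚ ⟪ a ⟫ ℚ.- t) (toℚ-* ⟪ g ⟫ ⟪ a4 ⟫)))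
    homo : Vec.map toℚ (Vec.map ⟪_⟫ (mulθP X)) ≡ shift (Vec.map ⟪_⟫ coefficientsP) (Vec.map toℚ (Vec.map ⟪_⟫ X))
    homo = cong₂ _∷_ (h [] (lookup coefficientsP zero)) (cong₂ _∷_ (h a0 (lookup coefficientsP (suc zero))) (cong₂ _∷_ (h a1 (lookup coefficientsP (suc (suc zero))))
      (cong₂ _∷_ (h a2 (lookup coefficientsP (suc (suc (suc zero))))) (cong₂ _∷_ (h a3 (lookup coefficientsP (suc (suc (suc (suc zero)))))) refl))))

  E-0 : E ([] ∷ [] ∷ [] ∷ [] ∷ [] ∷ []) ≡ 0#
  E-0 = trans (solve 1 (λ θ → con (pos 0) :+ θ :* (con (pos 0) :+ θ :* (con (pos 0) :+ θ :* (con (pos 0) :+ θ :* con (pos 0)))) := con (pos 0)) refl θ) const-0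
    where open Solver

  E-scalar : ∀ p → E (p ∷ [] ∷ [] ∷ [] ∷ [] ∷ []) ≡ ι ⟪ p ⟫
  E-scalar p = solve 2 (λ θ p → p :+ θ :* (con (pos 0) :+ θ :* (con (pos 0) :+ θ :* (con (pos 0) :+ θ :* con (pos 0)))) := p) refl θ (ι ⟪ p ⟫)
    where open Solver

  horner : List Poly → K
  horner [] = 0#
  horner (p ∷ ps) = ι ⟪ p ⟫ + θ * horner ps

  E-mul : ∀ ps Y → E (mulV ps Y) ≡ horner ps * E Y
  E-mul [] Y = trans E-0 (sym (zeroˡ (E Y)))
  E-mul (p ∷ ps) Y = begin
    E (addV (scaleV p Y) (mulθP (mulV ps Y))) ≡⟨ E-+ (scaleV p Y) (mulθP (mulV ps Y)) ⟩
    E (scaleV p Y) + E (mulθP (mulV ps Y)) ≡⟨ cong₂ _+_ (E-scale p Y) (trans (E-θ (mulV ps Y)) (cong (θ *_) (E-mul ps Y))) ⟩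
    ι ⟪ p ⟫ * E Y + θ * (horner ps * E Y) ≡⟨ solve 4 (λ p y θ h → p :* y :+ θ :* (h :* y) := (p :+ θ :* h) :* y) refl (ι ⟪ p ⟫) (E Y) θ (horner ps) ⟩
    (ι ⟪ p ⟫ + θ * horner ps) * E Y ∎
    where open Solver

  E-horner : ∀ X → horner (toList X) ≡ E X
  E-horner (a0 ∷ a1 ∷ a2 ∷ a3 ∷ a4 ∷ []) = cong (λ t → ι ⟪ a0 ⟫ + θ * (ι ⟪ a1 ⟫ + θ * (ι ⟪ a2 ⟫ + θ * (ι ⟪ a3 ⟫ + θ * t)))) (trans (cong (ι ⟪ a4 ⟫ +_) (zeroʳ θ)) (+-identityʳ _))

  eval : Expr → K
  eval (lit X) = E X
  eval (scalar p) = ι ⟪ p ⟫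
  eval (e ⊞ e') = eval e + eval e'
  eval (e ⊠ e') = eval e * eval e'

  compute-correct : ∀ e → E (compute e) ≡ eval e
  compute-correct (lit X) = refl
  compute-correct (scalar p) = E-scalar p
  compute-correct (e ⊞ e') = trans (E-+ (compute e) (compute e')) (cong₂ _+_ (compute-correct e) (compute-correct e'))
  compute-correct (e ⊠ e') = trans (E-mul (toList (compute e)) (compute e')) (cong₂ _*_ (trans (E-horner (compute e)) (compute-correct e)) (compute-correct e'))

  reflect : ∀ e e' → T (agree e e') → eval e ≡ eval e'
  reflect e e' h = trans (sym (compute-correct e)) (trans (cong (lcℤ θ) (pointwise (compute e) (compute e') h)) (compute-correct e'))
    where
    ∧-split : ∀ a {b} → T (a ∧ b) → T a × T b
    ∧-split true h = tt , h
    pointwise : ∀ {k} (X Y : Vec Poly k) → T (vanishesV (Vec.zipWith _-P_ X Y)) → Vec.map ⟪_⟫ X ≡ Vec.map ⟪_⟫ Y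
    pointwise [] [] _ = refl
    pointwise (p ∷ X) (q ∷ Y) h = cong₂ _∷_ (poly-≡ p q (proj₁ (∧-split (vanishes (p -P q)) h))) (pointwise X Y (proj₂ (∧-split (vanishes (p -P q)) h)))

-- The automorphism

-- These are D and m; the discriminant of f_n is D² m⁴.
discriminantRoot conductorP : Poly
discriminantRoot = pos 7 ∷ pos 10 ∷ pos 5 ∷ pos 1 ∷ []
conductorP = pos 25 ∷ pos 25 ∷ pos 15 ∷ pos 5 ∷ pos 1 ∷ []

-- conjugateⱼ holds the coordinates of D σʲθ, where D = n³ + 5n² + 10n + 7 is discriminantRoot and σθ = ((n + 2) + nθ − θ²) / (1 + (n + 2)θ).
conjugate₁ conjugate₂ conjugate₃ conjugate₄ θP : PolyVec
θP = [] ∷ (pos 1 ∷ []) ∷ [] ∷ [] ∷ [] ∷ []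
conjugate₁ = (pos 22 ∷ pos 39 ∷ pos 26 ∷ pos 8 ∷ pos 1 ∷ []) ∷ (pos 36 ∷ pos 107 ∷ pos 131 ∷ pos 89 ∷ pos 37 ∷ pos 9 ∷ pos 1 ∷ [])
  ∷ (neg 39 ∷ neg 80 ∷ neg 76 ∷ neg 43 ∷ neg 14 ∷ neg 2 ∷ []) ∷ (neg 2 ∷ neg 1 ∷ pos 4 ∷ pos 4 ∷ pos 1 ∷ []) ∷ (pos 4 ∷ pos 4 ∷ pos 1 ∷ []) ∷ []
conjugate₂ = (neg 6 ∷ neg 7 ∷ neg 2 ∷ []) ∷ (neg 6 ∷ neg 29 ∷ neg 36 ∷ neg 21 ∷ neg 7 ∷ neg 1 ∷ [])
  ∷ (pos 24 ∷ pos 41 ∷ pos 31 ∷ pos 14 ∷ pos 3 ∷ []) ∷ (neg 2 ∷ neg 3 ∷ neg 4 ∷ neg 2 ∷ []) ∷ (neg 3 ∷ neg 2 ∷ []) ∷ []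
conjugate₃ = (neg 25 ∷ neg 52 ∷ neg 47 ∷ neg 24 ∷ neg 7 ∷ neg 1 ∷ []) ∷ (neg 18 ∷ neg 59 ∷ neg 81 ∷ neg 62 ∷ neg 29 ∷ neg 8 ∷ neg 1 ∷ [])
  ∷ (pos 23 ∷ pos 53 ∷ pos 54 ∷ pos 33 ∷ pos 12 ∷ pos 2 ∷ []) ∷ (pos 1 ∷ pos 1 ∷ neg 2 ∷ neg 3 ∷ neg 1 ∷ []) ∷ (neg 2 ∷ neg 3 ∷ neg 1 ∷ []) ∷ []
conjugate₄ = (pos 9 ∷ pos 20 ∷ pos 16 ∷ pos 6 ∷ pos 1 ∷ []) ∷ (neg 19 ∷ neg 29 ∷ neg 19 ∷ neg 7 ∷ neg 1 ∷ [])
  ∷ (neg 8 ∷ neg 14 ∷ neg 9 ∷ neg 4 ∷ neg 1 ∷ []) ∷ (pos 3 ∷ pos 3 ∷ pos 2 ∷ pos 1 ∷ []) ∷ (pos 1 ∷ pos 1 ∷ []) ∷ []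

-- The traces of 1, θ, ..., θ⁴, as Newton's identities give them; `power-sum₁` to `power-sum₄`
-- confirm them from the explicit conjugates.
powerTraces : PolyVec
powerTraces = (pos 5 ∷ []) ∷ (pos 0 ∷ pos 0 ∷ neg 1 ∷ []) ∷ (pos 20 ∷ pos 20 ∷ pos 12 ∷ pos 4 ∷ pos 1 ∷ [])
  ∷ (neg 15 ∷ neg 45 ∷ neg 63 ∷ neg 45 ∷ neg 21 ∷ neg 6 ∷ neg 1 ∷ []) ∷ (pos 160 ∷ pos 360 ∷ pos 444 ∷ pos 376 ∷ pos 236 ∷ pos 108 ∷ pos 36 ∷ pos 8 ∷ pos 1 ∷ []) ∷ []

dotP : ∀ {k} → Vec Poly k → Vec Poly k → Poly
dotP [] [] = []
dotP (p ∷ v) (q ∷ w) = p *P q +P dotP v w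

-- d⁴ y(X/d) for the polynomial y of degree at most 4, and d⁵ (x⁵ + g(x)) at x = X/d.
homogeneous₄ homogeneous₅ : Poly → Expr → PolyVec → Expr
homogeneous₄ d X (y0 ∷ y1 ∷ y2 ∷ y3 ∷ y4 ∷ []) =
  let δ = scalar d in (δ ⊠ (δ ⊠ (δ ⊠ δ))) ⊠ scalar y0 ⊞ X ⊠ ((δ ⊠ (δ ⊠ δ)) ⊠ scalar y1 ⊞ X ⊠ ((δ ⊠ δ) ⊠ scalar y2 ⊞ X ⊠ (δ ⊠ scalar y3 ⊞ X ⊠ scalar y4)))
homogeneous₅ d X g = X ⊠ (X ⊠ (X ⊠ (X ⊠ X))) ⊞ scalar d ⊠ homogeneous₄ d X g

module Construct (n : ℤ) (Q : QuinticAlgebra n) (D≢0 : Evaluation.⟪_⟫ n discriminantRoot ≢ pos 0) where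
  open Evaluation n
  open QuinticAlgebra Q
  open Reflection n Q
  open ≡-Reasoning
  open Coeffs n

  private
    D : ℤ
    D = ⟪ discriminantRoot ⟫
    g : Vec ℤ 5
    g = c0 ∷ c1 ∷ c2 ∷ c3 ∷ c4 ∷ []

  eval-homogeneous₄ : ∀ d X y {x} → ι ⟪ d ⟫ * x ≡ eval X →
    eval (homogeneous₄ d X y) ≡ ι ⟪ d ⟫ * (ι ⟪ d ⟫ * (ι ⟪ d ⟫ * (ι ⟪ d ⟫ * lcℤ x (Vec.map ⟪_⟫ y))))
  eval-homogeneous₄ d X (y0 ∷ y1 ∷ y2 ∷ y3 ∷ y4 ∷ []) {x} e = trans
    (cong (λ X → (δ * (δ * (δ * δ))) * ι ⟪ y0 ⟫ + X * ((δ * (δ * δ)) * ι ⟪ y1 ⟫ + X * ((δ * δ) * ι ⟪ y2 ⟫ + X * (δ * ι ⟪ y3 ⟫ + X * ι ⟪ y4 ⟫)))) (sym e))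
    (solve 7 (λ d x y0 y1 y2 y3 y4 → (d :* (d :* (d :* d))) :* y0 :+ (d :* x) :* ((d :* (d :* d)) :* y1 :+ (d :* x) :* ((d :* d) :* y2 :+ (d :* x) :* (d :* y3 :+ (d :* x) :* y4)))
      := d :* (d :* (d :* (d :* (y0 :+ x :* (y1 :+ x :* (y2 :+ x :* (y3 :+ x :* y4)))))))) refl δ x (ι ⟪ y0 ⟫) (ι ⟪ y1 ⟫) (ι ⟪ y2 ⟫) (ι ⟪ y3 ⟫) (ι ⟪ y4 ⟫))
    where
    open Solver
    δ = ι ⟪ d ⟫

  cancel-zero : ∀ d {x} → d ≢ pos 0 → ι d * x ≡ 0# → x ≡ 0#
  cancel-zero d d≢0 e = ι-cancel d d≢0 (trans e (sym (zeroʳ (ι d))))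

  cancel⁴ : ∀ d {x y} → d ≢ pos 0 → ι d * (ι d * (ι d * (ι d * x))) ≡ ι d * (ι d * (ι d * (ι d * y))) → x ≡ y
  cancel⁴ d d≢0 e = ι-cancel d d≢0 (ι-cancel d d≢0 (ι-cancel d d≢0 (ι-cancel d d≢0 e)))

  -- Multiplied by d⁵, the relation for x = X / d becomes an identity in ℤ[n][θ], which `agree` can
  -- check.
  monic-relation : ∀ d X y {x} → ⟪ d ⟫ ≢ pos 0 → ι ⟪ d ⟫ * x ≡ eval X → T (agree (homogeneous₅ d X y) (scalar [])) →
    pow5 x + lcℤ x (Vec.map ⟪_⟫ y) ≡ 0#
  monic-relation d X y {x} d≢0 e h = cancel-zero ⟪ d ⟫ d≢0 (cancel⁴ ⟪ d ⟫ d≢0 (begin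
    δ * (δ * (δ * (δ * (δ * (pow5 x + l))))) ≡⟨ solve 3 (λ d x l → d :* (d :* (d :* (d :* (d :* (x :* (x :* (x :* (x :* x))) :+ l)))))
        := (let X = d :* x in X :* (X :* (X :* (X :* X)))) :+ d :* (d :* (d :* (d :* (d :* l))))) refl δ x l ⟩
    pow5 (δ * x) + δ * (δ * (δ * (δ * (δ * l)))) ≡⟨ cong₂ (λ s t → pow5 s + δ * t) e (sym (eval-homogeneous₄ d X y e)) ⟩
    eval (homogeneous₅ d X y) ≡⟨ reflect (homogeneous₅ d X y) (scalar []) h ⟩
    ι (pos 0) ≡⟨ const-0 ⟩
    0# ≡⟨ trans (cong (δ *_) (trans (cong (δ *_) (trans (cong (δ *_) (zeroʳ δ)) (zeroʳ δ))) (zeroʳ δ))) (zeroʳ δ) ⟨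
    δ * (δ * (δ * (δ * 0#))) ∎))
    where
    open Solver
    δ = ι ⟪ d ⟫
    l = lcℤ x (Vec.map ⟪_⟫ y)

  coords-+ : ∀ x y → coords (x + y) ≡ Vec.zipWith ℚ._+_ (coords x) (coords y)
  coords-+ x y = trans (cong coords (sym (trans (lc-+ θ (coords x) (coords y)) (cong₂ _+_ (lc-coords x) (lc-coords y))))) (coords-lc _)

  coords-const* : ∀ q x → coords (const q * x) ≡ Vec.map (q ℚ.*_) (coords x)
  coords-const* q x = trans (cong coords (sym (trans (lc-scale θ q (coords x)) (cong (const q *_) (lc-coords x))))) (coords-lc _)

  coords-θ* : ∀ x → coords (θ * x) ≡ shift g (coords x)
  coords-θ* x = trans (cong coords (sym (trans (lc-shift θ g θ⁵ (coords x)) (cong (θ *_) (lc-coords x))))) (coords-lc _)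

  lc-const : ∀ α q → lc α (q ∷ 0ℚ ∷ 0ℚ ∷ 0ℚ ∷ 0ℚ ∷ []) ≡ const q
  lc-const α q = solve 2 (λ α q → q :+ α :* (con (pos 0) :+ α :* (con (pos 0) :+ α :* (con (pos 0) :+ α :* con (pos 0)))) := q) refl α (const q)
    where open Solver

  coords-const : ∀ q → coords (const q) ≡ q ∷ 0ℚ ∷ 0ℚ ∷ 0ℚ ∷ 0ℚ ∷ []
  coords-const q = trans (cong coords (sym (lc-const θ q))) (coords-lc _)

  const-injective : ∀ {p q} → const p ≡ const q → p ≡ q
  const-injective {p} {q} e = cong Vec.head (trans (sym (coords-const p)) (trans (cong coords e) (coords-const q)))

  Eθ : E θP ≡ θ
  Eθ = trans (cong (λ t → ι (pos 0) + θ * (ι t + θ * (ι (pos 0) + θ * (ι (pos 0) + θ * ι (pos 0))))) (trans (cong (λ t → pos 1 ℤ.+ t) (ℤₚ.*-zeroʳ n)) refl))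
    (solve 1 (λ θ → con (pos 0) :+ θ :* (con (pos 1) :+ θ :* (con (pos 0) :+ θ :* (con (pos 0) :+ θ :* con (pos 0)))) := θ) refl θ)
    where open Solver

  opaque
    τ : K
    τ = const (proj₁ (toℚ-inverse D D≢0)) * E conjugate₁

    Dτ : ι D * τ ≡ E conjugate₁
    Dτ = ι-divide D D≢0 (E conjugate₁)

  -- As τ is again a root of f_n, the substitution of τ for θ respects multiplication by θ; from
  -- this `σ-*` follows along the Horner form.
  τ⁵ : pow5 τ + lcℤ τ g ≡ 0#
  τ⁵ = trans (cong (λ v → pow5 τ + lcℤ τ v) (sym coefficients-correct)) (monic-relation discriminantRoot (lit conjugate₁) coefficientsP D≢0 Dτ tt)

  opaque
    σ : K → K
    σ x = lc τ (coords x)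

    σ-lc : ∀ b → σ (lc θ b) ≡ lc τ b
    σ-lc b = cong (lc τ) (coords-lc b)

    σ-+ : ∀ x y → σ (x + y) ≡ σ x + σ y
    σ-+ x y = trans (cong (lc τ) (coords-+ x y)) (lc-+ τ (coords x) (coords y))

    σ-const* : ∀ q x → σ (const q * x) ≡ const q * σ x
    σ-const* q x = trans (cong (lc τ) (coords-const* q x)) (lc-scale τ q (coords x))

    σ-θ* : ∀ x → σ (θ * x) ≡ τ * σ x
    σ-θ* x = trans (cong (lc τ) (coords-θ* x)) (lc-shift τ g τ⁵ (coords x))

  σ-const : ∀ q → σ (const q) ≡ const q
  σ-const q = trans (cong σ (sym (lc-const θ q))) (trans (σ-lc _) (lc-const τ q))

  σ-* : ∀ x y → σ (x * y) ≡ σ x * σ y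
  σ-* x y = trans (cong (λ t → σ (t * y)) (sym (lc-coords x))) (trans (go (coords x)) (cong (_* σ y) (trans (sym (σ-lc (coords x))) (cong σ (lc-coords x)))))
    where
    step : ∀ q {u v} → σ (u * y) ≡ v * σ y → σ ((const q + θ * u) * y) ≡ (const q + τ * v) * σ y
    step q {u} {v} e = begin
      σ ((const q + θ * u) * y) ≡⟨ cong σ (solve 4 (λ q θ u y → (q :+ θ :* u) :* y := q :* y :+ θ :* (u :* y)) refl (const q) θ u y) ⟩
      σ (const q * y + θ * (u * y)) ≡⟨ trans (σ-+ _ _) (cong₂ _+_ (σ-const* q y) (trans (σ-θ* (u * y)) (cong (τ *_) e))) ⟩
      const q * σ y + τ * (v * σ y) ≡⟨ solve 4 (λ q θ u y → q :* y :+ θ :* (u :* y) := (q :+ θ :* u) :* y) refl (const q) τ v (σ y) ⟩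
      (const q + τ * v) * σ y ∎
      where open Solver
    go : ∀ b → σ (lc θ b * y) ≡ lc τ b * σ y
    go (b0 ∷ b1 ∷ b2 ∷ b3 ∷ b4 ∷ []) = step b0 (step b1 (step b2 (step b3 (σ-const* b4 y))))

  -- σ acts by substituting `conjugate₁` / D for θ. The degree in θ is at most 4, so D⁴ clears the
  -- denominators.
  σ-E : ∀ X Y → T (agree (homogeneous₄ discriminantRoot (lit conjugate₁) X) (scalar discriminantRoot ⊠ (scalar discriminantRoot ⊠ (scalar discriminantRoot ⊠ (scalar discriminantRoot ⊠ Y))))) → σ (E X) ≡ eval Y
  σ-E X Y h = trans (cong σ (sym (lc-toℚ θ (Vec.map ⟪_⟫ X)))) (trans (σ-lc (Vec.map toℚ (Vec.map ⟪_⟫ X))) (trans (lc-toℚ τ (Vec.map ⟪_⟫ X))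
    (cancel⁴ D D≢0 (trans (sym (eval-homogeneous₄ discriminantRoot (lit conjugate₁) X Dτ)) (reflect (homogeneous₄ discriminantRoot (lit conjugate₁) X) (scalar discriminantRoot ⊠ (scalar discriminantRoot ⊠ (scalar discriminantRoot ⊠ (scalar discriminantRoot ⊠ Y)))) h)))))

  τ₂ τ₃ τ₄ : K
  τ₂ = σ τ
  τ₃ = σ τ₂
  τ₄ = σ τ₃

  private
    σ-D : ∀ {x X} → ι D * x ≡ X → ι D * σ x ≡ σ X
    σ-D {x} refl = sym (σ-const* (toℚ D) x)

  σθ : σ θ ≡ τ
  σθ = ι-cancel D D≢0 (begin
    ι D * σ θ ≡⟨ cong (λ t → ι D * σ t) Eθ ⟨
    ι D * σ (E θP) ≡⟨ cong (ι D *_) (trans (cong σ (sym (lc-toℚ θ (Vec.map ⟪_⟫ θP)))) (trans (σ-lc (Vec.map toℚ (Vec.map ⟪_⟫ θP))) (lc-toℚ τ (Vec.map ⟪_⟫ θP)))) ⟩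
    ι D * lcℤ τ (Vec.map ⟪_⟫ θP) ≡⟨ cong (ι D *_) (trans (cong (λ t → ι (pos 0) + τ * (ι t + τ * (ι (pos 0) + τ * (ι (pos 0) + τ * ι (pos 0))))) (cong (λ t → pos 1 ℤ.+ t) (ℤₚ.*-zeroʳ n)))
        (solve 1 (λ θ → con (pos 0) :+ θ :* (con (pos 1) :+ θ :* (con (pos 0) :+ θ :* (con (pos 0) :+ θ :* con (pos 0)))) := θ) refl τ)) ⟩
    ι D * τ ∎)
    where open Solver

  Dτ₂ : ι D * τ₂ ≡ E conjugate₂
  Dτ₂ = trans (σ-D Dτ) (σ-E conjugate₁ (lit conjugate₂) tt)
  Dτ₃ : ι D * τ₃ ≡ E conjugate₃
  Dτ₃ = trans (σ-D Dτ₂) (σ-E conjugate₂ (lit conjugate₃) tt)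
  Dτ₄ : ι D * τ₄ ≡ E conjugate₄
  Dτ₄ = trans (σ-D Dτ₃) (σ-E conjugate₃ (lit conjugate₄) tt)

  σ⁵θ : σ τ₄ ≡ θ
  σ⁵θ = ι-cancel D D≢0 (trans (σ-D Dτ₄) (trans (σ-E conjugate₄ (scalar discriminantRoot ⊠ lit θP) tt) (cong (ι D *_) Eθ)))

  σ-lc-any : ∀ u b → σ (lc u b) ≡ lc (σ u) b
  σ-lc-any u (b0 ∷ b1 ∷ b2 ∷ b3 ∷ b4 ∷ []) = step b0 (step b1 (step b2 (step b3 (σ-const b4))))
    where
    step : ∀ q {v w} → σ v ≡ w → σ (const q + u * v) ≡ const q + σ u * w
    step q {v} refl = trans (σ-+ _ _) (cong₂ _+_ (σ-const q) (σ-* u v))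

  conjugates : ∀ x → let b = coords x in σ x ≡ lc τ b × σ (σ x) ≡ lc τ₂ b × σ (σ (σ x)) ≡ lc τ₃ b × σ (σ (σ (σ x))) ≡ lc τ₄ b × σ (σ (σ (σ (σ x)))) ≡ lc θ b
  conjugates x = s1 , s2 , s3 , s4 , trans (cong σ s4) (trans (σ-lc-any τ₄ b) (cong (λ t → lc t b) σ⁵θ))
    where
    b : Vec ℚ 5
    b = coords x
    s1 : σ x ≡ lc τ b
    s1 = trans (cong σ (sym (lc-coords x))) (σ-lc b)
    s2 = trans (cong σ s1) (σ-lc-any τ b)
    s3 = trans (cong σ s2) (σ-lc-any τ₂ b)
    s4 = trans (cong σ s3) (σ-lc-any τ₃ b)

  σ⁵ : ∀ x → σ (σ (σ (σ (σ x)))) ≡ x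
  σ⁵ x = trans (proj₂ (proj₂ (proj₂ (proj₂ (conjugates x))))) (lc-coords x)

  private
    P : Poly → Expr
    P = scalar
    d X₀ X₁ X₂ X₃ X₄ : Expr
    d = scalar discriminantRoot
    X₀ = d ⊠ lit θP
    X₁ = lit conjugate₁
    X₂ = lit conjugate₂
    X₃ = lit conjugate₃
    X₄ = lit conjugate₄

  DX₀ : ι D * θ ≡ eval X₀
  DX₀ = cong (ι D *_) (sym Eθ)

  T1 T2 T3 T4 : Poly
  T1 = lookup powerTraces 1F
  T2 = lookup powerTraces 2F
  T3 = lookup powerTraces 3F
  T4 = lookup powerTraces 4F

  power-sum₁ : θ + τ + τ₂ + τ₃ + τ₄ ≡ ι ⟪ T1 ⟫
  power-sum₁ = ι-cancel D D≢0 (begin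
    ι D * (θ + τ + τ₂ + τ₃ + τ₄) ≡⟨ solve 6 (λ d a b c e f → d :* (a :+ b :+ c :+ e :+ f) := d :* a :+ d :* b :+ d :* c :+ d :* e :+ d :* f) refl (ι D) θ τ τ₂ τ₃ τ₄ ⟩
    ι D * θ + ι D * τ + ι D * τ₂ + ι D * τ₃ + ι D * τ₄ ≡⟨ cong₂ _+_ (cong₂ _+_ (cong₂ _+_ (cong₂ _+_ DX₀ Dτ) Dτ₂) Dτ₃) Dτ₄ ⟩
    eval (X₀ ⊞ X₁ ⊞ X₂ ⊞ X₃ ⊞ X₄) ≡⟨ reflect (X₀ ⊞ X₁ ⊞ X₂ ⊞ X₃ ⊞ X₄) (d ⊠ P T1) tt ⟩
    ι D * ι ⟪ T1 ⟫ ∎)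
    where open Solver

  power-sum₂ : θ * θ + τ * τ + τ₂ * τ₂ + τ₃ * τ₃ + τ₄ * τ₄ ≡ ι ⟪ T2 ⟫
  power-sum₂ = ι-cancel D D≢0 (ι-cancel D D≢0 (begin
    ι D * (ι D * (θ * θ + τ * τ + τ₂ * τ₂ + τ₃ * τ₃ + τ₄ * τ₄)) ≡⟨ solve 6 (λ d a b c e f → d :* (d :* (a :* a :+ b :* b :+ c :* c :+ e :* e :+ f :* f)) := (d :* a) :* (d :* a) :+ (d :* b) :* (d :* b) :+ (d :* c) :* (d :* c) :+ (d :* e) :* (d :* e) :+ (d :* f) :* (d :* f)) refl (ι D) θ τ τ₂ τ₃ τ₄ ⟩
    _ ≡⟨ cong₂ _+_ (cong₂ _+_ (cong₂ _+_ (cong₂ _+_ (sq DX₀) (sq Dτ)) (sq Dτ₂)) (sq Dτ₃)) (sq Dτ₄) ⟩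
    eval (s X₀ ⊞ s X₁ ⊞ s X₂ ⊞ s X₃ ⊞ s X₄) ≡⟨ reflect (s X₀ ⊞ s X₁ ⊞ s X₂ ⊞ s X₃ ⊞ s X₄) (d ⊠ (d ⊠ P T2)) tt ⟩
    ι D * (ι D * ι ⟪ T2 ⟫) ∎))
    where
    open Solver
    s : Expr → Expr
    s X = X ⊠ X
    sq : ∀ {x y} → x ≡ y → x * x ≡ y * y
    sq refl = refl

  power-sum₃ : θ * (θ * θ) + τ * (τ * τ) + τ₂ * (τ₂ * τ₂) + τ₃ * (τ₃ * τ₃) + τ₄ * (τ₄ * τ₄) ≡ ι ⟪ T3 ⟫
  power-sum₃ = ι-cancel D D≢0 (ι-cancel D D≢0 (ι-cancel D D≢0 (begin
    ι D * (ι D * (ι D * (θ * (θ * θ) + τ * (τ * τ) + τ₂ * (τ₂ * τ₂) + τ₃ * (τ₃ * τ₃) + τ₄ * (τ₄ * τ₄))))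
      ≡⟨ solve 6 (λ d a b c e f → let cube = λ x → (d :* x) :* ((d :* x) :* (d :* x)) in d :* (d :* (d :* (a :* (a :* a) :+ b :* (b :* b) :+ c :* (c :* c) :+ e :* (e :* e) :+ f :* (f :* f)))) := cube a :+ cube b :+ cube c :+ cube e :+ cube f) refl (ι D) θ τ τ₂ τ₃ τ₄ ⟩
    _ ≡⟨ cong₂ _+_ (cong₂ _+_ (cong₂ _+_ (cong₂ _+_ (cb DX₀) (cb Dτ)) (cb Dτ₂)) (cb Dτ₃)) (cb Dτ₄) ⟩
    eval (s X₀ ⊞ s X₁ ⊞ s X₂ ⊞ s X₃ ⊞ s X₄) ≡⟨ reflect (s X₀ ⊞ s X₁ ⊞ s X₂ ⊞ s X₃ ⊞ s X₄) (d ⊠ (d ⊠ (d ⊠ P T3))) tt ⟩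
    ι D * (ι D * (ι D * ι ⟪ T3 ⟫)) ∎)))
    where
    open Solver
    s : Expr → Expr
    s X = X ⊠ (X ⊠ X)
    cb : ∀ {x y} → x ≡ y → x * (x * x) ≡ y * (y * y)
    cb refl = refl

  power-sum₄ : θ * (θ * (θ * θ)) + τ * (τ * (τ * τ)) + τ₂ * (τ₂ * (τ₂ * τ₂)) + τ₃ * (τ₃ * (τ₃ * τ₃)) + τ₄ * (τ₄ * (τ₄ * τ₄)) ≡ ι ⟪ T4 ⟫
  power-sum₄ = cancel⁴ D D≢0 (begin
    ι D * (ι D * (ι D * (ι D * (θ * (θ * (θ * θ)) + τ * (τ * (τ * τ)) + τ₂ * (τ₂ * (τ₂ * τ₂)) + τ₃ * (τ₃ * (τ₃ * τ₃)) + τ₄ * (τ₄ * (τ₄ * τ₄))))))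
      ≡⟨ solve 6 (λ d a b c e f → let four = λ x → (d :* x) :* ((d :* x) :* ((d :* x) :* (d :* x))) in d :* (d :* (d :* (d :* (a :* (a :* (a :* a)) :+ b :* (b :* (b :* b)) :+ c :* (c :* (c :* c)) :+ e :* (e :* (e :* e)) :+ f :* (f :* (f :* f)))))) := four a :+ four b :+ four c :+ four e :+ four f) refl (ι D) θ τ τ₂ τ₃ τ₄ ⟩
    _ ≡⟨ cong₂ _+_ (cong₂ _+_ (cong₂ _+_ (cong₂ _+_ (qd DX₀) (qd Dτ)) (qd Dτ₂)) (qd Dτ₃)) (qd Dτ₄) ⟩
    eval (s X₀ ⊞ s X₁ ⊞ s X₂ ⊞ s X₃ ⊞ s X₄) ≡⟨ reflect (s X₀ ⊞ s X₁ ⊞ s X₂ ⊞ s X₃ ⊞ s X₄) (d ⊠ (d ⊠ (d ⊠ (d ⊠ P T4)))) tt ⟩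
    ι D * (ι D * (ι D * (ι D * ι ⟪ T4 ⟫))) ∎)
    where
    open Solver
    s : Expr → Expr
    s X = X ⊠ (X ⊠ (X ⊠ X))
    qd : ∀ {x y} → x ≡ y → x * (x * (x * x)) ≡ y * (y * (y * y))
    qd refl = refl

-- The trace form and the order ℤ[θ]

module Cyclic (n : ℤ) (Q : QuinticAlgebra n) (D≢0 : Evaluation.⟪_⟫ n discriminantRoot ≢ pos 0) where
  open Evaluation n
  open QuinticAlgebra Q
  open Reflection n Q
  open Construct n Q D≢0
  open ≡-Reasoning
  open Coeffs n

  private
    D : ℤ
    D = ⟪ discriminantRoot ⟫

  -- The trace, written out before `field-K` is available because its component `σ-fixed` depends on
  -- it.
  total : K → K
  total x = x + σ x + σ (σ x) + σ (σ (σ x)) + σ (σ (σ (σ x)))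

  traceForm : Vec ℚ 5 → ℚ
  traceForm (a0 ∷ a1 ∷ a2 ∷ a3 ∷ a4 ∷ []) = a0 ℚ.* toℚ (pos 5) ℚ.+ (a1 ℚ.* toℚ ⟪ T1 ⟫ ℚ.+ (a2 ℚ.* toℚ ⟪ T2 ⟫ ℚ.+ (a3 ℚ.* toℚ ⟪ T3 ⟫ ℚ.+ a4 ℚ.* toℚ ⟪ T4 ⟫)))

  private
    sum-of-conjugates : ∀ b → lc θ b + lc τ b + lc τ₂ b + lc τ₃ b + lc τ₄ b ≡ const (traceForm b)
    sum-of-conjugates (a0 ∷ a1 ∷ a2 ∷ a3 ∷ a4 ∷ []) = begin
      _ ≡⟨ solve 10 (λ a0 a1 a2 a3 a4 u v w y z → let l = λ t → a0 :+ t :* (a1 :+ t :* (a2 :+ t :* (a3 :+ t :* a4))) in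
            l u :+ l v :+ l w :+ l y :+ l z := a0 :* con (pos 5) :+ (a1 :* (u :+ v :+ w :+ y :+ z) :+ (a2 :* (u :* u :+ v :* v :+ w :* w :+ y :* y :+ z :* z)
              :+ (a3 :* (u :* (u :* u) :+ v :* (v :* v) :+ w :* (w :* w) :+ y :* (y :* y) :+ z :* (z :* z))
              :+ a4 :* (u :* (u :* (u :* u)) :+ v :* (v :* (v :* v)) :+ w :* (w :* (w :* w)) :+ y :* (y :* (y :* y)) :+ z :* (z :* (z :* z)))))))
            refl (const a0) (const a1) (const a2) (const a3) (const a4) θ τ τ₂ τ₃ τ₄ ⟩
      _ ≡⟨ cong₂ (λ s t → const a0 * ι (pos 5) + (const a1 * s + t)) power-sum₁ (cong₂ (λ s t → const a2 * s + t) power-sum₂ (cong₂ (λ s t → const a3 * s + const a4 * t) power-sum₃ power-sum₄)) ⟩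
      const a0 * ι (pos 5) + (const a1 * ι ⟪ T1 ⟫ + (const a2 * ι ⟪ T2 ⟫ + (const a3 * ι ⟪ T3 ⟫ + const a4 * ι ⟪ T4 ⟫)))
        ≡⟨ h a0 (pos 5) (h a1 ⟪ T1 ⟫ (h a2 ⟪ T2 ⟫ (h a3 ⟪ T3 ⟫ (sym (const-* a4 (toℚ ⟪ T4 ⟫)))))) ⟩
      const (a0 ℚ.* toℚ (pos 5) ℚ.+ (a1 ℚ.* toℚ ⟪ T1 ⟫ ℚ.+ (a2 ℚ.* toℚ ⟪ T2 ⟫ ℚ.+ (a3 ℚ.* toℚ ⟪ T3 ⟫ ℚ.+ a4 ℚ.* toℚ ⟪ T4 ⟫)))) ∎
      where
      open Solver
      h : ∀ a z {x q} → x ≡ const q → const a * ι z + x ≡ const (a ℚ.* toℚ z ℚ.+ q)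
      h a z {q = q} refl = trans (cong (_+ const q) (sym (const-* a (toℚ z)))) (sym (const-+ (a ℚ.* toℚ z) q))

  total-rational : ∀ x → total x ≡ const (traceForm (coords x))
  total-rational x = trans (cong₂ _+_ (cong₂ _+_ (cong₂ _+_ (cong₂ _+_ (sym (lc-coords x)) (proj₁ c)) (proj₁ (proj₂ c))) (proj₁ (proj₂ (proj₂ c)))) (proj₁ (proj₂ (proj₂ (proj₂ c)))))
    (sum-of-conjugates (coords x))
    where c = conjugates x

  total-E : ∀ Z → total (E Z) ≡ ι ⟪ dotP Z powerTraces ⟫
  total-E Z@(a0 ∷ a1 ∷ a2 ∷ a3 ∷ a4 ∷ []) = trans (total-rational (E Z)) (trans (cong (λ b → const (traceForm b)) coords-E) (cong const (sym eq)))
    where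
    coords-E : coords (E Z) ≡ Vec.map toℚ (Vec.map ⟪_⟫ Z)
    coords-E = trans (cong coords (sym (lc-toℚ θ (Vec.map ⟪_⟫ Z)))) (coords-lc _)
    h : ∀ p q r {x} → toℚ ⟪ r ⟫ ≡ x → toℚ ⟪ p *P q +P r ⟫ ≡ toℚ ⟪ p ⟫ ℚ.* toℚ ⟪ q ⟫ ℚ.+ x
    h p q r refl = trans (cong toℚ (trans (⟪⟫-+ (p *P q) r) (cong (ℤ._+ ⟪ r ⟫) (⟪⟫-* p q)))) (trans (toℚ-+ (⟪ p ⟫ ℤ.* ⟪ q ⟫) ⟪ r ⟫) (cong (ℚ._+ toℚ ⟪ r ⟫) (toℚ-* ⟪ p ⟫ ⟪ q ⟫)))
    five : toℚ ⟪ pos 5 ∷ [] ⟫ ≡ toℚ (pos 5)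
    five = cong toℚ (cong (λ t → pos 5 ℤ.+ t) (ℤₚ.*-zeroʳ n))
    eq : toℚ ⟪ dotP Z powerTraces ⟫ ≡ traceForm (Vec.map toℚ (Vec.map ⟪_⟫ Z))
    eq = trans (h a0 (pos 5 ∷ []) _ (h a1 T1 _ (h a2 T2 _ (h a3 T3 _ (trans (h a4 T4 [] refl) (ℚₚ.+-identityʳ _))))))
      (cong (λ t → toℚ ⟪ a0 ⟫ ℚ.* t ℚ.+ (toℚ ⟪ a1 ⟫ ℚ.* toℚ ⟪ T1 ⟫ ℚ.+ (toℚ ⟪ a2 ⟫ ℚ.* toℚ ⟪ T2 ⟫ ℚ.+ (toℚ ⟪ a3 ⟫ ℚ.* toℚ ⟪ T3 ⟫ ℚ.+ toℚ ⟪ a4 ⟫ ℚ.* toℚ ⟪ T4 ⟫)))) five)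

  Λ : K → Set
  Λ x = Σ (Vec ℤ 5) λ v → x ≡ lcℤ θ v

  Λ-+ : ∀ {x y} → Λ x → Λ y → Λ (x + y)
  Λ-+ (v , refl) (w , refl) = v ⊕ w , sym (lcℤ-⊕ θ v w)

  Λ-ι* : ∀ z {x} → Λ x → Λ (ι z * x)
  Λ-ι* z (v , refl) = z · v , sym (lcℤ-· θ z v)

  private
    lcℤ-ι : ∀ α z → lcℤ α (z ∷ pos 0 ∷ pos 0 ∷ pos 0 ∷ pos 0 ∷ []) ≡ ι z
    lcℤ-ι α z = solve 2 (λ α q → q :+ α :* (con (pos 0) :+ α :* (con (pos 0) :+ α :* (con (pos 0) :+ α :* con (pos 0)))) := q) refl α (ι z)
      where open Solver

  Λ-ι : ∀ z → Λ (ι z)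
  Λ-ι z = z ∷ pos 0 ∷ pos 0 ∷ pos 0 ∷ pos 0 ∷ [] , sym (lcℤ-ι θ z)

  Λ-θ* : ∀ {x} → Λ x → Λ (θ * x)
  Λ-θ* (v , refl) = lcℤ-shift θ (c0 ∷ c1 ∷ c2 ∷ c3 ∷ c4 ∷ []) θ⁵ v

  Λ-* : ∀ {x y} → Λ x → Λ y → Λ (x * y)
  Λ-* {y = y} (z0 ∷ z1 ∷ z2 ∷ z3 ∷ z4 ∷ [] , refl) l = step z0 (step z1 (step z2 (step z3 (Λ-ι* z4 l))))
    where
    open Solver
    step : ∀ z {u} → Λ (u * y) → Λ ((ι z + θ * u) * y)
    step z {u} h = subst Λ (solve 4 (λ z θ u y → z :* y :+ θ :* (u :* y) := (z :+ θ :* u) :* y) refl (ι z) θ u y) (Λ-+ (Λ-ι* z l) (Λ-θ* h))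

  Λ-rational : ∀ q → Λ (const q) → IsInt q
  Λ-rational q (z0 ∷ z1 ∷ z2 ∷ z3 ∷ z4 ∷ [] , e) = z0 , cong Vec.head (trans (sym (coords-const q)) (trans (cong coords (trans e (sym (lc-toℚ θ (z0 ∷ z1 ∷ z2 ∷ z3 ∷ z4 ∷ []))))) (coords-lc _)))

  Λ-clear : ∀ Δ x → (∀ i → IsInt (toℚ Δ ℚ.* lookup (coords x) i)) → Λ (ι Δ * x)
  Λ-clear Δ x h = let (v , e) = ints (coords x) h in v , trans (cong (ι Δ *_) (sym (lc-coords x))) (trans (sym (lc-scale θ (toℚ Δ) (coords x))) (trans (cong (lc θ) e) (lc-toℚ θ v)))
    where
    ints : ∀ {k} (b : Vec ℚ k) → (∀ i → IsInt (toℚ Δ ℚ.* lookup b i)) → Σ (Vec ℤ k) λ v → Vec.map (toℚ Δ ℚ.*_) b ≡ Vec.map toℚ v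
    ints [] h = [] , refl
    ints (q ∷ b) h = let (v , e) = ints b (λ i → h (suc i)) in proj₁ (h zero) ∷ v , cong₂ _∷_ (proj₂ (h zero)) e

  Λ-denominator : ∀ x → Σ ℤ λ N → N ≢ pos 0 × Λ (ι N * x)
  Λ-denominator x = N , proj₁ (proj₂ cm) , v , trans (cong (ι N *_) (sym (lc-coords x))) (trans (sym (lc-scale θ (toℚ N) (coords x))) (trans (cong (lc θ) (proj₂ (proj₂ (proj₂ cm)))) (lc-toℚ θ v)))
    where
    cm = common-multiplier (_≢ pos 0) (λ ()) *-nonzero (coords x) (λ i → ℚ.↧ (lookup (coords x) i) , (λ ()) , (ℚ.↥ (lookup (coords x) i) , toℚ-↥ (lookup (coords x) i)))
    N = proj₁ cm
    v = proj₁ (proj₂ (proj₂ cm))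

  -- D τ lies in ℤ[θ], and elements of ℤ[θ] have degree at most 4 in θ, so D⁴ is enough.
  σ-denominator : Σ ℤ λ N → N ≢ pos 0 × (∀ x → Λ x → Λ (ι N * σ x))
  σ-denominator = D ℤ.* (D ℤ.* (D ℤ.* D)) , *-nonzero D≢0 (*-nonzero D≢0 (*-nonzero D≢0 D≢0)) , cleared
    where
    open Solver
    δ = ι D
    ΛX : Λ (E conjugate₁)
    ΛX = Vec.map ⟪_⟫ conjugate₁ , refl
    cleared : ∀ x → Λ x → Λ (ι (D ℤ.* (D ℤ.* (D ℤ.* D))) * σ x)
    cleared _ (v@(z0 ∷ z1 ∷ z2 ∷ z3 ∷ z4 ∷ []) , refl) = subst Λ eq
      (Λ-+ (Λ-ι* D (Λ-ι* D (Λ-ι* D (Λ-ι* D (Λ-ι z0))))) (Λ-* ΛX (Λ-+ (Λ-ι* D (Λ-ι* D (Λ-ι* D (Λ-ι z1)))) (Λ-* ΛX (Λ-+ (Λ-ι* D (Λ-ι* D (Λ-ι z2))) (Λ-* ΛX (Λ-+ (Λ-ι* D (Λ-ι z3)) (Λ-* ΛX (Λ-ι z4)))))))))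
      where
      X = E conjugate₁
      eq : δ * (δ * (δ * (δ * ι z0))) + X * (δ * (δ * (δ * ι z1)) + X * (δ * (δ * ι z2) + X * (δ * ι z3 + X * ι z4))) ≡ ι (D ℤ.* (D ℤ.* (D ℤ.* D))) * σ (lcℤ θ v)
      eq = begin
        _ ≡⟨ cong (λ X → δ * (δ * (δ * (δ * ι z0))) + X * (δ * (δ * (δ * ι z1)) + X * (δ * (δ * ι z2) + X * (δ * ι z3 + X * ι z4)))) (sym Dτ) ⟩
        _ ≡⟨ solve 7 (λ d x y0 y1 y2 y3 y4 → d :* (d :* (d :* (d :* y0))) :+ (d :* x) :* (d :* (d :* (d :* y1)) :+ (d :* x) :* (d :* (d :* y2) :+ (d :* x) :* (d :* y3 :+ (d :* x) :* y4)))
            := (d :* (d :* (d :* d))) :* (y0 :+ x :* (y1 :+ x :* (y2 :+ x :* (y3 :+ x :* y4))))) refl δ τ (ι z0) (ι z1) (ι z2) (ι z3) (ι z4) ⟩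
        (δ * (δ * (δ * δ))) * lcℤ τ v ≡⟨ cong₂ _*_ (sym (trans (ι-* D (D ℤ.* (D ℤ.* D))) (cong (δ *_) (trans (ι-* D (D ℤ.* D)) (cong (δ *_) (ι-* D D))))))
             (sym (trans (cong σ (sym (lc-toℚ θ v))) (trans (σ-lc (Vec.map toℚ v)) (lc-toℚ τ v)))) ⟩
        ι (D ℤ.* (D ℤ.* (D ℤ.* D))) * σ (lcℤ θ v) ∎

  scalar-cancel : ∀ q x → x ≢ 0# → const q * x ≡ 0# → q ≡ 0ℚ
  scalar-cancel q x x≢0 e = decidable-stable (q ℚₚ.≟ 0ℚ) λ q≢0 → x≢0 (vanish q≢0)
    where
    vanish : q ≢ 0ℚ → x ≡ 0#
    vanish q≢0 = begin
      x ≡⟨ *-identityˡ x ⟨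
      1# * x ≡⟨ cong (_* x) (trans (sym (const-* r q)) (trans (cong const (ℚₚ.*-inverseˡ q)) const-1)) ⟨
      const r * const q * x ≡⟨ *-assoc (const r) (const q) x ⟩
      const r * (const q * x) ≡⟨ cong (const r *_) e ⟩
      const r * 0# ≡⟨ zeroʳ (const r) ⟩
      0# ∎
      where
      instance _ = ℚ.≢-nonZero q≢0
      r = ℚ.1/ q

  -- A fixed x satisfies 5x = Tr x, and traces are rational.
  σ-fixed : ∀ x → σ x ≡ x → Σ ℚ λ q → x ≡ const q
  σ-fixed x f = proj₁ i ℚ.* t , ι-cancel (pos 5) (λ ()) (begin
      ι (pos 5) * x ≡⟨ solve 1 (λ x → con (pos 5) :* x := x :+ x :+ x :+ x :+ x) refl x ⟩
      x + x + x + x + x ≡⟨ cong₂ _+_ (cong₂ _+_ (cong₂ _+_ (cong (x +_) f1) f2) f3) f4 ⟩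
      total x ≡⟨ total-rational x ⟩
      const t ≡⟨ cong const (trans (sym (ℚₚ.*-identityˡ t)) (trans (cong (ℚ._* t) (trans (sym (proj₂ i)) (ℚₚ.*-comm (proj₁ i) (toℚ (pos 5))))) (ℚₚ.*-assoc (toℚ (pos 5)) (proj₁ i) t))) ⟩
      const (toℚ (pos 5) ℚ.* (proj₁ i ℚ.* t)) ≡⟨ const-* (toℚ (pos 5)) _ ⟩
      ι (pos 5) * const (proj₁ i ℚ.* t) ∎)
    where
    open Solver
    t = traceForm (coords x)
    i = toℚ-inverse (pos 5) (λ ())
    f1 = sym f
    f2 = trans f1 (cong σ f1)
    f3 = trans f1 (cong σ f2)
    f4 = trans f1 (cong σ f3)

  field-K : CyclicQuinticField
  field-K = record
    { algebra = algebra ; const-injective = const-injective ; scalar-cancel = scalar-cancel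
    ; Λ = Λ ; Λ-+ = Λ-+ ; Λ-* = Λ-* ; Λ-ι = Λ-ι ; Λ-rational = Λ-rational ; Λ-denominator = Λ-denominator
    ; σ = σ ; σ-+ = σ-+ ; σ-* = σ-* ; σ-const = σ-const ; σ⁵ = σ⁵ ; σ-fixed = σ-fixed ; σ-denominator = σ-denominator }

  open CyclicQuinticField field-K using (A)
  open AlmostIntegral field-K
  open Local field-K
  open PMaximality field-K

  A-root : ∀ {α} g → pow5 α + lcℤ α g ≡ 0# → A α
  A-root {α} (g0 ∷ g1 ∷ g2 ∷ g3 ∷ g4 ∷ []) e = Integral⇒A (g0 ∷ g1 ∷ g2 ∷ g3 ∷ g4 ∷ [] , trans
    (cong (λ t → ι g0 + α * (ι g1 + α * (ι g2 + α * (ι g3 + α * (ι g4 + α * t))))) (sym const-1))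
    (trans (solve 6 (λ α g0 g1 g2 g3 g4 → g0 :+ α :* (g1 :+ α :* (g2 :+ α :* (g3 :+ α :* (g4 :+ α :* con (pos 1))))) :=
      α :* (α :* (α :* (α :* α))) :+ (g0 :+ α :* (g1 :+ α :* (g2 :+ α :* (g3 :+ α :* g4))))) refl α (ι g0) (ι g1) (ι g2) (ι g3) (ι g4)) e))
    where open Solver

  total-scale : ∀ z x → total (ι z * x) ≡ ι z * total x
  total-scale z x = trans (cong₂ _+_ (cong₂ _+_ (cong₂ _+_ (cong (ι z * x +_) s1) s2) s3) s4)
    (solve 6 (λ q a b c d e → q :* a :+ q :* b :+ q :* c :+ q :* d :+ q :* e := q :* (a :+ b :+ c :+ d :+ e)) refl (ι z) x (σ x) (σ (σ x)) (σ (σ (σ x))) (σ (σ (σ (σ x)))))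
    where
    open Solver
    step : ∀ {v w} → v ≡ ι z * w → σ v ≡ ι z * σ w
    step {w = w} refl = σ-const* (toℚ z) w
    s1 = step refl
    s2 = step s1
    s3 = step s2
    s4 = step s3

  trace-check : ∀ e p q {x} → ⟪ p ⟫ ≢ pos 0 → ι ⟪ p ⟫ * x ≡ eval e → T (vanishes (dotP (compute e) powerTraces -P p *P q)) → trace x ≡ ι ⟪ q ⟫
  trace-check e p q {x} p≢0 h v = ι-cancel ⟪ p ⟫ p≢0 (begin
    ι ⟪ p ⟫ * total x ≡⟨ total-scale ⟪ p ⟫ x ⟨
    total (ι ⟪ p ⟫ * x) ≡⟨ cong total (trans h (sym (compute-correct e))) ⟩
    total (E (compute e)) ≡⟨ total-E (compute e) ⟩
    ι ⟪ dotP (compute e) powerTraces ⟫ ≡⟨ cong ι (poly-≡ (dotP (compute e) powerTraces) (p *P q) v) ⟩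
    ι ⟪ p *P q ⟫ ≡⟨ trans (cong ι (⟪⟫-* p q)) (ι-* ⟪ p ⟫ ⟪ q ⟫) ⟩
    ι ⟪ p ⟫ * ι ⟪ q ⟫ ∎)

  -- The element α = X / d and the coordinates e of y = Δ / f'(α) are data; their trace conditions
  -- are verified by computation. Clearing y costs d⁴, since e has degree at most 4, and clearing α⁴
  -- another d⁴, whence the eight factors d in `v4`.
  module Dual (d : Poly) (d≢0 : ⟪ d ⟫ ≢ pos 0) (X : Expr) (α : K) (dα : ι ⟪ d ⟫ * α ≡ eval X) (g e : PolyVec) (Δ : Poly)
    (relation : T (agree (homogeneous₅ d X g) (scalar [])))
    (v0 : T (vanishes (dotP (compute (homogeneous₄ d X e)) powerTraces)))
    (v1 : T (vanishes (dotP (compute (homogeneous₄ d X e ⊠ X)) powerTraces)))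
    (v2 : T (vanishes (dotP (compute (homogeneous₄ d X e ⊠ (X ⊠ X))) powerTraces)))
    (v3 : T (vanishes (dotP (compute (homogeneous₄ d X e ⊠ (X ⊠ (X ⊠ X)))) powerTraces)))
    (v4 : T (vanishes (dotP (compute (homogeneous₄ d X e ⊠ (X ⊠ (X ⊠ (X ⊠ X))))) powerTraces -P ((d *P (d *P (d *P d))) *P (d *P (d *P (d *P d)))) *P Δ))) where
    α⁵ : pow5 α + lcℤ α (Vec.map ⟪_⟫ g) ≡ 0#
    α⁵ = monic-relation d X g d≢0 dα relation

    aα : A α
    aα = A-root (Vec.map ⟪_⟫ g) α⁵

    private
      Y : Expr
      Y = homogeneous₄ d X e
      d⁴ : Poly
      d⁴ = d *P (d *P (d *P d))
      y : K
      y = lcℤ α (Vec.map ⟪_⟫ e)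
      product : ∀ p q {x y X Y} → ι ⟪ p ⟫ * x ≡ X → ι ⟪ q ⟫ * y ≡ Y → ι ⟪ p *P q ⟫ * (x * y) ≡ X * Y
      product p q {x} {y} refl refl = trans (cong (_* (x * y)) (trans (cong ι (⟪⟫-* p q)) (ι-* ⟪ p ⟫ ⟪ q ⟫)))
        (solve 4 (λ p q x y → p :* q :* (x :* y) := p :* x :* (q :* y)) refl (ι ⟪ p ⟫) (ι ⟪ q ⟫) x y)
        where open Solver
      nonzero : ∀ p q → ⟪ p ⟫ ≢ pos 0 → ⟪ q ⟫ ≢ pos 0 → ⟪ p *P q ⟫ ≢ pos 0
      nonzero p q h h' eq = *-nonzero h h' (trans (sym (⟪⟫-* p q)) eq)
      n² = nonzero d d d≢0 d≢0
      n³ = nonzero d (d *P d) d≢0 n²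
      n⁴ = nonzero d (d *P (d *P d)) d≢0 n³
      dy : ι ⟪ d⁴ ⟫ * y ≡ eval Y
      dy = trans (cong (_* y) (trans (s d (d *P (d *P d))) (cong (ι ⟪ d ⟫ *_) (trans (s d (d *P d)) (cong (ι ⟪ d ⟫ *_) (s d d))))))
        (trans (solve 2 (λ d y → d :* (d :* (d :* d)) :* y := d :* (d :* (d :* (d :* y)))) refl (ι ⟪ d ⟫) y) (sym (eval-homogeneous₄ d X e dα)))
        where
        open Solver
        s : ∀ p q → ι ⟪ p *P q ⟫ ≡ ι ⟪ p ⟫ * ι ⟪ q ⟫
        s p q = trans (cong ι (⟪⟫-* p q)) (ι-* ⟪ p ⟫ ⟪ q ⟫)
      zero-trace : ∀ e p {x} → ⟪ p ⟫ ≢ pos 0 → ι ⟪ p ⟫ * x ≡ eval e → T (vanishes (dotP (compute e) powerTraces)) → trace x ≡ 0#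
      zero-trace e p {x} p≢0 h v = cancel-zero ⟪ p ⟫ p≢0 (begin
        ι ⟪ p ⟫ * trace x ≡⟨ total-scale ⟪ p ⟫ x ⟨
        total (ι ⟪ p ⟫ * x) ≡⟨ cong total (trans h (sym (compute-correct e))) ⟩
        total (E (compute e)) ≡⟨ total-E (compute e) ⟩
        ι ⟪ dotP (compute e) powerTraces ⟫ ≡⟨ cong ι (vanishes-sound (dotP (compute e) powerTraces) v) ⟩
        ι (pos 0) ≡⟨ const-0 ⟩
        0# ∎)
      d²α = product d d dα dα
      d³α = product d (d *P d) dα d²α
      d⁴α = product d (d *P (d *P d)) dα d³α

    bounded : ∀ b → A (lc α b) → ∀ i → IsInt (toℚ ⟪ Δ ⟫ ℚ.* lookup b i)
    bounded = DualBasis.bounded-denominators α aα ⟪ lookup g 0F ⟫ ⟪ lookup g 1F ⟫ ⟪ lookup g 2F ⟫ ⟪ lookup g 3F ⟫ ⟪ lookup g 4F ⟫ α⁵' y (A-lcℤ aα (Vec.map ⟪_⟫ e)) ⟪ Δ ⟫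
      (zero-trace Y d⁴ n⁴ dy v0)
      (zero-trace (Y ⊠ X) (d⁴ *P d) (nonzero d⁴ d n⁴ d≢0) (product d⁴ d dy dα) v1)
      (zero-trace (Y ⊠ (X ⊠ X)) (d⁴ *P (d *P d)) (nonzero d⁴ (d *P d) n⁴ n²) (product d⁴ (d *P d) dy d²α) v2)
      (zero-trace (Y ⊠ (X ⊠ (X ⊠ X))) (d⁴ *P (d *P (d *P d))) (nonzero d⁴ (d *P (d *P d)) n⁴ n³) (product d⁴ (d *P (d *P d)) dy d³α) v3)
      (trace-check (Y ⊠ (X ⊠ (X ⊠ (X ⊠ X)))) (d⁴ *P d⁴) Δ (nonzero d⁴ d⁴ n⁴ n⁴) (product d⁴ d⁴ dy d⁴α) v4)
      where
      α⁵' : pow5 α + lcℤ α (⟪ lookup g 0F ⟫ ∷ ⟪ lookup g 1F ⟫ ∷ ⟪ lookup g 2F ⟫ ∷ ⟪ lookup g 3F ⟫ ∷ ⟪ lookup g 4F ⟫ ∷ []) ≡ 0#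
      α⁵' = trans (cong (λ g → pow5 α + lcℤ α g) (five-entries g)) α⁵
        where
        five-entries : ∀ (g : PolyVec) → ⟪ lookup g 0F ⟫ ∷ ⟪ lookup g 1F ⟫ ∷ ⟪ lookup g 2F ⟫ ∷ ⟪ lookup g 3F ⟫ ∷ ⟪ lookup g 4F ⟫ ∷ [] ≡ Vec.map ⟪_⟫ g
        five-entries (_ ∷ _ ∷ _ ∷ _ ∷ _ ∷ []) = refl

-- unitIndex is, up to sign and outside m, the index of θ / σ⁴θ; unitPart is the constant term of the minimal polynomial of T divided by m.
bezout₁ bezout₂ bezout₃ bezout₄ bezout₅ bezout₆ unitIndex unitPart : Poly
unitIndex = neg 1075 ∷ neg 7325 ∷ neg 22570 ∷ neg 42540 ∷ neg 55498 ∷ neg 53399 ∷ neg 39212 ∷ neg 22336 ∷ neg 9895 ∷ neg 3373 ∷ neg 861 ∷ neg 156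
  ∷ neg 18 ∷ neg 1 ∷ []
unitPart = pos 125 ∷ neg 125 ∷ neg 200 ∷ pos 0 ∷ pos 65 ∷ pos 30 ∷ pos 4 ∷ []
bezout₁ = neg 2610 ∷ neg 15750 ∷ neg 42420 ∷ neg 69695 ∷ neg 79188 ∷ neg 66158 ∷ neg 41896 ∷ neg 20329 ∷ neg 7517 ∷ neg 2069 ∷ neg 403 ∷ neg 50
  ∷ neg 3 ∷ []
bezout₂ = neg 17 ∷ neg 11 ∷ neg 3 ∷ []
bezout₃ = pos 18 ∷ pos 10 ∷ pos 5 ∷ pos 1 ∷ []
bezout₄ = neg 5 ∷ neg 5 ∷ neg 1 ∷ []
bezout₅ = pos 200 ∷ neg 175 ∷ neg 130 ∷ pos 15 ∷ pos 58 ∷ pos 12 ∷ []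
bezout₆ = neg 15 ∷ neg 20 ∷ neg 7 ∷ neg 3 ∷ []

-- By Euler's formula Tr (αᵏ / f'(α)) = δₖ₄ for k ≤ 4, where f is the minimal polynomial of α: dualθ and dualUnitRatio are the
-- coordinates of Δ / f'(α) in the powers of α, for α = θ with Δ = D² m and for α = θ / σ⁴θ with Δ = unitIndex² m.
-- unitRatio, depressed and cubed are D θ / σ⁴θ, T = n² + 5θ and T³; the powers of m are left out of the polynomials of the last two.
dualθ unitRatio unitRatioPolynomial dualUnitRatio shiftedP shiftedPolynomial depressed depressedPolynomial cubed cubedPolynomial : PolyVec
dualθ = (pos 165 ∷ pos 485 ∷ pos 613 ∷ pos 442 ∷ pos 202 ∷ pos 60 ∷ pos 11 ∷ pos 1 ∷ [])
  ∷ (pos 179 ∷ pos 795 ∷ pos 1463 ∷ pos 1522 ∷ pos 1015 ∷ pos 454 ∷ pos 134 ∷ pos 24 ∷ pos 2 ∷ [])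
  ∷ (neg 282 ∷ neg 844 ∷ neg 1151 ∷ neg 954 ∷ neg 523 ∷ neg 187 ∷ neg 40 ∷ neg 4 ∷ [])
  ∷ (neg 1 ∷ pos 2 ∷ pos 33 ∷ pos 59 ∷ pos 42 ∷ pos 14 ∷ pos 2 ∷ [])
  ∷ (pos 30 ∷ pos 58 ∷ pos 42 ∷ pos 14 ∷ pos 2 ∷ []) ∷ []
unitRatio = (pos 1 ∷ pos 2 ∷ pos 1 ∷ [])
  ∷ (pos 15 ∷ pos 35 ∷ pos 35 ∷ pos 19 ∷ pos 6 ∷ pos 1 ∷ [])
  ∷ (pos 10 ∷ pos 39 ∷ pos 57 ∷ pos 46 ∷ pos 23 ∷ pos 7 ∷ pos 1 ∷ [])
  ∷ (neg 9 ∷ neg 18 ∷ neg 18 ∷ neg 12 ∷ neg 5 ∷ neg 1 ∷ [])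
  ∷ (neg 3 ∷ neg 6 ∷ neg 4 ∷ neg 1 ∷ []) ∷ []
unitRatioPolynomial = (neg 1 ∷ [])
  ∷ (neg 20 ∷ neg 25 ∷ neg 15 ∷ neg 5 ∷ neg 1 ∷ [])
  ∷ (neg 85 ∷ neg 175 ∷ neg 170 ∷ neg 100 ∷ neg 38 ∷ neg 9 ∷ neg 1 ∷ [])
  ∷ (neg 90 ∷ neg 250 ∷ neg 310 ∷ neg 235 ∷ neg 119 ∷ neg 41 ∷ neg 9 ∷ neg 1 ∷ [])
  ∷ (pos 20 ∷ pos 25 ∷ pos 15 ∷ pos 5 ∷ pos 1 ∷ []) ∷ []
dualUnitRatio = (neg 9825725 ∷ neg 108668575 ∷ neg 585966935 ∷ neg 2049746805 ∷ neg 5226704639 ∷ neg 10353416711 ∷ neg 16578946863 ∷ neg 22046209344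
    ∷ neg 24812891519 ∷ neg 23964652462 ∷ neg 20062078916 ∷ neg 14663119091 ∷ neg 9403233875 ∷ neg 5307061497 ∷ neg 2639589356 ∷ neg 1156609021
    ∷ neg 445584880 ∷ neg 150342864 ∷ neg 44157622 ∷ neg 11191003 ∷ neg 2416899 ∷ neg 437038 ∷ neg 64506 ∷ neg 7479 ∷ neg 640 ∷ neg 36 ∷ neg 1 ∷ [])
  ∷ (neg 112913725 ∷ neg 1312712400 ∷ neg 7473592860 ∷ neg 27735098225 ∷ neg 75379745754 ∷ neg 159849942279 ∷ neg 275162759259 ∷ neg 394926159646
    ∷ neg 481674428909 ∷ neg 506225794593 ∷ neg 463195999781 ∷ neg 371814458684 ∷ neg 263284752475 ∷ neg 165084622061 ∷ neg 91866805752 ∷ neg 45412176411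
    ∷ neg 19932313710 ∷ neg 7754046613 ∷ neg 2664704885 ∷ neg 804893021 ∷ neg 212181858 ∷ neg 48340926 ∷ neg 9391954 ∷ neg 1527599 ∷ neg 202617 ∷ neg 21075
    ∷ neg 1614 ∷ neg 81 ∷ neg 2 ∷ [])
  ∷ (neg 188418350 ∷ neg 2255342475 ∷ neg 13232886410 ∷ neg 50682951445 ∷ neg 142399082074 ∷ neg 312708375562 ∷ neg 558437487566 ∷ neg 833060861293
    ∷ neg 1058172904875 ∷ neg 1160704577726 ∷ neg 1111052914995 ∷ neg 935438551958 ∷ neg 696777372721 ∷ neg 461081677046 ∷ neg 271803522977
    ∷ neg 142941692479 ∷ neg 67080734909 ∷ neg 28064460246 ∷ neg 10444057703 ∷ neg 3444745165 ∷ neg 1001673992 ∷ neg 254920681 ∷ neg 56219789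
    ∷ neg 10600874 ∷ neg 1677765 ∷ neg 217108 ∷ neg 22092 ∷ neg 1660 ∷ neg 82 ∷ neg 2 ∷ [])
  ∷ (pos 38838275 ∷ pos 412639075 ∷ pos 2142725265 ∷ pos 7239543185 ∷ pos 17881253091 ∷ pos 34395216705 ∷ pos 53594323746 ∷ pos 69465917643
    ∷ pos 76306935880 ∷ pos 72001960938 ∷ pos 58932796075 ∷ pos 42134309896 ∷ pos 26439131729 ∷ pos 14602857233 ∷ pos 7107491235 ∷ pos 3047059296
    ∷ pos 1148150494 ∷ pos 378732446 ∷ pos 108692247 ∷ pos 26898641 ∷ pos 5668763 ∷ pos 999556 ∷ pos 143762 ∷ pos 16232 ∷ pos 1352 ∷ pos 74 ∷ pos 2 ∷ [])
  ∷ (pos 1970150 ∷ pos 18403750 ∷ pos 83596690 ∷ pos 245628540 ∷ pos 524209776 ∷ pos 865069972 ∷ pos 1147268122 ∷ pos 1254295240 ∷ pos 1150234754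
    ∷ pos 895277740 ∷ pos 596037456 ∷ pos 340936746 ∷ pos 167827320 ∷ pos 71018072 ∷ pos 25733354 ∷ pos 7927772 ∷ pos 2053514 ∷ pos 439886 ∷ pos 76032
    ∷ pos 10212 ∷ pos 1002 ∷ pos 64 ∷ pos 2 ∷ []) ∷ []
shiftedP = (pos 1 ∷ []) ∷ (pos 1 ∷ []) ∷ [] ∷ [] ∷ [] ∷ []
shiftedPolynomial = (pos 5 ∷ pos 15 ∷ pos 14 ∷ pos 6 ∷ pos 1 ∷ [])
  ∷ (neg 25 ∷ neg 50 ∷ neg 40 ∷ neg 15 ∷ neg 2 ∷ [])
  ∷ (pos 25 ∷ pos 45 ∷ pos 35 ∷ pos 11 ∷ pos 1 ∷ [])
  ∷ (pos 0 ∷ neg 10 ∷ neg 10 ∷ neg 2 ∷ [])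
  ∷ (neg 5 ∷ pos 0 ∷ pos 1 ∷ []) ∷ []
depressed = (pos 0 ∷ pos 0 ∷ pos 1 ∷ []) ∷ (pos 5 ∷ []) ∷ [] ∷ [] ∷ [] ∷ []
depressedPolynomial = (pos 125 ∷ neg 125 ∷ neg 200 ∷ pos 0 ∷ pos 65 ∷ pos 30 ∷ pos 4 ∷ [])
  ∷ (pos 250 ∷ pos 0 ∷ neg 100 ∷ neg 75 ∷ neg 15 ∷ [])
  ∷ (pos 25 ∷ pos 50 ∷ pos 20 ∷ [])
  ∷ (neg 10 ∷ [])
  ∷ [] ∷ []
cubed = (pos 0 ∷ pos 0 ∷ pos 0 ∷ pos 0 ∷ pos 0 ∷ pos 0 ∷ pos 1 ∷ [])
  ∷ (pos 0 ∷ pos 0 ∷ pos 0 ∷ pos 0 ∷ pos 15 ∷ [])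
  ∷ (pos 0 ∷ pos 0 ∷ pos 75 ∷ [])
  ∷ (pos 125 ∷ [])
  ∷ (pos 0 ∷ []) ∷ []
cubedPolynomial = (pos 1953125 ∷ neg 5859375 ∷ neg 3515625 ∷ pos 16796875 ∷ pos 8671875 ∷ neg 19687500 ∷ neg 17328125 ∷ pos 6281250 ∷ pos 13471875
    ∷ pos 4078125 ∷ neg 2985000 ∷ neg 2782500 ∷ neg 661375 ∷ pos 230250 ∷ pos 216600 ∷ pos 73800 ∷ pos 13920 ∷ pos 1440 ∷ pos 64 ∷ [])
  ∷ (pos 12812500 ∷ neg 1406250 ∷ neg 10218750 ∷ neg 4546875 ∷ pos 3000000 ∷ pos 2934375 ∷ pos 350000 ∷ neg 669375 ∷ neg 444375 ∷ neg 141375 ∷ neg 28725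
    ∷ neg 3825 ∷ neg 255 ∷ [])
  ∷ (pos 5921875 ∷ pos 16890625 ∷ pos 20578125 ∷ pos 15381250 ∷ pos 7978125 ∷ pos 3020625 ∷ pos 870000 ∷ pos 198625 ∷ pos 37125 ∷ pos 4750 ∷ pos 380 ∷ [])
  ∷ (neg 15625 ∷ neg 17500 ∷ neg 7500 ∷ neg 1250 ∷ neg 250 ∷ [])
  ∷ (pos 75 ∷ pos 150 ∷ pos 60 ∷ []) ∷ []

-- The dual bases for θ and for the unit θ / σ⁴θ

module Dualities (n : ℤ) (Q : QuinticAlgebra n) (D≢0 : Evaluation.⟪_⟫ n discriminantRoot ≢ pos 0) where
  open Evaluation n
  open QuinticAlgebra Q
  open Reflection n Q
  open Construct n Q D≢0
  open Cyclic n Q D≢0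
  open ≡-Reasoning

  one : Poly
  one = pos 1 ∷ []

  ⟪one⟫ : ⟪ one ⟫ ≡ pos 1
  ⟪one⟫ = cong (λ t → pos 1 ℤ.+ t) (ℤₚ.*-zeroʳ n)

  one≢0 : ⟪ one ⟫ ≢ pos 0
  one≢0 e with trans (sym ⟪one⟫) e
  ... | ()

  ι-one* : ∀ x → ι ⟪ one ⟫ * x ≡ x
  ι-one* x = trans (cong (λ t → ι t * x) ⟪one⟫) (trans (cong (_* x) const-1) (*-identityˡ x))

  module θ-Dual = Dual one one≢0 (lit θP) θ (trans (ι-one* θ) (sym Eθ)) coefficientsP dualθ (discriminantRoot *P discriminantRoot *P conductorP)
    tt tt tt tt tt tt

  ratio : K
  ratio = const (proj₁ (toℚ-inverse ⟪ discriminantRoot ⟫ D≢0)) * E unitRatio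

  D-ratio : ι ⟪ discriminantRoot ⟫ * ratio ≡ E unitRatio
  D-ratio = ι-divide ⟪ discriminantRoot ⟫ D≢0 (E unitRatio)

  module ratio-Dual = Dual discriminantRoot D≢0 (lit unitRatio) ratio D-ratio unitRatioPolynomial dualUnitRatio (unitIndex *P unitIndex *P conductorP)
    tt tt tt tt tt tt

-- A generator for every prime

∣-+ : ∀ {p} a b → p ℕD.∣ ∣ a ∣ → p ℕD.∣ ∣ b ∣ → p ℕD.∣ ∣ a ℤ.+ b ∣
∣-+ {p} a b pa pb = let (x , ex) = ∣-signed p a pa ; (y , ey) = ∣-signed p b pb in
  ℕD.divides ∣ x ℤ.+ y ∣ (trans (cong ∣_∣ (trans (cong₂ ℤ._+_ ex ey) (sym (ℤₚ.*-distribʳ-+ (pos p) x y)))) (ℤₚ.∣i*j∣≡∣i∣*∣j∣ (x ℤ.+ y) (pos p)))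

∣-*ˡ : ∀ {p} a b → p ℕD.∣ ∣ b ∣ → p ℕD.∣ ∣ a ℤ.* b ∣
∣-*ˡ {p} a b pb = subst (p ℕD.∣_) (sym (ℤₚ.∣i*j∣≡∣i∣*∣j∣ a b)) (ℕD.∣n⇒∣m*n ∣ a ∣ pb)

module Divisibility (n : ℤ) where
  open Evaluation n

  -- A Bézout identity in ℤ[n] with constant right side bounds the common divisors of two polynomial
  -- values for all n at once.
  bezout-∣ : ∀ {p} u a v b c → T (vanishes (u *P a +P v *P b -P (c ∷ []))) → p ℕD.∣ ∣ ⟪ a ⟫ ∣ → p ℕD.∣ ∣ ⟪ b ⟫ ∣ → p ℕD.∣ ∣ c ∣
  bezout-∣ {p} u a v b c h pa pb = subst (λ t → p ℕD.∣ ∣ t ∣)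
    (trans (sym (trans (⟪⟫-+ (u *P a) (v *P b)) (cong₂ ℤ._+_ (⟪⟫-* u a) (⟪⟫-* v b)))) (trans (poly-≡ (u *P a +P v *P b) (c ∷ []) h)
      (trans (cong (λ t → c ℤ.+ t) (ℤₚ.*-zeroʳ n)) (ℤₚ.+-identityʳ c))))
    (∣-+ (⟪ u ⟫ ℤ.* ⟪ a ⟫) (⟪ v ⟫ ℤ.* ⟪ b ⟫) (∣-*ˡ ⟪ u ⟫ ⟪ a ⟫ pa) (∣-*ˡ ⟪ v ⟫ ⟪ b ⟫ pb))

  constant-term : ∀ {p} → p ℕD.∣ ∣ n ∣ → ∀ a q → p ℕD.∣ ∣ ⟪ a ∷ q ⟫ ∣ → p ℕD.∣ ∣ a ∣
  constant-term {p} p∣n a q h = subst (λ t → p ℕD.∣ ∣ t ∣)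
    (solve 3 (λ a n q → (a :+ n :* q) :+ (:- q) :* n := a) refl a n ⟪ q ⟫)
    (∣-+ ⟪ a ∷ q ⟫ (ℤ.- ⟪ q ⟫ ℤ.* n) h (∣-*ˡ (ℤ.- ⟪ q ⟫) n p∣n))
    where open ℤSolver.+-*-Solver

∣5⇒≡5 : ∀ {p} → Prime p → ∀ k → p ℕD.∣ 5 ℕ.^ suc k → p ≡ 5
∣5⇒≡5 {p} pr k d = go (Data.Nat.Primality.prime⇒irreducible prime5 (∣^⇒∣ pr 5 k d))
  where
  go : (p ≡ 1) ⊎ (p ≡ 5) → p ≡ 5
  go (inj₁ refl) = contradiction pr Data.Nat.Primality.¬prime[1]
  go (inj₂ e) = e

module PrimeCases (n : ℤ) (Q : QuinticAlgebra n) (5∣n : 5 ℕD.∣ ∣ n ∣) (cube-free : CubeFree (Evaluation.⟪_⟫ n conductorP)) where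
  open Evaluation n
  open QuinticAlgebra Q
  open Reflection n Q
  open Divisibility n
  open ≡-Reasoning

  5∤D : ¬ 5 ℕD.∣ ∣ ⟪ discriminantRoot ⟫ ∣
  5∤D h = from-no (5 ℕD.∣? 7) (constant-term 5∣n (pos 7) (pos 10 ∷ pos 5 ∷ pos 1 ∷ []) h)

  D≢0 : ⟪ discriminantRoot ⟫ ≢ pos 0
  D≢0 e = 5∤D (subst (λ z → 5 ℕD.∣ ∣ z ∣) (sym e) (5 ℕD.∣0))

  m≢0 : ⟪ conductorP ⟫ ≢ pos 0
  m≢0 e with cube-free 2 (subst (λ z → 8 ℕD.∣ ∣ z ∣) (sym e) (8 ℕD.∣0))
  ... | ()

  open Construct n Q D≢0
  open Cyclic n Q D≢0 public
  open Dualities n Q D≢0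
  open CyclicQuinticField field-K using (A)
  open AlmostIntegral field-K
  open PMaximality field-K

  private
    μ : ℤ
    μ = ⟪ conductorP ⟫
    ⟪⟫-*-nonzero : ∀ p q → ⟪ p ⟫ ≢ pos 0 → ⟪ q ⟫ ≢ pos 0 → ⟪ p *P q ⟫ ≢ pos 0
    ⟪⟫-*-nonzero p q hp hq e = *-nonzero hp hq (trans (sym (⟪⟫-* p q)) e)
    ⟪⟫-*-∤ : ∀ {p} → Prime p → ∀ a b → ¬ p ℕD.∣ ∣ ⟪ a ⟫ ∣ → ¬ p ℕD.∣ ∣ ⟪ b ⟫ ∣ → ¬ p ℕD.∣ ∣ ⟪ a *P b ⟫ ∣
    ⟪⟫-*-∤ {p} pr a b ha hb h = ∤-* pr {⟪ a ⟫} {⟪ b ⟫} ha hb (subst (λ z → p ℕD.∣ ∣ z ∣) (⟪⟫-* a b) h)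

  coordinates : Coordinates field-K
  coordinates = record
    { coordinate = λ c x → lookup (coords x) c
    ; coordinate-+ = λ c x y → trans (cong (λ v → lookup v c) (coords-+ x y)) (Vecₚ.lookup-zipWith ℚ._+_ c (coords x) (coords y))
    ; coordinate-const* = λ c q x → trans (cong (λ v → lookup v c) (coords-const* q x)) (Vecₚ.lookup-map c (q ℚ.*_) (coords x))
    ; coordinate-injective = λ x h → trans (sym (lc-coords x)) (trans (cong (lc θ) (all-zero (coords x) h)) (trans (lc-const θ 0ℚ) const-0))
    ; θ = θ
    ; Λ-generated = λ l → l
    ; discriminant = ⟪ discriminantRoot *P discriminantRoot *P conductorP ⟫
    ; discriminant≢0 = ⟪⟫-*-nonzero (discriminantRoot *P discriminantRoot) conductorP (⟪⟫-*-nonzero discriminantRoot discriminantRoot D≢0 D≢0) m≢0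
    ; A-denominator = λ {x} a → Λ-clear ⟪ discriminantRoot *P discriminantRoot *P conductorP ⟫ x (θ-Dual.bounded (coords x) (A-≡ (sym (lc-coords x)) a)) }
    where
    all-zero : ∀ {k} (v : Vec ℚ k) → (∀ c → lookup v c ≡ 0ℚ) → v ≡ Vec.replicate k 0ℚ
    all-zero [] h = refl
    all-zero (q ∷ v) h = cong₂ _∷_ (h zero) (all-zero v (λ c → h (suc c)))

  -- A monic relation for α is kept as well: it reduces polynomials in α of arbitrary degree, as
  -- they occur in membership in ℤ[α], to degree at most 4.
  Good : ℕ → Set
  Good p = Σ K λ α → A α × PMaximal p α × Σ (Vec ℤ 5) λ g → pow5 α + lcℤ α g ≡ 0#

  record EisensteinAt (p : ℕ) : Set where
    field
      root : K
      e0 e1 e2 e3 e4 : ℤ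
      p∤e0 : ¬ p ℕD.∣ ∣ e0 ∣
      equation : pow5 root + ι (pos p) * lcℤ root (e0 ∷ e1 ∷ e2 ∷ e3 ∷ e4 ∷ []) ≡ 0#
    polynomial : pow5 root + lcℤ root (pos p · (e0 ∷ e1 ∷ e2 ∷ e3 ∷ e4 ∷ [])) ≡ 0#
    polynomial = trans (cong (pow5 root +_) (lcℤ-· root (pos p) (e0 ∷ e1 ∷ e2 ∷ e3 ∷ e4 ∷ []))) equation
    A-rootₑ : A root
    A-rootₑ = A-root (pos p · (e0 ∷ e1 ∷ e2 ∷ e3 ∷ e4 ∷ [])) polynomial

  eisenstein-good : ∀ {p} → Prime p → EisensteinAt p → Good p
  eisenstein-good {p} pr ei = root , A-rootₑ , eisenstein⇒PMaximal pr A-rootₑ e0 e1 e2 e3 e4 p∤e0 equation , pos p · (e0 ∷ e1 ∷ e2 ∷ e3 ∷ e4 ∷ []) , polynomial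
    where open EisensteinAt ei

  -- As 5 ∣ n, f_n is (X + 1)⁵ modulo 5. The polynomial of θ + 1 has constant term 5 + n (15 + 14n +
  -- 6n² + n³), which is 5 modulo 25 because both n and the bracket are divisible by 5.
  wild : EisensteinAt 5
  wild = record
    { root = E shiftedP
    ; e0 = c (pos 1) w0 ; e1 = c (neg 5) w1 ; e2 = c (pos 5) w2 ; e3 = c (pos 0) w3 ; e4 = c (neg 1) w4
    ; p∤e0 = λ h → from-no (5 ℕD.∣? 1) (subst (λ z → 5 ℕD.∣ ∣ z ∣) (solve 2 (λ a b → a :+ b :- b := a) refl (pos 1) (k ℤ.* ⟪ w0 ⟫))
        (∣-+ (c (pos 1) w0) (ℤ.- (k ℤ.* ⟪ w0 ⟫)) h (subst (5 ℕD.∣_) (sym (ℤₚ.∣-i∣≡∣i∣ (k ℤ.* ⟪ w0 ⟫))) (∣-*ˡ k ⟪ w0 ⟫ 5∣w0))))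
    ; equation = trans (cong (pow5 (E shiftedP) +_) (trans (sym (lcℤ-· (E shiftedP) (pos 5) digits₅)) (cong (lcℤ (E shiftedP)) (sym fives))))
        (monic-relation one (lit shiftedP) shiftedPolynomial one≢0 (ι-one* (E shiftedP)) tt) }
    where
    open ℤSolver.+-*-Solver using (solve; _:+_; _:*_; _:-_; _:=_)
    k = proj₁ (∣-signed 5 n 5∣n)
    n≡ : n ≡ k ℤ.* pos 5
    n≡ = proj₂ (∣-signed 5 n 5∣n)
    w0 w1 w2 w3 w4 : Poly
    w0 = pos 15 ∷ pos 14 ∷ pos 6 ∷ pos 1 ∷ []
    w1 = neg 50 ∷ neg 40 ∷ neg 15 ∷ neg 2 ∷ []
    w2 = pos 45 ∷ pos 35 ∷ pos 11 ∷ pos 1 ∷ []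
    w3 = neg 10 ∷ neg 10 ∷ neg 2 ∷ []
    w4 = pos 0 ∷ pos 1 ∷ []
    c : ℤ → Poly → ℤ
    c u w = u ℤ.+ k ℤ.* ⟪ w ⟫
    5∣w0 : 5 ℕD.∣ ∣ ⟪ w0 ⟫ ∣
    5∣w0 = ∣-+ (pos 15) (n ℤ.* ⟪ pos 14 ∷ pos 6 ∷ pos 1 ∷ [] ⟫) (ℕD.divides 3 refl)
      (subst (λ z → 5 ℕD.∣ ∣ z ∣) (ℤₚ.*-comm ⟪ pos 14 ∷ pos 6 ∷ pos 1 ∷ [] ⟫ n) (∣-*ˡ ⟪ pos 14 ∷ pos 6 ∷ pos 1 ∷ [] ⟫ n 5∣n))
    digits₅ : Vec ℤ 5
    digits₅ = c (pos 1) w0 ∷ c (neg 5) w1 ∷ c (pos 5) w2 ∷ c (pos 0) w3 ∷ c (neg 1) w4 ∷ []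
    five-times : ∀ u w → pos 5 ℤ.* u ℤ.+ n ℤ.* ⟪ w ⟫ ≡ pos 5 ℤ.* c u w
    five-times u w = trans (cong (λ t → pos 5 ℤ.* u ℤ.+ t ℤ.* ⟪ w ⟫) n≡) (solve 4 (λ f u k w → f :* u :+ (k :* f) :* w := f :* (u :+ k :* w)) refl (pos 5) u k ⟪ w ⟫)
    fives : Vec.map ⟪_⟫ shiftedPolynomial ≡ pos 5 · digits₅
    fives = cong₂ _∷_ (five-times (pos 1) w0) (cong₂ _∷_ (five-times (neg 5) w1) (cong₂ _∷_ (five-times (pos 5) w2) (cong₂ _∷_ (five-times (pos 0) w3) (cong₂ _∷_ (five-times (neg 1) w4) refl))))

  -- The Bézout combination of m and `unitPart` is 3125 = 5⁵.
  unitPart-coprime : ∀ {p} → Prime p → p ≢ 5 → p ℕD.∣ ∣ μ ∣ → ¬ p ℕD.∣ ∣ ⟪ unitPart ⟫ ∣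
  unitPart-coprime pr p≢5 p∣m p∣g = p≢5 (∣5⇒≡5 pr 4 (bezout-∣ bezout₅ conductorP bezout₆ unitPart (pos 3125) tt p∣m p∣g))

  -- In the polynomial of T all lower coefficients are multiples of m, and the constant term is m
  -- times `unitPart`, which p divides exactly once.
  simple : ∀ {p} → Prime p → p ≢ 5 → ∀ q → μ ≡ q ℤ.* pos p → ¬ p ℕD.∣ ∣ q ∣ → EisensteinAt p
  simple {p} pr p≢5 q μ≡ p∤q = record
    { root = E depressed
    ; e0 = q ℤ.* ⟪ unitPart ⟫ ; e1 = c 1F ; e2 = c 2F ; e3 = c 3F ; e4 = c 4F
    ; p∤e0 = ∤-* pr {q} {⟪ unitPart ⟫} p∤q (unitPart-coprime pr p≢5 (subst (λ z → p ℕD.∣ ∣ z ∣) (sym μ≡) (∣-*ˡ q (pos p) ℕD.∣-refl)))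
    ; equation = trans (cong (pow5 (E depressed) +_) (trans (sym (lcℤ-· (E depressed) (pos p) (c zero ∷ c 1F ∷ c 2F ∷ c 3F ∷ c 4F ∷ []))) (cong (lcℤ (E depressed)) (sym multiples))))
        (monic-relation one (lit depressed) (scaleV conductorP depressedPolynomial) one≢0 (ι-one* (E depressed)) tt) }
    where
    open ℤSolver.+-*-Solver using (solve; _:*_; _:=_)
    c : Fin 5 → ℤ
    c i = q ℤ.* ⟪ lookup depressedPolynomial i ⟫
    h : ∀ b → ⟪ conductorP *P b ⟫ ≡ pos p ℤ.* (q ℤ.* ⟪ b ⟫)
    h b = trans (⟪⟫-* conductorP b) (trans (cong (ℤ._* ⟪ b ⟫) μ≡) (solve 3 (λ q p b → (q :* p) :* b := p :* (q :* b)) refl q (pos p) ⟪ b ⟫))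
    multiples : Vec.map ⟪_⟫ (scaleV conductorP depressedPolynomial) ≡ pos p · (c zero ∷ c 1F ∷ c 2F ∷ c 3F ∷ c 4F ∷ [])
    multiples = cong₂ _∷_ (h (lookup depressedPolynomial zero)) (cong₂ _∷_ (h (lookup depressedPolynomial 1F)) (cong₂ _∷_ (h (lookup depressedPolynomial 2F))
      (cong₂ _∷_ (h (lookup depressedPolynomial 3F)) (cong₂ _∷_ (h (lookup depressedPolynomial 4F)) refl))))

  private
    b0 b1 b2 b3 b4 : Poly
    b0 = lookup cubedPolynomial zero
    b1 = lookup cubedPolynomial 1F
    b2 = lookup cubedPolynomial 2F
    b3 = lookup cubedPolynomial 3F
    b4 = lookup cubedPolynomial 4F

  cube-relation : pow5 (E cubed) + lcℤ (E cubed) (Vec.map ⟪_⟫ ((conductorP *P (conductorP *P (conductorP *P b0))) ∷ (conductorP *P (conductorP *P (conductorP *P b1)))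
    ∷ (conductorP *P (conductorP *P b2)) ∷ (conductorP *P (conductorP *P b3)) ∷ (conductorP *P b4) ∷ [])) ≡ 0#
  cube-relation = monic-relation one (lit cubed) ((conductorP *P (conductorP *P (conductorP *P b0))) ∷ (conductorP *P (conductorP *P (conductorP *P b1)))
    ∷ (conductorP *P (conductorP *P b2)) ∷ (conductorP *P (conductorP *P b3)) ∷ (conductorP *P b4) ∷ []) one≢0 (ι-one* (E cubed)) tt

  -- The coefficients of the polynomial of T³ carry the factors m³, m³, m², m², m, constant term
  -- first. Passing to T³ / p divides them by p⁵, p⁴, p³, p², p; with m = q p² the powers p, p², p,
  -- p², p remain, and the constant term keeps exactly one p.
  double : ∀ {p} → Prime p → p ≢ 5 → ∀ q → μ ≡ q ℤ.* pos p ℤ.* pos p → ¬ p ℕD.∣ ∣ q ∣ → EisensteinAt p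
  double {p} pr p≢5 q μ≡ p∤q = record
    { root = α
    ; e0 = q ℤ.* (q ℤ.* (q ℤ.* ⟪ b0 ⟫)) ; e1 = pos p ℤ.* (q ℤ.* (q ℤ.* (q ℤ.* ⟪ b1 ⟫))) ; e2 = q ℤ.* (q ℤ.* ⟪ b2 ⟫) ; e3 = pos p ℤ.* (q ℤ.* (q ℤ.* ⟪ b3 ⟫)) ; e4 = q ℤ.* ⟪ b4 ⟫
    ; p∤e0 = ∤-* pr {q} {q ℤ.* (q ℤ.* ⟪ b0 ⟫)} p∤q (∤-* pr {q} {q ℤ.* ⟪ b0 ⟫} p∤q (∤-* pr {q} {⟪ b0 ⟫} p∤q p∤b0))
    ; equation = cancel-zero (pos p) p≢0 (cancel⁴ (pos p) p≢0 (trans scaled (sym (trans (cong (P *_) (trans (cong (P *_) (trans (cong (P *_) (zeroʳ P)) (zeroʳ P))) (zeroʳ P))) (zeroʳ P))))) }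
    where
    open Solver
    P = ι (pos p)
    p≢0 : pos p ≢ pos 0
    p≢0 = prime≢0 pr
    S = E cubed
    α : K
    α = const (proj₁ (toℚ-inverse (pos p) p≢0)) * S
    Pα : P * α ≡ S
    Pα = ι-divide (pos p) p≢0 S
    p∣μ : p ℕD.∣ ∣ μ ∣
    p∣μ = subst (λ z → p ℕD.∣ ∣ z ∣) (sym μ≡) (∣-*ˡ (q ℤ.* pos p) (pos p) ℕD.∣-refl)
    p∤g = unitPart-coprime pr p≢5 p∣μ
    -- The norm of T³ is the cube of the norm of T, so b0 is the cube of `unitPart`.
    p∤b0 : ¬ p ℕD.∣ ∣ ⟪ b0 ⟫ ∣
    p∤b0 h = ⟪⟫-*-∤ pr unitPart (unitPart *P unitPart) p∤g (⟪⟫-*-∤ pr unitPart unitPart p∤g p∤g) (subst (λ z → p ℕD.∣ ∣ z ∣) (poly-≡ b0 (unitPart *P (unitPart *P unitPart)) tt) h)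
    q' = ι q
    M = q' * P * P
    ιμ : ι μ ≡ M
    ιμ = trans (cong ι μ≡) (trans (ι-* (q ℤ.* pos p) (pos p)) (cong (_* P) (ι-* q (pos p))))
    m* : ∀ b {x} → ι ⟪ b ⟫ ≡ x → ι ⟪ conductorP *P b ⟫ ≡ M * x
    m* b refl = trans (cong ι (⟪⟫-* conductorP b)) (trans (ι-* μ ⟪ b ⟫) (cong (_* ι ⟪ b ⟫) ιμ))
    ι* : ∀ a b {x} → ι b ≡ x → ι (a ℤ.* b) ≡ ι a * x
    ι* a b refl = ι-* a b
    scaled : P * (P * (P * (P * (P * (pow5 α + P * lcℤ α (q ℤ.* (q ℤ.* (q ℤ.* ⟪ b0 ⟫)) ∷ pos p ℤ.* (q ℤ.* (q ℤ.* (q ℤ.* ⟪ b1 ⟫))) ∷ q ℤ.* (q ℤ.* ⟪ b2 ⟫) ∷ pos p ℤ.* (q ℤ.* (q ℤ.* ⟪ b3 ⟫)) ∷ q ℤ.* ⟪ b4 ⟫ ∷ [])))))) ≡ 0#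
    scaled = begin
      _ ≡⟨ cong (λ l → P * (P * (P * (P * (P * (pow5 α + P * l))))))
            (cong₂ (λ s t → s + α * t) (ι* q _ (ι* q _ (ι* q _ refl))) (cong₂ (λ s t → s + α * t) (ι* (pos p) _ (ι* q _ (ι* q _ (ι* q _ refl)))) (cong₂ (λ s t → s + α * t) (ι* q _ (ι* q _ refl))
              (cong₂ (λ s t → s + α * t) (ι* (pos p) _ (ι* q _ (ι* q _ refl))) (ι* q _ refl))))) ⟩
      _ ≡⟨ solve 8 (λ P q α b0 b1 b2 b3 b4 →
            P :* (P :* (P :* (P :* (P :* (α :* (α :* (α :* (α :* α))) :+ P :* (q :* (q :* (q :* b0)) :+ α :* (P :* (q :* (q :* (q :* b1))) :+ α :* (q :* (q :* b2) :+ α :* (P :* (q :* (q :* b3)) :+ α :* (q :* b4)))))))))) :=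
            (let S = P :* α ; M = q :* P :* P in S :* (S :* (S :* (S :* S))) :+ (M :* (M :* (M :* b0)) :+ S :* (M :* (M :* (M :* b1)) :+ S :* (M :* (M :* b2) :+ S :* (M :* (M :* b3) :+ S :* (M :* b4)))))))
            refl P q' α (ι ⟪ b0 ⟫) (ι ⟪ b1 ⟫) (ι ⟪ b2 ⟫) (ι ⟪ b3 ⟫) (ι ⟪ b4 ⟫) ⟩
      _ ≡⟨ cong (λ S → pow5 S + (M * (M * (M * ι ⟪ b0 ⟫)) + S * (M * (M * (M * ι ⟪ b1 ⟫)) + S * (M * (M * ι ⟪ b2 ⟫) + S * (M * (M * ι ⟪ b3 ⟫) + S * (M * ι ⟪ b4 ⟫)))))) Pα ⟩
      _ ≡⟨ cong (pow5 S +_) (cong₂ (λ s t → s + S * t) (m* (conductorP *P (conductorP *P b0)) (m* (conductorP *P b0) (m* b0 refl))) (cong₂ (λ s t → s + S * t) (m* (conductorP *P (conductorP *P b1)) (m* (conductorP *P b1) (m* b1 refl)))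
            (cong₂ (λ s t → s + S * t) (m* (conductorP *P b2) (m* b2 refl)) (cong₂ (λ s t → s + S * t) (m* (conductorP *P b3) (m* b3 refl)) (m* b4 refl))))) ⟨
      _ ≡⟨ cube-relation ⟩
      0# ∎

  good : ∀ p → Prime p → Good p
  good p pr = split (p ℕD.∣? ∣ ⟪ discriminantRoot ⟫ ∣) (p ℕD.∣? ∣ μ ∣)
   where
   split : Dec (p ℕD.∣ ∣ ⟪ discriminantRoot ⟫ ∣) → Dec (p ℕD.∣ ∣ μ ∣) → Good p
   split (yes p∣D) _ = ratio , ratio-Dual.aα , dual⇒PMaximal ⟪ unitIndex *P unitIndex *P conductorP ⟫
        (⟪⟫-*-∤ pr (unitIndex *P unitIndex) conductorP (⟪⟫-*-∤ pr unitIndex unitIndex p∤I p∤I) p∤m) ratio-Dual.bounded , Vec.map ⟪_⟫ unitRatioPolynomial , ratio-Dual.α⁵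
    where
    p∤I : ¬ p ℕD.∣ ∣ ⟪ unitIndex ⟫ ∣
    -- A combination of D and `unitIndex` equals 5, so a common prime would be 5, which does not
    -- divide D.
    p∤I h = 5∤D (subst (λ t → t ℕD.∣ ∣ ⟪ discriminantRoot ⟫ ∣) (∣5⇒≡5 pr 0 (bezout-∣ bezout₁ discriminantRoot bezout₂ unitIndex (pos 5) tt p∣D h)) p∣D)
    p∤m : ¬ p ℕD.∣ ∣ μ ∣
    -- D and m are coprime for every n.
    p∤m h = prime∤1 pr (bezout-∣ bezout₃ discriminantRoot bezout₄ conductorP (pos 1) tt p∣D h)
   split (no p∤D) (no p∤m) = θ , θ-Dual.aα , dual⇒PMaximal ⟪ discriminantRoot *P discriminantRoot *P conductorP ⟫
        (⟪⟫-*-∤ pr (discriminantRoot *P discriminantRoot) conductorP (⟪⟫-*-∤ pr discriminantRoot discriminantRoot p∤D p∤D) p∤m) θ-Dual.bounded , Vec.map ⟪_⟫ coefficientsP , θ-Dual.α⁵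
   split (no _) (yes p∣m) = ramified (p ℕ.≟ 5) (p ℕD.∣? ∣ proj₁ (∣-signed p μ p∣m) ∣)
    where
    q = proj₁ (∣-signed p μ p∣m)
    ramified : Dec (p ≡ 5) → Dec (p ℕD.∣ ∣ q ∣) → Good p
    ramified (yes refl) _ = eisenstein-good pr wild
    ramified (no p≢5) (no p∤q) = eisenstein-good pr (simple pr p≢5 q (proj₂ (∣-signed p μ p∣m)) p∤q)
    ramified (no p≢5) (yes p∣q) = eisenstein-good pr (double pr p≢5 r μ≡ p∤r)
      where
      r = proj₁ (∣-signed p q p∣q)
      μ≡ : μ ≡ r ℤ.* pos p ℤ.* pos p
      μ≡ = trans (proj₂ (∣-signed p μ p∣m)) (cong (ℤ._* pos p) (proj₂ (∣-signed p q p∣q)))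
      p∤r : ¬ p ℕD.∣ ∣ r ∣
      p∤r p∣r = Data.Nat.Primality.¬prime[1] (subst Prime (cube-free p (ℕD.divides ∣ s ∣ (begin
        ∣ μ ∣ ≡⟨ cong ∣_∣ (trans μ≡ (cong (λ t → t ℤ.* pos p ℤ.* pos p) (proj₂ (∣-signed p r p∣r)))) ⟩
        ∣ s ℤ.* pos p ℤ.* pos p ℤ.* pos p ∣ ≡⟨ trans (ℤₚ.∣i*j∣≡∣i∣*∣j∣ (s ℤ.* pos p ℤ.* pos p) (pos p)) (cong (ℕ._* p) (trans (ℤₚ.∣i*j∣≡∣i∣*∣j∣ (s ℤ.* pos p) (pos p)) (cong (ℕ._* p) (ℤₚ.∣i*j∣≡∣i∣*∣j∣ s (pos p))))) ⟩
        ∣ s ∣ ℕ.* p ℕ.* p ℕ.* p ≡⟨ trans (ℕₚ.*-assoc (∣ s ∣ ℕ.* p) p p) (trans (ℕₚ.*-assoc ∣ s ∣ p (p ℕ.* p)) (cong (λ t → ∣ s ∣ ℕ.* (p ℕ.* (p ℕ.* t))) (sym (ℕₚ.*-identityʳ p)))) ⟩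
        ∣ s ∣ ℕ.* p ℕ.^ 3 ∎))) pr)
        where s = proj₁ (∣-signed p r p∣r)

  -- Compared at θ⁴: the coefficient of D σθ is (n + 2)², which is 4 modulo 5, while D θ has
  -- coefficient 0.
  σθ≢θ : σ θ ≢ θ
  σθ≢θ e = from-no (5 ℕD.∣? 4) (constant-term 5∣n (pos 4) (pos 4 ∷ pos 1 ∷ []) (subst (λ z → 5 ℕD.∣ ∣ z ∣) (sym coefficient≡0) (5 ℕD.∣0)))
    where
    same : lcℤ θ (Vec.map ⟪_⟫ conjugate₁) ≡ lcℤ θ (⟪ discriminantRoot ⟫ · Vec.map ⟪_⟫ θP)
    same = trans (sym Dτ) (trans (cong (ι ⟪ discriminantRoot ⟫ *_) (trans (sym σθ) (trans e (sym Eθ)))) (sym (lcℤ-· θ ⟪ discriminantRoot ⟫ (Vec.map ⟪_⟫ θP))))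
    vectors : Vec.map toℚ (Vec.map ⟪_⟫ conjugate₁) ≡ Vec.map toℚ (⟪ discriminantRoot ⟫ · Vec.map ⟪_⟫ θP)
    vectors = trans (sym (coords-lc _)) (trans (cong coords (trans (lc-toℚ θ (Vec.map ⟪_⟫ conjugate₁)) (trans same (sym (lc-toℚ θ (⟪ discriminantRoot ⟫ · Vec.map ⟪_⟫ θP)))))) (coords-lc _))
    coefficient≡0 : ⟪ pos 4 ∷ pos 4 ∷ pos 1 ∷ [] ⟫ ≡ pos 0
    coefficient≡0 = trans (toℚ-injective {⟪ pos 4 ∷ pos 4 ∷ pos 1 ∷ [] ⟫} {⟪ discriminantRoot ⟫ ℤ.* pos 0} (cong (λ v → lookup v 4F) vectors)) (ℤₚ.*-zeroʳ ⟪ discriminantRoot ⟫)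

  not-monogenic : ∀ α → A α → (∀ x → A x → Σ (List ℤ) λ cs → evalℤK cs α ≡ x) → ⊥
  not-monogenic = WildPrime.no-power-basis field-K
    (PowerBasis.Residue.residue field-K coordinates root A-rootₑ e0 e1 e2 e3 e4 p∤e0 equation prime5) θ σθ≢θ
    where open EisensteinAt wild

  InZ : K → K → Set
  InZ α x = Σ (List ℤ) λ cs → evalℤK cs α ≡ x

  index : ∀ p → Prime p → ¬ ¬ (Σ K λ α → A α × (∀ x → Σ (Vec ℚ 5) λ b → lc α b ≡ x) × Σ ℕ λ d → ¬ p ℕD.∣ d ×
    Σ (Fin d → K) λ r → (∀ i → A (r i)) × (∀ i j → InZ α (r i - r j) → i ≡ j) × (∀ x → A x → Σ (Fin d) λ i → InZ α (x - r i)))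
  index p pr none = B.¬¬-index p pr α aα maximal λ (d , p∤d , r , ar , distinct , exhaustive) →
    none (α , aα , B.spanning p pr α aα maximal , d , p∤d , r , ar ,
      (λ i j z → distinct i j (reduce z)) , λ x ax → proj₁ (exhaustive x ax) , polynomial (proj₂ (exhaustive x ax)))
    where
    module B = PowerBasis field-K coordinates
    α = proj₁ (good p pr)
    aα = proj₁ (proj₂ (good p pr))
    maximal = proj₁ (proj₂ (proj₂ (good p pr)))
    g = proj₁ (proj₂ (proj₂ (proj₂ (good p pr))))
    α⁵ = proj₂ (proj₂ (proj₂ (proj₂ (good p pr))))
    Zα : K → Set
    Zα x = Σ (Vec ℤ 5) λ v → x ≡ lcℤ α v
    polynomial : ∀ {x} → Zα x → InZ α x
    polynomial (v@(z0 ∷ z1 ∷ z2 ∷ z3 ∷ z4 ∷ []) , refl) = Vec.toList v ,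
      cong (λ t → ι z0 + α * (ι z1 + α * (ι z2 + α * (ι z3 + α * t)))) (trans (cong (ι z4 +_) (zeroʳ α)) (+-identityʳ (ι z4)))
    powers : ∀ cs → Zα (evalℤK cs α)
    powers [] = pos 0 ∷ pos 0 ∷ pos 0 ∷ pos 0 ∷ pos 0 ∷ [] , sym (trans (lc-const α 0ℚ) const-0)
    powers (c ∷ cs) = let (v , e) = powers cs ; (w , f) = lcℤ-shift α g α⁵ v in
      (c ∷ pos 0 ∷ pos 0 ∷ pos 0 ∷ pos 0 ∷ []) ⊕ w , sym (trans (lcℤ-⊕ α (c ∷ pos 0 ∷ pos 0 ∷ pos 0 ∷ pos 0 ∷ []) w) (cong₂ _+_ (lc-const α (toℚ c)) (sym (trans (cong (α *_) e) f))))
    reduce : ∀ {x} → InZ α x → Zα x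
    reduce (cs , refl) = powers cs

-- The field of the statement

-- In the field of the statement an element is its own coordinate vector. The map v separates the
-- two roles and is the identity where the module is applied.
module Horner (R : ℚAlgebra) where
 open ℚAlgebra R
 module _ (θ : K) (v : Vec ℚ 5 → K)
  (cons : ∀ a b0 b1 b2 b3 → v (a ∷ b0 ∷ b1 ∷ b2 ∷ b3 ∷ []) ≡ const a + θ * v (b0 ∷ b1 ∷ b2 ∷ b3 ∷ 0ℚ ∷ []))
  (constant : ∀ a → v (a ∷ 0ℚ ∷ 0ℚ ∷ 0ℚ ∷ 0ℚ ∷ []) ≡ const a) where

  lc-v : ∀ x → lc θ x ≡ v x
  lc-v (a0 ∷ a1 ∷ a2 ∷ a3 ∷ a4 ∷ []) = sym (trans (cons a0 a1 a2 a3 a4) (cong (λ t → const a0 + θ * t)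
    (trans (cons a1 a2 a3 a4 0ℚ) (cong (λ t → const a1 + θ * t) (trans (cons a2 a3 a4 0ℚ 0ℚ) (cong (λ t → const a2 + θ * t)
      (trans (cons a3 a4 0ℚ 0ℚ 0ℚ) (cong (λ t → const a3 + θ * t) (constant a4)))))))))

  θ*v : ∀ b0 b1 b2 b3 → θ * v (b0 ∷ b1 ∷ b2 ∷ b3 ∷ 0ℚ ∷ []) ≡ v (0ℚ ∷ b0 ∷ b1 ∷ b2 ∷ b3 ∷ [])
  θ*v b0 b1 b2 b3 = sym (trans (cons 0ℚ b0 b1 b2 b3) (trans (cong (_+ θ * v (b0 ∷ b1 ∷ b2 ∷ b3 ∷ 0ℚ ∷ [])) const-0) (+-identityˡ _)))

  relation : ∀ c → θ ≡ v (0ℚ ∷ 1ℚ ∷ 0ℚ ∷ 0ℚ ∷ 0ℚ ∷ []) → θ * v (0ℚ ∷ 0ℚ ∷ 0ℚ ∷ 0ℚ ∷ 1ℚ ∷ []) + v (Vec.map toℚ c) ≡ 0# → pow5 θ + lcℤ θ c ≡ 0#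
  relation c e h = trans (cong₂ _+_
    (cong (θ *_) (trans (cong (θ *_) (trans (cong (θ *_) (trans (cong (θ *_) e) (θ*v 0ℚ 1ℚ 0ℚ 0ℚ))) (θ*v 0ℚ 0ℚ 1ℚ 0ℚ))) (θ*v 0ℚ 0ℚ 0ℚ 1ℚ)))
    (trans (sym (lc-toℚ θ c)) (lc-v (Vec.map toℚ c)))) h

module _ (n : ℤ) where
  open Coeffs n
  open Field n
  open KRing n

  private
    algebraK : ℚAlgebra
    algebraK = record { isCommutativeRing = K-isCommutativeRing ; const = const ; const-+ = const-+ ; const-* = const-*-homo ; const-1 = refl }

  opaque
    θ° : K
    θ° = θn

    θ°≡ : θ° ≡ 0ℚ ∷ 1ℚ ∷ 0ℚ ∷ 0ℚ ∷ 0ℚ ∷ []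
    θ°≡ = refl

    θ°-cons : ∀ a b0 b1 b2 b3 → a ∷ b0 ∷ b1 ∷ b2 ∷ b3 ∷ [] ≡ const a +K (θ° *K (b0 ∷ b1 ∷ b2 ∷ b3 ∷ 0ℚ ∷ []))
    θ°-cons = K-cons

    θ°-* : ∀ x → θ° *K x ≡ mulθ x
    θ°-* = θ-*

  private
    lc-identity : ∀ x → ℚAlgebra.lc algebraK θ° x ≡ x
    lc-identity = Horner.lc-v algebraK θ° (λ x → x) θ°-cons (λ a → refl)

    top-power : (θ° *K (0ℚ ∷ 0ℚ ∷ 0ℚ ∷ 0ℚ ∷ 1ℚ ∷ [])) +K (toℚ c0 ∷ toℚ c1 ∷ toℚ c2 ∷ toℚ c3 ∷ toℚ c4 ∷ []) ≡ 0K
    top-power = trans (cong (_+K (toℚ c0 ∷ toℚ c1 ∷ toℚ c2 ∷ toℚ c3 ∷ toℚ c4 ∷ [])) (θ°-* (0ℚ ∷ 0ℚ ∷ 0ℚ ∷ 0ℚ ∷ 1ℚ ∷ [])))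
      (vec5 (cancel (toℚ c0)) (cancel (toℚ c1)) (cancel (toℚ c2)) (cancel (toℚ c3)) (cancel (toℚ c4)))
      where
      cancel : ∀ q → (0ℚ ℚ.- 1ℚ ℚ.* q) ℚ.+ q ≡ 0ℚ
      cancel q = trans (cong (ℚ._+ q) (trans (ℚₚ.+-identityˡ (ℚ.- (1ℚ ℚ.* q))) (cong (λ t → ℚ.- t) (ℚₚ.*-identityˡ q)))) (ℚₚ.+-inverseˡ q)

    θ-relation : ℚAlgebra.pow5 algebraK θ° +K ℚAlgebra.lcℤ algebraK θ° (c0 ∷ c1 ∷ c2 ∷ c3 ∷ c4 ∷ []) ≡ 0K
    θ-relation = Horner.relation algebraK θ° (λ x → x) θ°-cons (λ a → refl) (c0 ∷ c1 ∷ c2 ∷ c3 ∷ c4 ∷ []) θ°≡ top-power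

  opaque
    quintic : QuinticAlgebra n
    quintic = record { algebra = algebraK ; θ = θ° ; coords = λ x → x ; lc-coords = lc-identity ; coords-lc = lc-identity ; θ⁵ = θ-relation }

  private module Q = QuinticAlgebra quintic

  opaque
    unfolding quintic

    to : K → Q.K
    to x = x

    from : Q.K → K
    from x = x

    to-from : ∀ x → to (from x) ≡ x
    to-from x = refl

    from-to : ∀ x → from (to x) ≡ x
    from-to x = refl

    to-eval : ∀ cs x → to (evalℚ cs x) ≡ Q.evalℚK cs (to x)
    to-eval [] x = refl
    to-eval (c ∷ cs) x = cong (λ t → const c +K (x *K t)) (to-eval cs x)

    to-minus : ∀ x y → to (x -K y) ≡ to x Q.- to y
    to-minus x y = -K-def x y

    to-0 : to 0K ≡ Q.0#
    to-0 = refl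

prime-divisor : ∀ g → g ≢ 1 → Σ ℕ λ p → Prime p × p ℕD.∣ g
-- A common divisor g = 0 has to be excluded too, and every prime divides it.
prime-divisor zero _ = 2 , prime[2] , 2 ℕD.∣0
prime-divisor g@(suc _) g≢1 = go (factors f) (factorsPrime f) (isFactorisation f)
  where
  open PrimeFactorisation
  f = factorise g
  go : ∀ ps → All.All Prime ps → g ≡ List.foldr ℕ._*_ 1 ps → Σ ℕ λ p → Prime p × p ℕD.∣ g
  go [] _ e = contradiction e g≢1
  go (p ∷ ps) (pr All.∷ _) e = p , pr , subst (p ℕD.∣_) (sym e) (ℕD.m∣m*n (List.foldr ℕ._*_ 1 ps))

module Bridge (n : ℤ) where
  open Field n
  private module Q = QuinticAlgebra (quintic n)

  eval-monic : ∀ cs (x : Q.K) → Q.evalℚK (List.map toℚ cs ++ (1ℚ ∷ [])) x ≡ Q.evalMonicK cs x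
  eval-monic [] x = trans (cong₂ Q._+_ Q.const-1 (Q.zeroʳ x)) (Q.+-identityʳ Q.1#)
  eval-monic (c ∷ cs) x = cong (λ t → Q.ι c Q.+ x Q.* t) (eval-monic cs x)

  eval-int : ∀ cs (x : Q.K) → Q.evalℚK (List.map toℚ cs) x ≡ Q.evalℤK cs x
  eval-int [] x = refl
  eval-int (c ∷ cs) x = cong (λ t → Q.ι c Q.+ x Q.* t) (eval-int cs x)

  to-injective : ∀ {x y} → to n x ≡ to n y → x ≡ y
  to-injective {x} {y} e = trans (sym (from-to n x)) (trans (cong (from n) e) (from-to n y))

  integral⇒ : ∀ {x} → Integral x → Σ (List ℤ) λ cs → Q.evalMonicK cs (to n x) ≡ Q.0#
  integral⇒ {x} (cs , e) = cs , trans (sym (eval-monic cs (to n x))) (trans (sym (to-eval n (List.map toℚ cs ++ (1ℚ ∷ [])) x)) (trans (cong (to n) e) (to-0 n)))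

  ⇒integral : ∀ {x} → (Σ (List ℤ) λ cs → Q.evalMonicK cs (to n x) ≡ Q.0#) → Integral x
  ⇒integral {x} (cs , e) = cs , to-injective (trans (to-eval n (List.map toℚ cs ++ (1ℚ ∷ [])) x) (trans (eval-monic cs (to n x)) (trans e (sym (to-0 n)))))

  InZθ⇒ : ∀ {θ x} → InZθ θ x → Σ (List ℤ) λ cs → Q.evalℤK cs (to n θ) ≡ to n x
  InZθ⇒ {θ} (cs , e) = cs , trans (sym (eval-int cs (to n θ))) (trans (sym (to-eval n (List.map toℚ cs) θ)) (cong (to n) e))

  ⇒InZθ : ∀ {θ x} → (Σ (List ℤ) λ cs → Q.evalℤK cs (to n θ) ≡ to n x) → InZθ θ x
  ⇒InZθ {θ} (cs , e) = cs , to-injective (trans (to-eval n (List.map toℚ cs) θ) (trans (eval-int cs (to n θ)) e))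

-- Transport of both results to the definitions of the statement

module _ (n : ℤ) (cube-free : CubeFree (m n)) (5∣n : 5 ℕD.∣ ∣ n ∣) where
  open Field n
  open Bridge n
  open Evaluation n

  private
    m-correct : m n ≡ ⟪ conductorP ⟫
    m-correct = solve 1 (λ n → n :* n :* n :* n :+ con (pos 5) :* n :* n :* n :+ con (pos 15) :* n :* n :+ con (pos 25) :* n :+ con (pos 25)
      := con (pos 25) :+ n :* (con (pos 25) :+ n :* (con (pos 15) :+ n :* (con (pos 5) :+ n :* (con (pos 1) :+ n :* con (pos 0)))))) refl n
      where open ℤSolver.+-*-Solver
    module Q = QuinticAlgebra (quintic n)
    module P = PrimeCases n (quintic n) 5∣n (subst CubeFree m-correct cube-free)
    open AlmostIntegral P.field-K using (Integral⇒A; A⇒Integral; A-≡)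

    to-A : ∀ {x} → Integral x → CyclicQuinticField.A P.field-K (to n x)
    to-A i = Integral⇒A (integral⇒ i)

    from-A : ∀ {x} → CyclicQuinticField.A P.field-K x → Integral (from n x)
    from-A {x} a = ⇒integral (A⇒Integral (A-≡ (sym (to-from n x)) a))

  ¬Monogenic : ¬ Monogenic
  ¬Monogenic (α , i , gen) = P.not-monogenic (to n α) (to-A i) λ x a →
    let (cs , e) = InZθ⇒ (gen (from n x) (from-A a)) in cs , trans e (to-from n x)

  -- If g is not 1, a prime divisor p of g divides every index, in particular that of the generator
  -- chosen for p, whose index is prime to p.
  fieldIndexOne : FieldIndexOne
  fieldIndexOne g divides = decidable-stable (g ℕD.∣? 1) λ g∤1 →
    let (p , pr , p∣g) = prime-divisor g (λ e → g∤1 (subst (ℕD._∣ 1) (sym e) ℕD.∣-refl)) in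
    P.index p pr λ (α , aα , span , d , p∤d , r , ar , distinct , exhaustive) →
      p∤d (ℕD.∣-trans p∣g (divides (from n α) d (from-A aα)
        (λ β → let (b , e) = span (to n β) in Vec.toList b , to-injective (trans (to-eval n (Vec.toList b) (from n α)) (trans (cong (Q.evalℚK (Vec.toList b)) (to-from n α)) (trans (eval-lc α b) e))))
        ((λ i → from n (r i)) , (λ i → from-A (ar i))
        , (λ i j z → distinct i j (let (cs , e) = InZθ⇒ z in cs , trans (cong (Q.evalℤK cs) (sym (to-from n α))) (trans e (trans (to-minus n _ _) (cong₂ Q._-_ (to-from n (r i)) (to-from n (r j)))))))
        , λ β iβ → let (i , cs , e) = exhaustive (to n β) (to-A iβ) in i , ⇒InZθ (cs , trans (cong (Q.evalℤK cs) (to-from n α)) (trans e (trans (cong (λ t → to n β Q.- t) (sym (to-from n (r i)))) (sym (to-minus n β (from n (r i))))))))))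
    where
    eval-lc : ∀ α b → Q.evalℚK (Vec.toList b) α ≡ Q.lc α b
    eval-lc α (b0 ∷ b1 ∷ b2 ∷ b3 ∷ b4 ∷ []) = cong (λ t → Q.const b0 Q.+ α Q.* (Q.const b1 Q.+ α Q.* (Q.const b2 Q.+ α Q.* (Q.const b3 Q.+ α Q.* t))))
      (trans (cong (λ t → Q.const b4 Q.+ t) (Q.zeroʳ α)) (Q.+-identityʳ (Q.const b4)))

open import Data.Integer using (+_)
open import Data.Integer.Divisibility using (_∣_)

theorem1p8 : (n : ℤ) → CubeFree (m n) → (+ 5) ∣ n →
    ¬ Field.Monogenic n × Field.FieldIndexOne n
theorem1p8 n cube-free 5∣n = ¬Monogenic n cube-free 5∣n , fieldIndexOne n cube-free 5∣n
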